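{- Let $n\ge 2$ and let $S$ be a set of $n$ points in $\mathbb{R}^2$. Then the number of unordered pairs $\{p,q\}\subset S$ with $|p-q|=1$ and such that $\{p,q\}$ has rational angle is at most $n^{1+6/\sqrt{\log n}}$, where $\log$ denotes the natural logarithm.
   Context: Identify $\mathbb{R}^2$ with $\mathbb{C}$. A pair of distinct points $p,q$ has rational angle if the segment between them, viewed as the complex number $q-p=re^{\pi i\gamma}$ with $r>0$, has $\gamma\in\mathbb{Q}$; equivalently, the line through $p$ and $q$ makes an angle with the $x$-axis that is a rational multiple of $\pi$. -}

module Defs where

open import Data.Fin as Fin using (Fin)
open import Data.Integer using (+_)
open import Data.List using (List; length)
open import Data.List.Relation.Unary.All using (All)
open import Data.List.Relation.Unary.Unique.Propositional using (Unique)
open import Data.Nat as ℕ using (ℕ; zero; suc; _⊔_; _!)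
import Data.Nat.Properties as ℕ
open import Data.Product using (∃-syntax; _×_; _,_)
open import Data.Rational as ℚ using (ℚ; 0ℚ; 1ℚ; ½; ∣_∣)
import Data.Rational.Properties as ℚ
open import Data.Rational.Solver using (module +-*-Solver)
open import Relation.Binary.PropositionalEquality using (_≡_; refl; sym; cong; subst)
open import Relation.Nullary using (¬_)

-- Real numbers: Cauchy sequences of rationals, up to the equivalence _≈_.

IsCauchy : (ℕ → ℚ) → Set
IsCauchy x =
  ∀ (ε : ℚ) → 0ℚ ℚ.< ε → ∃[ N ] (∀ m n → N ℕ.≤ m → N ℕ.≤ n → ∣ x m ℚ.- x n ∣ ℚ.< ε)

record ℝ : Set where
  constructor mkℝ
  field
    seq    : ℕ → ℚ
    cauchy : IsCauchy seq

open ℝ public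

infix 4 _≈_ _<_ _≤_

_≈_ : ℝ → ℝ → Set
x ≈ y = ∀ (ε : ℚ) → 0ℚ ℚ.< ε → ∃[ N ] (∀ n → N ℕ.≤ n → ∣ seq x n ℚ.- seq y n ∣ ℚ.< ε)

_<_ : ℝ → ℝ → Set
x < y = ∃[ ε ] (0ℚ ℚ.< ε × ∃[ N ] (∀ n → N ℕ.≤ n → seq x n ℚ.+ ε ℚ.< seq y n))

_≤_ : ℝ → ℝ → Set
x ≤ y = ¬ (y < x)

0<½*_ : ∀ {ε} → 0ℚ ℚ.< ε → 0ℚ ℚ.< ½ ℚ.* ε
0<½*_ {ε} 0<ε = ℚ.positive⁻¹ (½ ℚ.* ε) {{ℚ.pos*pos⇒pos ½ ε {{ℚ.positive 0<ε}}}}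

½+½ : ∀ ε → ½ ℚ.* ε ℚ.+ ½ ℚ.* ε ≡ ε
½+½ = solve 1 (λ e → con ½ :* e :+ con ½ :* e := e) refl
  where open +-*-Solver

+-cauchy : ∀ x y → IsCauchy x → IsCauchy y → IsCauchy (λ n → x n ℚ.+ y n)
+-cauchy x y cx cy ε 0<ε with cx (½ ℚ.* ε) (0<½* 0<ε) | cy (½ ℚ.* ε) (0<½* 0<ε)
... | M , p | N , q = M ⊔ N , λ m n M⊔N≤m M⊔N≤n → begin-strict
  ∣ (x m ℚ.+ y m) ℚ.- (x n ℚ.+ y n) ∣      ≡⟨ cong ∣_∣ (rearrange (x m) (y m) (x n) (y n)) ⟩
  ∣ (x m ℚ.- x n) ℚ.+ (y m ℚ.- y n) ∣      ≤⟨ ℚ.∣p+q∣≤∣p∣+∣q∣ (x m ℚ.- x n) (y m ℚ.- y n) ⟩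
  ∣ x m ℚ.- x n ∣ ℚ.+ ∣ y m ℚ.- y n ∣      <⟨ ℚ.+-mono-< (p m n (ℕ.m⊔n≤o⇒m≤o M N M⊔N≤m) (ℕ.m⊔n≤o⇒m≤o M N M⊔N≤n))
                                                          (q m n (ℕ.m⊔n≤o⇒n≤o M N M⊔N≤m) (ℕ.m⊔n≤o⇒n≤o M N M⊔N≤n)) ⟩
  ½ ℚ.* ε ℚ.+ ½ ℚ.* ε                      ≡⟨ ½+½ ε ⟩
  ε                                        ∎
  where
  open ℚ.≤-Reasoning
  open +-*-Solver
  rearrange : ∀ a b c d → (a ℚ.+ b) ℚ.- (c ℚ.+ d) ≡ (a ℚ.- c) ℚ.+ (b ℚ.- d)
  rearrange = solve 4 (λ a b c d → (a :+ b) :- (c :+ d) := (a :- c) :+ (b :- d)) refl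

neg-cauchy : ∀ x → IsCauchy x → IsCauchy (λ n → ℚ.- x n)
neg-cauchy x cx ε 0<ε with cx ε 0<ε
... | N , p = N , λ m n N≤m N≤n →
  subst (ℚ._< ε) (cong ∣_∣ (swap (x m) (x n))) (p n m N≤n N≤m)
  where
  open +-*-Solver
  swap : ∀ a b → b ℚ.- a ≡ (ℚ.- a) ℚ.- (ℚ.- b)
  swap = solve 2 (λ a b → b :- a := (:- a) :- (:- b)) refl

bounded : ∀ {x} → IsCauchy x →
          ∃[ M ] (ℚ.Positive M × ∃[ N ] (∀ n → N ℕ.≤ n → ∣ x n ∣ ℚ.≤ M))
bounded {x} cx with cx 1ℚ (ℚ.positive⁻¹ 1ℚ)
... | N , p = 1ℚ ℚ.+ ∣ x N ∣
            , ℚ.pos+nonNeg⇒pos 1ℚ ∣ x N ∣ {{ℚ.nonNegative (ℚ.0≤∣p∣ (x N))}}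
            , N , λ n N≤n → begin
  ∣ x n ∣                        ≡⟨ cong ∣_∣ (split (x n) (x N)) ⟩
  ∣ (x n ℚ.- x N) ℚ.+ x N ∣      ≤⟨ ℚ.∣p+q∣≤∣p∣+∣q∣ (x n ℚ.- x N) (x N) ⟩
  ∣ x n ℚ.- x N ∣ ℚ.+ ∣ x N ∣    ≤⟨ ℚ.+-monoˡ-≤ ∣ x N ∣ (ℚ.<⇒≤ (p n N N≤n ℕ.≤-refl)) ⟩
  1ℚ ℚ.+ ∣ x N ∣                 ∎
  where
  open ℚ.≤-Reasoning
  open +-*-Solver
  split : ∀ a b → a ≡ (a ℚ.- b) ℚ.+ b
  split = solve 2 (λ a b → a := (a :- b) :+ b) refl

scaled : ∀ (M ε : ℚ) → ℚ.Positive M → 0ℚ ℚ.< ε →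
         ∃[ δ ] (0ℚ ℚ.< δ × (∀ a b → ∣ a ∣ ℚ.< δ → ∣ b ∣ ℚ.≤ M → ∣ a ℚ.* b ∣ ℚ.< ε))
scaled M ε M>0 0<ε = δ , ℚ.positive⁻¹ δ {{δ>0}} , λ a b ∣a∣<δ ∣b∣≤M → begin-strict
  ∣ a ℚ.* b ∣            ≡⟨ ℚ.∣p*q∣≡∣p∣*∣q∣ a b ⟩
  ∣ a ∣ ℚ.* ∣ b ∣        ≤⟨ ℚ.*-monoˡ-≤-nonNeg ∣ a ∣ {{ℚ.nonNegative (ℚ.0≤∣p∣ a)}} ∣b∣≤M ⟩
  ∣ a ∣ ℚ.* M            <⟨ ℚ.*-monoˡ-<-pos M {{M>0}} ∣a∣<δ ⟩
  (ε ℚ.* 1/M) ℚ.* M      ≡⟨ ℚ.*-assoc ε 1/M M ⟩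
  ε ℚ.* (1/M ℚ.* M)      ≡⟨ cong (ε ℚ.*_) (ℚ.*-inverseˡ M {{M≢0}}) ⟩
  ε ℚ.* 1ℚ               ≡⟨ ℚ.*-identityʳ ε ⟩
  ε                      ∎
  where
  open ℚ.≤-Reasoning
  M≢0 = ℚ.pos⇒nonZero M {{M>0}}
  1/M = ℚ.1/_ M {{M≢0}}
  δ   = ε ℚ.* 1/M
  δ>0 : ℚ.Positive δ
  δ>0 = ℚ.pos*pos⇒pos ε {{ℚ.positive 0<ε}} 1/M {{ℚ.1/pos⇒pos M {{M>0}}}}

*-cauchy : ∀ x y → IsCauchy x → IsCauchy y → IsCauchy (λ n → x n ℚ.* y n)
*-cauchy x y cx cy ε 0<ε =
  let A , A>0 , I , ∣x∣≤A = bounded cx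
      B , B>0 , J , ∣y∣≤B = bounded cy
      δ , 0<δ , f = scaled B (½ ℚ.* ε) B>0 (0<½* 0<ε)
      η , 0<η , g = scaled A (½ ℚ.* ε) A>0 (0<½* 0<ε)
      M , p = cx δ 0<δ
      N , q = cy η 0<η
  in (I ⊔ J) ⊔ (M ⊔ N) , λ m n K≤m K≤n →
  let J≤m = ℕ.m⊔n≤o⇒n≤o I J (ℕ.m⊔n≤o⇒m≤o (I ⊔ J) (M ⊔ N) K≤m)
      I≤n = ℕ.m⊔n≤o⇒m≤o I J (ℕ.m⊔n≤o⇒m≤o (I ⊔ J) (M ⊔ N) K≤n)
      MN≤m = ℕ.m⊔n≤o⇒n≤o (I ⊔ J) (M ⊔ N) K≤m
      MN≤n = ℕ.m⊔n≤o⇒n≤o (I ⊔ J) (M ⊔ N) K≤n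
  in close (x m) (y m) (x n) (y n)
       (f (x m ℚ.- x n) (y m)
          (p m n (ℕ.m⊔n≤o⇒m≤o M N MN≤m) (ℕ.m⊔n≤o⇒m≤o M N MN≤n)) (∣y∣≤B m J≤m))
       (g (y m ℚ.- y n) (x n)
          (q m n (ℕ.m⊔n≤o⇒n≤o M N MN≤m) (ℕ.m⊔n≤o⇒n≤o M N MN≤n)) (∣x∣≤A n I≤n))
  where
  open ℚ.≤-Reasoning
  open +-*-Solver
  rearrange : ∀ a b c d →
    a ℚ.* b ℚ.- c ℚ.* d ≡ (a ℚ.- c) ℚ.* b ℚ.+ (b ℚ.- d) ℚ.* c
  rearrange = solve 4 (λ a b c d → a :* b :- c :* d := (a :- c) :* b :+ (b :- d) :* c) refl

  close : ∀ a b c d →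
    ∣ (a ℚ.- c) ℚ.* b ∣ ℚ.< ½ ℚ.* ε → ∣ (b ℚ.- d) ℚ.* c ∣ ℚ.< ½ ℚ.* ε →
    ∣ a ℚ.* b ℚ.- c ℚ.* d ∣ ℚ.< ε
  close a b c d h k = begin-strict
    ∣ a ℚ.* b ℚ.- c ℚ.* d ∣                              ≡⟨ cong ∣_∣ (rearrange a b c d) ⟩
    ∣ (a ℚ.- c) ℚ.* b ℚ.+ (b ℚ.- d) ℚ.* c ∣              ≤⟨ ℚ.∣p+q∣≤∣p∣+∣q∣ ((a ℚ.- c) ℚ.* b) ((b ℚ.- d) ℚ.* c) ⟩
    ∣ (a ℚ.- c) ℚ.* b ∣ ℚ.+ ∣ (b ℚ.- d) ℚ.* c ∣          <⟨ ℚ.+-mono-< h k ⟩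
    ½ ℚ.* ε ℚ.+ ½ ℚ.* ε                                  ≡⟨ ½+½ ε ⟩
    ε                                                    ∎

infixl 6 _+_ _-_
infixl 7 _*_
infix  8 -_

fromℚ : ℚ → ℝ
fromℚ q = mkℝ (λ _ → q) λ ε 0<ε →
  0 , λ _ _ _ _ → subst (ℚ._< ε) (sym (cong ∣_∣ (ℚ.+-inverseʳ q))) 0<ε

fromℕ : ℕ → ℝ
fromℕ n = fromℚ (+ n ℚ./ 1)

0ℝ 1ℝ : ℝ
0ℝ = fromℕ 0
1ℝ = fromℕ 1

_+_ : ℝ → ℝ → ℝ
x + y = mkℝ (λ n → seq x n ℚ.+ seq y n) (+-cauchy (seq x) (seq y) (cauchy x) (cauchy y))

_*_ : ℝ → ℝ → ℝ
x * y = mkℝ (λ n → seq x n ℚ.* seq y n) (*-cauchy (seq x) (seq y) (cauchy x) (cauchy y))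

-_ : ℝ → ℝ
- x = mkℝ (λ n → ℚ.- seq x n) (neg-cauchy (seq x) (cauchy x))

_-_ : ℝ → ℝ → ℝ
x - y = x + (- y)

infix 4 _⟶_

_⟶_ : (ℕ → ℝ) → ℝ → Set
a ⟶ L = ∀ (ε : ℚ) → 0ℚ ℚ.< ε →
  ∃[ N ] (∀ n → N ℕ.≤ n → (L - fromℚ ε < a n) × (a n < L + fromℚ ε))

-- The plane ℝ², identified with ℂ.

record ℂ : Set where
  constructor _+i_
  field
    re im : ℝ

open ℂ public

infix  4 _≈ℂ_ _⟶ℂ_
infix  5 _+i_
infixl 6 _+ℂ_ _-ℂ_
infixl 7 _*ℂ_
infixr 8 _^ℂ_

_≈ℂ_ : ℂ → ℂ → Set
z ≈ℂ w = re z ≈ re w × im z ≈ im w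

fromℝ : ℝ → ℂ
fromℝ x = x +i 0ℝ

𝕚 : ℂ
𝕚 = 0ℝ +i 1ℝ

_+ℂ_ : ℂ → ℂ → ℂ
z +ℂ w = (re z + re w) +i (im z + im w)

_-ℂ_ : ℂ → ℂ → ℂ
z -ℂ w = (re z - re w) +i (im z - im w)

_*ℂ_ : ℂ → ℂ → ℂ
z *ℂ w = (re z * re w - im z * im w) +i (re z * im w + im z * re w)

_^ℂ_ : ℂ → ℕ → ℂ
z ^ℂ zero  = fromℝ 1ℝ
z ^ℂ suc n = z *ℂ z ^ℂ n

_⟶ℂ_ : (ℕ → ℂ) → ℂ → Set
a ⟶ℂ w = (λ n → re (a n)) ⟶ re w × (λ n → im (a n)) ⟶ im w

-- Elementary functions are given by their graphs: "IsF x y" says that y is the value of F at x.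

1/_! : ℕ → ℚ
1/ k ! = (+ 1 ℚ./ (k !)) {{k ℕ.!≢0}}

expSum : ℂ → ℕ → ℂ
expSum z zero    = fromℝ 0ℝ
expSum z (suc k) = expSum z k +ℂ fromℝ (fromℚ (1/ k !)) *ℂ z ^ℂ k

IsExpℂ : ℂ → ℂ → Set
IsExpℂ z w = expSum z ⟶ℂ w

IsExp : ℝ → ℝ → Set
IsExp x y = IsExpℂ (fromℝ x) (fromℝ y)

IsCos : ℝ → ℝ → Set
IsCos t c = ∃[ w ] (IsExpℂ (𝕚 *ℂ fromℝ t) w × re w ≈ c)

-- π is twice the least positive zero of the cosine.
Isπ : ℝ → Set
Isπ π = ∃[ h ] (0ℝ < h × IsCos h 0ℝ × (∀ t → 0ℝ < t → t < h → ¬ IsCos t 0ℝ) × π ≈ h + h)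

IsLog : ℝ → ℝ → Set
IsLog x ℓ = IsExp ℓ x

IsSqrt : ℝ → ℝ → Set
IsSqrt x s = 0ℝ ≤ s × s * s ≈ x

IsQuotient : ℝ → ℝ → ℝ → Set
IsQuotient x y q = ¬ (y ≈ 0ℝ) × q * y ≈ x

-- For x > 0, x to the power y is exp (y log x).
IsPower : ℝ → ℝ → ℝ → Set
IsPower x y z = ∃[ ℓ ] (IsLog x ℓ × IsExp (y * ℓ) z)

IsDistance : ℂ → ℂ → ℝ → Set
IsDistance p q d = IsSqrt (re z * re z + im z * im z) d
  where z = p -ℂ q

RationalAngle : ℂ → ℂ → Set
RationalAngle p q =
  ∃[ π ] ∃[ γ ] ∃[ r ] ∃[ w ]
    (Isπ π × 0ℝ < r × IsExpℂ (𝕚 *ℂ fromℝ (π * fromℚ γ)) w × (q -ℂ p) ≈ℂ fromℝ r *ℂ w)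

-- Unordered pairs of points of S are represented by their indices i < j.
UnitRationalPair : ∀ {n} → (Fin n → ℂ) → Fin n × Fin n → Set
UnitRationalPair S (i , j) =
  i Fin.< j × IsDistance (S i) (S j) 1ℝ × RationalAngle (S i) (S j)

-- P holds for at most B elements: B bounds the length of every repetition-free list of them.
AtMost : {A : Set} → ℝ → (A → Set) → Set
AtMost {A} B P = ∀ (xs : List A) → Unique xs → All P xs → fromℕ (length xs) ≤ B

{-# OPTIONS --safe #-}

-- Unit vectors of rational angle are roots of unity, so the directions of all the pairs are powers of one
-- ζ of exact order N.  If B is a set of powers of ζ that is linearly independent over ℤ, then n < 2^(t+1)
-- points have at most n t pairs with difference in B: cut along a hyperplane orthogonal to one direction,
-- where the cut edges form a matching, and induct.  It remains to find, among at most n² directions counted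
-- with multiplicity, an independent subfamily containing at least the fraction 1/(2t+2)² of them.
--
-- Strip the primes p off N, the largest first.  Let N = p N′.  Galois conjugation shows that a linear
-- relation between powers of ζ splits into relations inside the p residue classes of the exponents modulo p
-- if p ∣ N′, and also if p ∤ N′ provided that one of the classes is empty.  Hence the classes can be treated
-- separately, after dropping the smallest one when p ∤ N′.  The primes up to A lose a factor
-- ∏ p/(p-1) ≤ A altogether; for the larger primes all classes but one have at most half of the elements,
-- and what is gained there pays for the dropped class.
--
-- This gives at most 16 n t³ pairs, and for 2^t ≤ n the Taylor term of order 6 of the exponential yields
-- n^(1 + 6/√(log n)) = n e^(6√(log n)) ≥ n (6√(log n))⁶/6! ≥ 16 n t³ because log n ≥ ⅔ t.

module Submission where

open import Algebra.Bundles using (CommutativeRing)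
import Algebra.Solver.Ring as RingSolver
open import Algebra.Solver.Ring.AlmostCommutativeRing using (fromCommutativeRing; _-Raw-AlmostCommutative⟶_)
open import Algebra.Structures using (IsCommutativeRing)
open import Data.Bool using (Bool; true; false; if_then_else_)
open import Data.Empty using (⊥)
open import Data.Fin as Fin using (Fin)
import Data.Fin.Properties as Fin
open import Data.Integer as ℤ using (ℤ; +_; -[1+_]; _⊖_)
import Data.Integer.Properties as ℤ
open import Data.List using (List; []; _∷_; _++_; length; filter; map; allFin)
open import Data.List.Membership.Propositional using (_∈_)
open import Data.List.Membership.Propositional.Properties using (∈-∃++; ∈-++⁻; ∈-++⁺ˡ; ∈-++⁺ʳ; ∈-filter⁺; ∈-filter⁻; ∈-allFin; ∈-length)
open import Data.List.Properties using (length-++; length-tabulate)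
open import Data.List.Relation.Unary.All as All using (All; []; _∷_)
open import Data.List.Relation.Unary.AllPairs using ([]; _∷_)
open import Data.List.Relation.Unary.Any using (here; there)
open import Data.List.Relation.Unary.Unique.Propositional using (Unique)
import Data.List.Relation.Unary.Unique.Propositional.Properties as Unique
open import Data.Maybe using (Maybe; just; nothing)
open import Data.Nat as ℕ using (ℕ; zero; suc; NonZero; _%_; _/_; _∸_; _⊔_; _!)
open import Data.Nat.Combinatorics using (nCn≡1; nCk+nC[k+1]≡[n+1]C[k+1]; k>n⇒nCk≡0) renaming (_C_ to _choose_)
import Data.Nat.DivMod as ℕ
open import Data.Nat.Divisibility using (_∣_; _∤_; _∣?_; divides; ∣m⇒∣m*n; ∣n⇒∣m*n; ∣m+n∣m⇒∣n; ∣-trans; ∣1⇒≡1; m∣m*n; *-cancelˡ-∣; ∣⇒≤; m%n≡0⇒n∣m)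
open import Data.Nat.Induction using (<-rec)
open import Data.Nat.ListAction using (product)
open import Data.Nat.Primality using (Prime; prime?; euclidsLemma; prime⇒irreducible; ¬prime[1])
open import Data.Nat.Primality.Factorisation using (factorise; PrimeFactorisation)
import Data.Nat.Properties as ℕ
open import Data.Nat.Solver using (module +-*-Solver)
open import Data.Product using (∃-syntax; _×_; _,_; proj₁; proj₂; uncurry)
open import Data.Rational as ℚ using (ℚ; mkℚ; 0ℚ; 1ℚ; ½; ∣_∣; ↥_; ↧ₙ_)
import Data.Rational.Properties as ℚ
import Data.Rational.Unnormalised as ℚᵘ
import Data.Rational.Unnormalised.Properties as ℚᵘ
open import Data.Sum using (_⊎_; inj₁; inj₂; [_,_]′)
open import Function using (_∘_; id; const)
open import Function.Definitions using (Injective)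
open import Level using (0ℓ)
open import Relation.Binary.PropositionalEquality as ≡ using (_≡_; _≢_)
open import Relation.Nullary using (¬_; Dec; yes; no; does; contradiction)
open import Relation.Nullary.Decidable using (¬¬-excluded-middle; _×-dec_; ¬?; dec-true; dec-false; decidable-stable; from-yes)
open import Relation.Unary using (Decidable)

-- Equality in ℂ is not decidable, and neither is membership in a half space or in a span. But
-- equality of reals is stable, and the bounds on pairs are inequalities of natural numbers, so case
-- distinctions are made under a double negation that the conclusion absorbs. Relations over ℤ are
-- pairs of lists of exponents with equal values, and conjugation is a statement about evaluating
-- both lists at ζ^m; no minimal polynomial or field automorphism is constructed.
--
-- Two parameters measure the loss of a selection. A prime p raises a factor p - 1 to p, and ∏
-- p/(p-1) over the primes up to A is at most the telescoping product over all integers from 2 to A,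
-- which is A. For p > A the induction keeps the factor A τ for lists of fewer than 2^τ directions:
-- at most one class can reach 2^(τ-1), and the others enjoy the better factor A (τ-1). The choice A
-- = τ = 2t + 2 meets n² < 2^τ and τ ≤ A, and gives (2t+2)².

-- Integers in a commutative ring

module IntegerMultiples (R : CommutativeRing 0ℓ 0ℓ) where

  open CommutativeRing R
  open import Algebra.Properties.Ring ring public
  open import Algebra.Properties.Monoid.Mult +-monoid using () renaming (_×_ to _·_)
  open import Algebra.Properties.Monoid.Mult +-monoid using (×-homo-+; ×-homo-1)
  open import Algebra.Properties.Semiring.Mult semiring using (×1-homo-*)
  open import Relation.Binary.Reasoning.Setoid setoid

  ι : ℤ → Carrier
  ι (+ n)     = n · 1#
  ι (-[1+ n ]) = - (suc n · 1#)

  private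
    cancel-1# : ∀ x y → (1# + x) - (1# + y) ≈ x - y
    cancel-1# x y = begin
      (1# + x) - (1# + y)          ≈⟨ +-congˡ (-‿+-comm 1# y) ⟨
      (1# + x) + (- 1# + - y)      ≈⟨ +-congʳ (+-comm 1# x) ⟩
      (x + 1#) + (- 1# + - y)      ≈⟨ +-assoc x 1# _ ⟩
      x + (1# + (- 1# + - y))      ≈⟨ +-congˡ (+-assoc 1# (- 1#) (- y)) ⟨
      x + ((1# + - 1#) + - y)      ≈⟨ +-congˡ (+-congʳ (-‿inverseʳ 1#)) ⟩
      x + (0# + - y)               ≈⟨ +-congˡ (+-identityˡ (- y)) ⟩
      x - y                        ∎

  ι-⊖ : ∀ m n → ι (m ⊖ n) ≈ m · 1# - n · 1#
  ι-⊖ zero    zero    = sym (-‿inverseʳ 0#)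
  ι-⊖ zero    (suc n) = sym (+-identityˡ _)
  ι-⊖ (suc m) zero    = sym (trans (+-congˡ -0#≈0#) (+-identityʳ _))
  ι-⊖ (suc m) (suc n) = begin
    ι (suc m ⊖ suc n)                  ≡⟨ ≡.cong ι (ℤ.[1+m]⊖[1+n]≡m⊖n m n) ⟩
    ι (m ⊖ n)                          ≈⟨ ι-⊖ m n ⟩
    m · 1# - n · 1#                    ≈⟨ cancel-1# (m · 1#) (n · 1#) ⟨
    suc m · 1# - suc n · 1#            ∎

  ι-neg : ∀ i → ι (ℤ.- i) ≈ - ι i
  ι-neg (+ zero)  = sym -0#≈0#
  ι-neg (+ suc n) = refl
  ι-neg -[1+ n ]  = sym (-‿involutive _)

  ι-+ : ∀ i j → ι (i ℤ.+ j) ≈ ι i + ι j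
  ι-+ (+ m)     (+ n)     = ×-homo-+ 1# m n
  ι-+ (+ m)     -[1+ n ]  = ι-⊖ m (suc n)
  ι-+ -[1+ m ]  (+ n)     = trans (ι-⊖ n (suc m)) (+-comm _ _)
  ι-+ -[1+ m ]  -[1+ n ]  = begin
    - (suc (suc (m ℕ.+ n)) · 1#)      ≡⟨ ≡.cong (λ k → - (suc k · 1#)) (ℕ.+-suc m n) ⟨
    - ((suc m ℕ.+ suc n) · 1#)        ≈⟨ -‿cong (×-homo-+ 1# (suc m) (suc n)) ⟩
    - (suc m · 1# + suc n · 1#)       ≈⟨ -‿+-comm _ _ ⟨
    - (suc m · 1#) - suc n · 1#       ∎

  ι-pos* : ∀ m j → ι (+ m ℤ.* j) ≈ ι (+ m) * ι j
  ι-pos* m (+ n)    = begin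
    ι (+ m ℤ.* + n)       ≡⟨ ≡.cong ι (ℤ.pos-* m n) ⟨
    (m ℕ.* n) · 1#        ≈⟨ ×1-homo-* m n ⟩
    (m · 1#) * (n · 1#)   ∎
  ι-pos* m -[1+ n ] = begin
    ι (+ m ℤ.* -[1+ n ])             ≡⟨ ≡.cong ι (ℤ.neg-distribʳ-* (+ m) (+ suc n)) ⟨
    ι (ℤ.- (+ m ℤ.* + suc n))        ≈⟨ ι-neg (+ m ℤ.* + suc n) ⟩
    - ι (+ m ℤ.* + suc n)            ≈⟨ -‿cong (ι-pos* m (+ suc n)) ⟩
    - (ι (+ m) * ι (+ suc n))        ≈⟨ -‿distribʳ-* _ _ ⟩
    ι (+ m) * ι -[1+ n ]             ∎

  ι-* : ∀ i j → ι (i ℤ.* j) ≈ ι i * ι j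
  ι-* (+ m)    j = ι-pos* m j
  ι-* -[1+ m ] j = begin
    ι (-[1+ m ] ℤ.* j)           ≡⟨ ≡.cong ι (ℤ.neg-distribˡ-* (+ suc m) j) ⟨
    ι (ℤ.- (+ suc m ℤ.* j))      ≈⟨ ι-neg (+ suc m ℤ.* j) ⟩
    - ι (+ suc m ℤ.* j)          ≈⟨ -‿cong (ι-pos* (suc m) j) ⟩
    - (ι (+ suc m) * ι j)        ≈⟨ -‿distribˡ-* _ _ ⟩
    ι -[1+ m ] * ι j             ∎

  ι-morphism : ℤ.+-*-rawRing -Raw-AlmostCommutative⟶ fromCommutativeRing R
  ι-morphism = record
    { ⟦_⟧    = ι
    ; +-homo = ι-+
    ; *-homo = ι-*
    ; -‿homo = ι-neg
    ; 0-homo = refl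
    ; 1-homo = ×-homo-1 1#
    }

  ι-≟ : ∀ i j → Maybe (ι i ≈ ι j)
  ι-≟ i j with i ℤ.≟ j
  ... | yes i≡j = just (reflexive (≡.cong ι i≡j))
  ... | no _    = nothing

  -- Coefficients are integers rather than ring elements: their equality is decidable, so terms can
  -- be cancelled even where equality in `R` cannot be decided.
  module Solver = RingSolver ℤ.+-*-rawRing (fromCommutativeRing R) ι-morphism ι-≟

-- The Frobenius congruence for power sums

-- The absorption identity in a form without division, to which Euclid's lemma applies.
[k+1]*nC[k+1] : ∀ n k → suc k ℕ.* (suc n choose suc k) ≡ suc n ℕ.* (n choose k)
[k+1]*nC[k+1] zero    zero    = ≡.refl
[k+1]*nC[k+1] zero    (suc k) = ≡.trans (≡.cong (suc (suc k) ℕ.*_) (k>n⇒nCk≡0 {1} {suc (suc k)} (ℕ.s≤s (ℕ.s≤s ℕ.z≤n))))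
                                        (ℕ.*-zeroʳ (suc (suc k)))
[k+1]*nC[k+1] (suc n) zero    = begin
  1 ℕ.* (suc (suc n) choose 1)       ≡⟨ ℕ.*-identityˡ _ ⟩
  suc (suc n) choose 1               ≡⟨ nCk+nC[k+1]≡[n+1]C[k+1] (suc n) 0 ⟨
  1 ℕ.+ (suc n choose 1)             ≡⟨ ≡.cong (1 ℕ.+_) (≡.trans (≡.sym (ℕ.*-identityˡ _)) ([k+1]*nC[k+1] n 0)) ⟩
  1 ℕ.+ suc n ℕ.* 1             ∎
  where open ≡.≡-Reasoning
[k+1]*nC[k+1] (suc n) (suc k) = begin
  suc (suc k) ℕ.* (suc (suc n) choose suc (suc k))
    ≡⟨ ≡.cong (suc (suc k) ℕ.*_) (nCk+nC[k+1]≡[n+1]C[k+1] (suc n) (suc k)) ⟨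
  suc (suc k) ℕ.* (a ℕ.+ b)
    ≡⟨ solve 3 (λ k a b → (con 2 :+ k) :* (a :+ b) := (con 1 :+ k) :* a :+ a :+ (con 2 :+ k) :* b) ≡.refl k a b ⟩
  suc k ℕ.* a ℕ.+ a ℕ.+ suc (suc k) ℕ.* b
    ≡⟨ ≡.cong₂ (λ u v → u ℕ.+ a ℕ.+ v) ([k+1]*nC[k+1] n k) ([k+1]*nC[k+1] n (suc k)) ⟩
  suc n ℕ.* (n choose k) ℕ.+ a ℕ.+ suc n ℕ.* (n choose suc k)
    ≡⟨ solve 4 (λ n u v a → n :* u :+ a :+ n :* v := n :* (u :+ v) :+ a) ≡.refl (suc n) (n choose k) (n choose suc k) a ⟩
  suc n ℕ.* (n choose k ℕ.+ n choose suc k) ℕ.+ a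
    ≡⟨ ≡.cong (λ u → suc n ℕ.* u ℕ.+ a) (nCk+nC[k+1]≡[n+1]C[k+1] n k) ⟩
  suc n ℕ.* a ℕ.+ a
    ≡⟨ ℕ.+-comm _ a ⟩
  suc (suc n) ℕ.* a ∎
  where
  open ≡.≡-Reasoning
  open +-*-Solver
  a = suc n choose suc k
  b = suc n choose suc (suc k)

-- By the absorption identity the prime divides the product of k+1 and the binomial coefficient, and
-- it is too large to divide k+1.
prime∣binomial : ∀ {p} → Prime (suc p) → ∀ k → k ℕ.< p → suc p ∣ (suc p choose suc k)
prime∣binomial {p} pr k k<p with euclidsLemma (suc k) (suc p choose suc k) pr
  (divides (p choose k) (≡.trans ([k+1]*nC[k+1] p k) (ℕ.*-comm (suc p) (p choose k))))
... | inj₁ p∣k = contradiction (∣⇒≤ p∣k) (ℕ.<⇒≱ (ℕ.s≤s k<p))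
... | inj₂ p∣C = p∣C

module PowerSums (R : CommutativeRing 0ℓ 0ℓ) where

  open CommutativeRing R
  open IntegerMultiples R public
  open import Algebra.Properties.Semiring.Exp semiring public using (_^_; ^-congˡ; ^-congʳ; ^-homo-*; ^-assocʳ)
  open import Algebra.Properties.CommutativeSemiring.Exp commutativeSemiring public using (^-distrib-*)
  open import Algebra.Properties.CommutativeSemiring.Binomial commutativeSemiring using (binomialTerm; theorem)
  open import Algebra.Properties.Monoid.Sum +-monoid using (sum; sum-init-last)
  open import Algebra.Properties.Monoid.Mult +-monoid using (×-assocˡ; ×-congʳ; ×-homo-1) renaming (_×_ to _·_)
  open import Algebra.Properties.Semiring.Mult semiring using (×-assoc-*)
  open import Relation.Binary.Reasoning.Setoid setoid
  open Solver

  1^n≈1 : ∀ n → 1# ^ n ≈ 1#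
  1^n≈1 zero    = refl
  1^n≈1 (suc n) = trans (*-identityˡ _) (1^n≈1 n)

  -- The polynomial ∑ X^e over the exponents e in the list, evaluated at z.
  ev : Carrier → List ℕ → Carrier
  ev z []      = 0#
  ev z (e ∷ L) = z ^ e + ev z L

  ev-cong : ∀ {z z'} L → z ≈ z' → ev z L ≈ ev z' L
  ev-cong []      z≈z' = refl
  ev-cong (e ∷ L) z≈z' = +-cong (^-congˡ e z≈z') (ev-cong L z≈z')

  ev-++ : ∀ z L M → ev z (L ++ M) ≈ ev z L + ev z M
  ev-++ z []      M = sym (+-identityˡ _)
  ev-++ z (e ∷ L) M = trans (+-congˡ (ev-++ z L M)) (sym (+-assoc _ _ _))

  ev-shift : ∀ z d L → ev z (map (d ℕ.+_) L) ≈ z ^ d * ev z L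
  ev-shift z d []      = sym (zeroʳ _)
  ev-shift z d (e ∷ L) = trans (+-cong (^-homo-* z d e) (ev-shift z d L)) (sym (distribˡ _ _ _))

  -- Nonnegative coefficients suffice, as binomial expansions of power sums involve no subtraction.
  -- Explicit exponents later place the error terms in a finitely generated group.
  IsEv : Carrier → Carrier → Set
  IsEv z x = ∃[ H ] x ≈ ev z H

  isEv-+ : ∀ {z x y} → IsEv z x → IsEv z y → IsEv z (x + y)
  isEv-+ {z} (H , x≈) (K , y≈) = H ++ K , trans (+-cong x≈ y≈) (sym (ev-++ z H K))

  ev-* : ∀ z H K → IsEv z (ev z H * ev z K)
  ev-* z []      K = [] , zeroˡ _
  ev-* z (e ∷ H) K with isEv-+ {z} (map (e ℕ.+_) K , sym (ev-shift z e K)) (ev-* z H K)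
  ... | L , eq = L , trans (distribʳ _ _ _) eq

  isEv-* : ∀ {z x y} → IsEv z x → IsEv z y → IsEv z (x * y)
  isEv-* {z} (H , x≈) (K , y≈) with ev-* z H K
  ... | L , eq = L , trans (*-cong x≈ y≈) eq

  isEv-^ : ∀ {z x} n → IsEv z x → IsEv z (x ^ n)
  isEv-^ zero    _ = 0 ∷ [] , sym (+-identityʳ _)
  isEv-^ (suc n) h = isEv-* h (isEv-^ n h)

  isEv-× : ∀ {z x} n → IsEv z x → IsEv z (n · x)
  isEv-× zero    _ = [] , refl
  isEv-× (suc n) h = isEv-+ h (isEv-× n h)

  IsMultiple : ℕ → Carrier → Carrier → Set
  IsMultiple p z x = ∃[ H ] x ≈ p · 1# * ev z H

  multiple : ∀ {p z x} n → p ∣ n → IsEv z x → IsMultiple p z (n · x)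
  multiple {p} {z} {x} n (divides q n≡q*p) h with isEv-× q h
  ... | H , q×x≈ = H , (begin
    n · x                ≡⟨ ≡.cong (_· x) (≡.trans n≡q*p (ℕ.*-comm q p)) ⟩
    (p ℕ.* q) · x        ≈⟨ ×-assocˡ x p q ⟨
    p · (q · x)          ≈⟨ ×-congʳ p (*-identityˡ _) ⟨
    p · (1# * (q · x))   ≈⟨ ×-assoc-* p 1# _ ⟨
    p · 1# * (q · x)     ≈⟨ *-congˡ q×x≈ ⟩
    p · 1# * ev z H      ∎)

  isMultiple-+ : ∀ p z {x y} → IsMultiple p z x → IsMultiple p z y → IsMultiple p z (x + y)
  isMultiple-+ p z (H , x≈) (K , y≈) =
    H ++ K , trans (+-cong x≈ y≈) (trans (sym (distribˡ _ _ _)) (*-congˡ (sym (ev-++ z H K))))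

  isMultiple-sum : ∀ p z {n} (t : Fin n → Carrier) → (∀ i → IsMultiple p z (t i)) → IsMultiple p z (sum t)
  isMultiple-sum p z {zero}  t h = [] , sym (zeroʳ _)
  isMultiple-sum p z {suc n} t h = isMultiple-+ p z (h Fin.zero) (isMultiple-sum p z (t ∘ Fin.suc) (h ∘ Fin.suc))

  private
    rotate : ∀ a b c → a + (b + c) ≈ c + a + b
    rotate = solve 3 (λ a b c → a :+ (b :+ c) := c :+ a :+ b) refl

    collect : ∀ a b p c d → a + (b + p * c) + p * d ≈ a + b + p * (d + c)
    collect = solve 5 (λ a b p c d → a :+ (b :+ p :* c) :+ p :* d := a :+ b :+ p :* (d :+ c)) refl

  first-term : ∀ x y n → binomialTerm x y n Fin.zero ≈ y ^ n
  first-term x y n = trans (×-homo-1 _) (*-identityˡ _)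

  last-term : ∀ x y n → binomialTerm x y n (Fin.fromℕ n) ≈ x ^ n
  last-term x y n = begin
    (n choose Fin.toℕ (Fin.fromℕ n)) · (x ^ Fin.toℕ (Fin.fromℕ n) * y ^ (n ∸ Fin.toℕ (Fin.fromℕ n)))
      ≡⟨ ≡.cong (λ k → (n choose k) · (x ^ k * y ^ (n ∸ k))) (Fin.toℕ-fromℕ n) ⟩
    (n choose n) · (x ^ n * y ^ (n ∸ n))
      ≡⟨ ≡.cong₂ (λ c k → c · (x ^ n * y ^ k)) (nCn≡1 n) (ℕ.n∸n≡0 n) ⟩
    1 · (x ^ n * 1#)
      ≈⟨ trans (×-homo-1 _) (*-identityʳ _) ⟩
    x ^ n ∎

  -- The end terms of the binomial expansion are the two powers, and all terms in between are
  -- divisible by the prime. The quotient is exhibited as a power sum at z, because its membership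
  -- in a particular group matters later.
  freshman : ∀ {p} → Prime (suc p) → ∀ {z x y} → IsEv z x → IsEv z y →
             ∃[ H ] (x + y) ^ suc p ≈ x ^ suc p + y ^ suc p + suc p · 1# * ev z H
  freshman {p} pr {z} {x} {y} hx hy = let H , eq = middle in H , (begin
    (x + y) ^ suc p                                        ≈⟨ theorem (suc p) x y ⟩
    t Fin.zero + sum (t ∘ Fin.suc)                         ≈⟨ +-cong (first-term x y (suc p)) (sum-init-last (t ∘ Fin.suc)) ⟩
    y ^ suc p + (sum (λ i → t (Fin.suc (Fin.inject₁ i))) + t (Fin.fromℕ (suc p)))
                                                           ≈⟨ +-congˡ (+-cong eq (last-term x y (suc p))) ⟩
    y ^ suc p + (suc p · 1# * ev z H + x ^ suc p)          ≈⟨ rotate (y ^ suc p) (suc p · 1# * ev z H) (x ^ suc p) ⟩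
    x ^ suc p + y ^ suc p + suc p · 1# * ev z H            ∎)
    where
    t = binomialTerm x y (suc p)
    middle = isMultiple-sum (suc p) z (λ i → t (Fin.suc (Fin.inject₁ i))) λ i →
      multiple (suc p choose suc (Fin.toℕ (Fin.inject₁ i)))
        (prime∣binomial pr _ (≡.subst (ℕ._< p) (≡.sym (Fin.toℕ-inject₁ i)) (Fin.toℕ<n i)))
        (isEv-* (isEv-^ (suc (Fin.toℕ (Fin.inject₁ i))) hx) (isEv-^ (p ∸ Fin.toℕ (Fin.inject₁ i)) hy))

  -- Induction over the terms with `freshman`: f(z)^p and f(z^p) agree modulo p, and the two
  -- corrections are merged into one power sum.
  frobenius : ∀ {p} → Prime (suc p) → ∀ z L →
              ∃[ H ] ev z L ^ suc p ≈ ev (z ^ suc p) L + suc p · 1# * ev z H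
  frobenius {p} pr z [] = [] , trans (zeroˡ (0# ^ p)) (sym (trans (+-identityˡ (suc p · 1# * 0#)) (zeroʳ (suc p · 1#))))
  frobenius {p} pr z (e ∷ L) =
    let H , eq₁ = freshman pr {z} (e ∷ [] , sym (+-identityʳ (z ^ e))) (L , refl)
        K , eq₂ = frobenius pr z L
    in H ++ K , (begin
    (z ^ e + ev z L) ^ suc p                                        ≈⟨ eq₁ ⟩
    (z ^ e) ^ suc p + ev z L ^ suc p + P * ev z H                   ≈⟨ +-congʳ (+-cong pow eq₂) ⟩
    (z ^ suc p) ^ e + (ev (z ^ suc p) L + P * ev z K) + P * ev z H  ≈⟨ collect ((z ^ suc p) ^ e) (ev (z ^ suc p) L) P (ev z K) (ev z H) ⟩
    ev (z ^ suc p) (e ∷ L) + P * (ev z H + ev z K)                  ≈⟨ +-congˡ (*-congˡ (ev-++ z H K)) ⟨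
    ev (z ^ suc p) (e ∷ L) + P * ev z (H ++ K)                      ∎)
    where
    P = suc p · 1#
    pow : (z ^ e) ^ suc p ≈ (z ^ suc p) ^ e
    pow = trans (^-assocʳ z e (suc p)) (trans (^-congʳ z (ℕ.*-comm e (suc p))) (sym (^-assocʳ z (suc p) e)))

-- Divisibility in finitely generated groups

-- What the algebra uses of ℂ. The field `stable` stands in for a decidable equality, and
-- nonvanishing occurs only as a negation, never as apartness.
record CharZeroDomain : Set₁ where
  field
    commutativeRing : CommutativeRing 0ℓ 0ℓ
  open CommutativeRing commutativeRing
  open IntegerMultiples commutativeRing using (ι)
  field
    stable         : ∀ {x y} → ¬ ¬ (x ≈ y) → x ≈ y
    torsionFree    : ∀ n x → ι (+ ℕ.suc n) * x ≈ 0# → x ≈ 0#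
    noZeroDivisors : ∀ {x y} → x * y ≈ 0# → ¬ (x ≈ 0#) → y ≈ 0#
    0≉1            : ¬ (0# ≈ 1#)

module Spans (K : CharZeroDomain) where

  open CharZeroDomain K
  open CommutativeRing commutativeRing
  open PowerSums commutativeRing
  open import Relation.Binary.Reasoning.Setoid setoid
  open Solver

  -- Recursion on the generators exposes the coordinate at the first of them, on which the induction
  -- in `boundedly-divisible` acts.
  Span : List Carrier → Carrier → Set
  Span []       x = x ≈ 0#
  Span (g ∷ gs) x = ∃[ a ] Span gs (x - ι a * g)

  span-resp : ∀ gs {x y} → x ≈ y → Span gs x → Span gs y
  span-resp []       x≈y x≈0      = trans (sym x≈y) x≈0
  span-resp (g ∷ gs) x≈y (a , sp) = a , span-resp gs (+-congʳ x≈y) sp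

  private
    combine : ∀ k l a b g x y →
      k * (x - a * g) + l * (y - b * g) ≈ (k * x + l * y) - (k * a + l * b) * g
    combine = solve 7 (λ k l a b g x y →
      k :* (x :- a :* g) :+ l :* (y :- b :* g) := (k :* x :+ l :* y) :- (k :* a :+ l :* b) :* g) refl

    ι-combine : ∀ k l a b → ι (k ℤ.* a ℤ.+ l ℤ.* b) ≈ ι k * ι a + ι l * ι b
    ι-combine k l a b = trans (ι-+ (k ℤ.* a) (l ℤ.* b)) (+-cong (ι-* k a) (ι-* l b))

  span-combine : ∀ gs k l {x y} → Span gs x → Span gs y → Span gs (ι k * x + ι l * y)
  span-combine []       k l x≈0 y≈0 = trans (+-cong (trans (*-congˡ x≈0) (zeroʳ _)) (trans (*-congˡ y≈0) (zeroʳ _))) (+-identityˡ 0#)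
  span-combine (g ∷ gs) k l {x} {y} (a , spx) (b , spy) = k ℤ.* a ℤ.+ l ℤ.* b ,
    span-resp gs (trans (combine (ι k) (ι l) (ι a) (ι b) g x y) (+-congˡ (-‿cong (*-congʳ (sym (ι-combine k l a b))))))
      (span-combine gs k l spx spy)

  span-0 : ∀ gs → Span gs 0#
  span-0 []       = refl
  span-0 (g ∷ gs) = + 0 , span-resp gs (solve 1 (λ g → con (+ 0) := con (+ 0) :- con (+ 0) :* g) refl g) (span-0 gs)

  span-+ : ∀ gs {x y} → Span gs x → Span gs y → Span gs (x + y)
  span-+ gs {x} {y} spx spy =
    span-resp gs (solve 2 (λ x y → con (+ 1) :* x :+ con (+ 1) :* y := x :+ y) refl x y) (span-combine gs (+ 1) (+ 1) spx spy)

  span-- : ∀ gs {x y} → Span gs x → Span gs y → Span gs (x - y)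
  span-- gs {x} {y} spx spy =
    span-resp gs (solve 2 (λ x y → con (+ 1) :* x :+ con -[1+ 0 ] :* y := x :- y) refl x y) (span-combine gs (+ 1) -[1+ 0 ] spx spy)

  powers : Carrier → ℕ → List Carrier
  powers z zero       = []
  powers z (ℕ.suc n) = z ^ n ∷ powers z n

  span-power : ∀ z {e} n → e ℕ.< n → Span (powers z n) (z ^ e)
  span-power z {e} (ℕ.suc n) e<1+n with e ℕ.≟ n
  ... | yes ≡.refl = + 1 , span-resp (powers z n) (solve 1 (λ x → con (+ 0) := x :- con (+ 1) :* x) refl (z ^ n)) (span-0 (powers z n))
  ... | no e≢n     = + 0 , span-resp (powers z n) (solve 2 (λ x y → x := x :- con (+ 0) :* y) refl (z ^ e) (z ^ n))
                             (span-power z n (ℕ.≤∧≢⇒< (ℕ.≤-pred e<1+n) e≢n))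

  torsionFree′ : ∀ i {x} → ι i * x ≈ 0# → ¬ (i ≡ + 0) → x ≈ 0#
  torsionFree′ (+ zero)     h i≢0 = contradiction ≡.refl i≢0
  torsionFree′ (+ ℕ.suc n) h i≢0 = torsionFree n _ h
  torsionFree′ -[1+ n ]     h i≢0 = torsionFree n _ (trans (sym (-‿involutive _)) (trans (-‿cong (trans (-‿distribˡ-* _ _) h)) -0#≈0#))

  -- A nonzero element of a finitely generated torsion-free group has such a bound `M`. In the
  -- Galois argument it forces an element divisible by a large prime to vanish.
  NotDivisibleAbove : ℕ → List Carrier → Carrier → Set
  NotDivisibleAbove M gs α = ∀ m β → M ℕ.< m → Span gs β → ¬ (α ≈ ι (+ m) * β)

  private
    Torsion : List Carrier → Carrier → Set
    Torsion gs g = ∃[ n ] Span gs (ι (+ ℕ.suc n) * g)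

    Involves : Carrier → List Carrier → Carrier → Set
    Involves g gs α = ∃[ m ] ∃[ β ] ∃[ a ] (0 ℕ.< m × ¬ (a ≡ + 0) × Span gs (β - ι a * g) × α ≈ ι (+ m) * β)

    independent : ∀ gs g → ¬ Torsion gs g → ∀ i → Span gs (ι i * g) → i ≡ + 0
    independent gs g ¬t (+ zero)     sp = ≡.refl
    independent gs g ¬t (+ ℕ.suc n) sp = contradiction (n , sp) ¬t
    independent gs g ¬t -[1+ n ]    sp = contradiction (n , span-resp gs
      (solve 2 (λ n g → con (+ 0) :- (:- n) :* g := n :* g) refl (ι (+ ℕ.suc n)) g) (span-- gs (span-0 gs) sp)) ¬t

    -- Some positive multiple of g lies in the span of `gs`, so multiplying α = m β by the same
    -- number absorbs the coordinate at g without changing m.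
    torsion-case : ∀ gs g α M n → Span gs (ι (+ ℕ.suc n) * g) →
      NotDivisibleAbove M gs (ι (+ ℕ.suc n) * α) → NotDivisibleAbove M (g ∷ gs) α
    torsion-case gs g α M n spg h m β M<m (a , sp) α≈mβ = h m (ι (+ ℕ.suc n) * β) M<m
      (span-resp gs (solve 4 (λ n a g β → n :* (β :- a :* g) :+ a :* (n :* g) := n :* β) refl (ι (+ ℕ.suc n)) (ι a) g β)
        (span-combine gs (+ ℕ.suc n) a sp spg))
      (trans (*-congˡ α≈mβ) (solve 3 (λ n m β → n :* (m :* β) := m :* (n :* β)) refl (ι (+ ℕ.suc n)) (ι (+ m)) β))

    -- Take m times one decomposition minus m₀ times the other. Both multiples m β and m₀ β₀ equal α
    -- and cancel; an integer multiple of g remains in the span of `gs`, and g is not torsion there.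
    coefficients-match : ∀ gs g {α} → ¬ Torsion gs g → ∀ m₀ m a₀ a {β₀ β} →
      Span gs (β₀ - ι a₀ * g) → Span gs (β - ι a * g) →
      α ≈ ι (+ m₀) * β₀ → α ≈ ι (+ m) * β → + m ℤ.* a ≡ + m₀ ℤ.* a₀
    coefficients-match gs g ¬t m₀ m a₀ a {β₀} {β} sp₀ sp α≈₀ α≈ =
      ≡.sym (ℤ.i-j≡0⇒i≡j (+ m₀ ℤ.* a₀) (+ m ℤ.* a) (independent gs g ¬t (+ m₀ ℤ.* a₀ ℤ.- + m ℤ.* a)
        (span-resp gs eq (span-combine gs (+ m) (ℤ.- + m₀) sp sp₀))))
      where
      eq : ι (+ m) * (β - ι a * g) + ι (ℤ.- + m₀) * (β₀ - ι a₀ * g) ≈ ι (+ m₀ ℤ.* a₀ ℤ.- + m ℤ.* a) * g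
      eq = begin
        ι (+ m) * (β - ι a * g) + ι (ℤ.- + m₀) * (β₀ - ι a₀ * g)
          ≈⟨ +-congˡ (*-congʳ (ι-neg (+ m₀))) ⟩
        ι (+ m) * (β - ι a * g) + (- ι (+ m₀)) * (β₀ - ι a₀ * g)
          ≈⟨ solve 7 (λ m m₀ a a₀ g β β₀ → m :* (β :- a :* g) :+ (:- m₀) :* (β₀ :- a₀ :* g)
                := (m :* β :- m₀ :* β₀) :+ (m₀ :* a₀ :- m :* a) :* g) refl (ι (+ m)) (ι (+ m₀)) (ι a) (ι a₀) g β β₀ ⟩
        (ι (+ m) * β - ι (+ m₀) * β₀) + (ι (+ m₀) * ι a₀ - ι (+ m) * ι a) * g
          ≈⟨ +-congʳ (trans (+-congʳ (trans (sym α≈) α≈₀)) (-‿inverseʳ _)) ⟩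
        0# + (ι (+ m₀) * ι a₀ - ι (+ m) * ι a) * g
          ≈⟨ +-identityˡ _ ⟩
        (ι (+ m₀) * ι a₀ - ι (+ m) * ι a) * g
          ≈⟨ *-congʳ (+-cong (ι-* (+ m₀) a₀) (trans (ι-neg (+ m ℤ.* a)) (-‿cong (ι-* (+ m) a)))) ⟨
        (ι (+ m₀ ℤ.* a₀) + ι (ℤ.- (+ m ℤ.* a))) * g
          ≈⟨ *-congʳ (ι-+ (+ m₀ ℤ.* a₀) (ℤ.- (+ m ℤ.* a))) ⟨
        ι (+ m₀ ℤ.* a₀ ℤ.- + m ℤ.* a) * g ∎

    -- m divides m₀ a₀, which is not zero.
    bounded-factor : ∀ m₀ m a₀ a → 0 ℕ.< m₀ → ¬ (a₀ ≡ + 0) → + m ℤ.* a ≡ + m₀ ℤ.* a₀ → m ℕ.≤ m₀ ℕ.* ℤ.∣ a₀ ∣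
    bounded-factor m₀ m a₀ a 0<m₀ a₀≢0 eq = ≡.subst (m ℕ.≤_) abs-eq (ℕ.m≤m*n m ℤ.∣ a ∣ {{ℕ.≢-nonZero ∣a∣≢0}})
      where
      abs-eq : m ℕ.* ℤ.∣ a ∣ ≡ m₀ ℕ.* ℤ.∣ a₀ ∣
      abs-eq = ≡.trans (≡.sym (ℤ.abs-* (+ m) a)) (≡.trans (≡.cong ℤ.∣_∣ eq) (ℤ.abs-* (+ m₀) a₀))
      ∣a∣≢0 : ¬ (ℤ.∣ a ∣ ≡ 0)
      ∣a∣≢0 ∣a∣≡0 with ℕ.m*n≡0⇒m≡0∨n≡0 m₀ (≡.trans (≡.sym abs-eq) (≡.trans (≡.cong (m ℕ.*_) ∣a∣≡0) (ℕ.*-zeroʳ m)))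
      ... | inj₁ m₀≡0 = ℕ.<⇒≢ 0<m₀ (≡.sym m₀≡0)
      ... | inj₂ ∣a₀∣≡0 = a₀≢0 (ℤ.∣i∣≡0⇒i≡0 ∣a₀∣≡0)

  -- Either g is torsion modulo gs, and a multiple of α can be used instead, or every divisor of α divides the
  -- same multiple of its coordinate at g.
  boundedly-divisible : ∀ gs α → ¬ (α ≈ 0#) → ¬ ¬ (∃[ M ] NotDivisibleAbove M gs α)
  boundedly-divisible []       α α≉0 k =
    k (0 , λ m β _ β≈0 α≈mβ → α≉0 (trans α≈mβ (trans (*-congˡ β≈0) (zeroʳ _))))
  boundedly-divisible (g ∷ gs) α α≉0 k = ¬¬-excluded-middle {A = Torsion gs g} λ where
      (yes (n , spg)) → boundedly-divisible gs (ι (+ ℕ.suc n) * α) (λ h → α≉0 (torsionFree n α h)) λ where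
        (M , h) → k (M , torsion-case gs g α M n spg h)
      (no ¬t) → ¬¬-excluded-middle {A = Involves g gs α} λ where
        (yes (m₀ , β₀ , a₀ , 0<m₀ , a₀≢0 , sp₀ , α≈₀)) → k (m₀ ℕ.* ℤ.∣ a₀ ∣ , λ m β M<m (a , sp) α≈ →
          ℕ.<⇒≱ M<m (bounded-factor m₀ m a₀ a 0<m₀ a₀≢0 (coefficients-match gs g ¬t m₀ m a₀ a sp₀ sp α≈₀ α≈)))
        (no ¬inv) → boundedly-divisible gs α α≉0 λ where
          (M , h) → k (M , λ m β M<m (a , sp) α≈ → uninvolved M h ¬inv m β M<m a sp α≈)
    where
    uninvolved : ∀ M → NotDivisibleAbove M gs α → ¬ Involves g gs α →
                 ∀ m β → M ℕ.< m → ∀ a → Span gs (β - ι a * g) → ¬ (α ≈ ι (+ m) * β)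
    uninvolved M h ¬inv m β M<m a sp α≈ with a ℤ.≟ + 0
    ... | yes ≡.refl = h m β M<m (span-resp gs (solve 2 (λ β g → β :- con (+ 0) :* g := β) refl β g) sp) α≈
    ... | no a≢0     = ¬inv (m , β , a , ℕ.≤-<-trans ℕ.z≤n M<m , a≢0 , sp , α≈)

-- Residues represented by products of large primes

prime∣prime⇒≡ : ∀ {p q} → Prime p → Prime q → p ∣ q → p ≡ q
prime∣prime⇒≡ p-prime q-prime p∣q with prime⇒irreducible q-prime p∣q
... | inj₁ ≡.refl = contradiction p-prime ¬prime[1]
... | inj₂ p≡q    = p≡q

-- Every prime up to `M` divides exactly one of `m` and this product.
primesAvoiding : ℕ → ℕ → ℕ
primesAvoiding m zero    = 1
primesAvoiding m (suc M) with prime? (suc M) ×-dec ¬? (suc M ∣? m)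
... | yes _ = suc M ℕ.* primesAvoiding m M
... | no _  = primesAvoiding m M

primesAvoiding≢0 : ∀ m M → NonZero (primesAvoiding m M)
primesAvoiding≢0 m zero    = _
primesAvoiding≢0 m (suc M) with prime? (suc M) ×-dec ¬? (suc M ∣? m)
... | yes _ = ℕ.m*n≢0 (suc M) (primesAvoiding m M) {{_}} {{primesAvoiding≢0 m M}}
... | no _  = primesAvoiding≢0 m M

∤-primesAvoiding : ∀ {q} m M → Prime q → q ∣ m → q ∤ primesAvoiding m M
∤-primesAvoiding m zero    q-prime q∣m q∣1 = ¬prime[1] (≡.subst Prime (∣1⇒≡1 q∣1) q-prime)
∤-primesAvoiding m (suc M) q-prime q∣m q∣Π with prime? (suc M) ×-dec ¬? (suc M ∣? m)
... | no _ = ∤-primesAvoiding m M q-prime q∣m q∣Π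
... | yes (p-prime , p∤m) with euclidsLemma (suc M) (primesAvoiding m M) q-prime q∣Π
...   | inj₁ q∣p rewrite prime∣prime⇒≡ q-prime p-prime q∣p = p∤m q∣m
...   | inj₂ q∣Π′ = ∤-primesAvoiding m M q-prime q∣m q∣Π′

∣-primesAvoiding : ∀ {q} m M → Prime q → q ∤ m → q ℕ.≤ M → q ∣ primesAvoiding m M
∣-primesAvoiding m zero    q-prime q∤m ℕ.z≤n = contradiction q-prime λ ()
∣-primesAvoiding {q} m (suc M) q-prime q∤m q≤1+M with prime? (suc M) ×-dec ¬? (suc M ∣? m) | q ℕ.≟ suc M
... | yes _    | yes ≡.refl = m∣m*n (primesAvoiding m M)
... | yes _    | no q≢      = ∣n⇒∣m*n (suc M) (∣-primesAvoiding m M q-prime q∤m (ℕ.≤-pred (ℕ.≤∧≢⇒< q≤1+M q≢)))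
... | no ¬both | yes ≡.refl = contradiction (q-prime , q∤m) ¬both
... | no _     | no q≢      = ∣-primesAvoiding m M q-prime q∤m (ℕ.≤-pred (ℕ.≤∧≢⇒< q≤1+M q≢))

∈⇒∣product : ∀ {q qs} → q ∈ qs → q ∣ product qs
∈⇒∣product {qs = q ∷ qs} (here ≡.refl) = m∣m*n (product qs)
∈⇒∣product {qs = q ∷ qs} (there h)     = ∣n⇒∣m*n q (∈⇒∣product h)

-- With j = `primesAvoiding m M`, a prime q ≤ M dividing m divides neither j nor N, and one not
-- dividing m divides j; in both cases q does not divide m + j N. This replaces an appeal to
-- Dirichlet's theorem on primes in progressions.
rough-residue : ∀ m N M → .{{NonZero N}} → (∀ q → Prime q → q ∣ m → q ∤ N) →
  ∃[ qs ] (All Prime qs × All (M ℕ.<_) qs × ∃[ j ] product qs ≡ m ℕ.+ j ℕ.* N)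
rough-residue m N M coprime = factors , factorsPrime , All.tabulate large , j , ≡.sym isFactorisation
  where
  j = primesAvoiding m M
  instance
    j≢0 : NonZero j
    j≢0 = primesAvoiding≢0 m M
    jN≢0 : NonZero (j ℕ.* N)
    jN≢0 = ℕ.m*n≢0 j N
    m′≢0 : NonZero (m ℕ.+ j ℕ.* N)
    m′≢0 = ℕ.≢-nonZero λ eq → ℕ.≢-nonZero⁻¹ (j ℕ.* N) (ℕ.m+n≡0⇒n≡0 m eq)
  open PrimeFactorisation (factorise (m ℕ.+ j ℕ.* N))
  rough : ∀ q → Prime q → q ∣ m ℕ.+ j ℕ.* N → M ℕ.< q
  rough q q-prime q∣m′ with q ℕ.≤? M | q ∣? m
  ... | no q≰M  | _      = ℕ.≰⇒> q≰M
  ... | yes q≤M | yes q∣m = contradiction (euclidsLemma j N q-prime (∣m+n∣m⇒∣n q∣m′ q∣m))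
                              [ ∤-primesAvoiding m M q-prime q∣m , coprime q q-prime q∣m ]′
  ... | yes q≤M | no q∤m  = contradiction
    (∣m+n∣m⇒∣n (≡.subst (q ∣_) (ℕ.+-comm m (j ℕ.* N)) q∣m′) (∣m⇒∣m*n N (∣-primesAvoiding m M q-prime q∤m q≤M))) q∤m
  large : ∀ {q} → q ∈ factors → M ℕ.< q
  large {q} q∈ = rough q (All.lookup factorsPrime q∈) (≡.subst (q ∣_) (≡.sym isFactorisation) (∈⇒∣product q∈))

-- Conjugation of relations between roots of unity

module Galois (K : CharZeroDomain) where

  open CharZeroDomain K
  open CommutativeRing commutativeRing
  open PowerSums commutativeRing
  open Spans K
  open import Relation.Binary.Reasoning.Setoid setoid
  open Solver

  x-y≈0⇒x≈y : ∀ {x y} → x - y ≈ 0# → x ≈ y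
  x-y≈0⇒x≈y {x} {y} h = trans (solve 2 (λ x y → x := (x :- y) :+ y) refl x y) (trans (+-congʳ h) (+-identityˡ y))

  x≈y⇒x-y≈0 : ∀ {x y} → x ≈ y → x - y ≈ 0#
  x≈y⇒x-y≈0 {x} {y} h = trans (+-congʳ h) (-‿inverseʳ y)

  module _ (ζ : Carrier) (N : ℕ) {{_ : NonZero N}} (ζ^N≈1 : ζ ^ N ≈ 1#) where

    ^-multiple : ∀ k → ζ ^ (k ℕ.* N) ≈ 1#
    ^-multiple k = begin
      ζ ^ (k ℕ.* N)  ≡⟨ ≡.cong (ζ ^_) (ℕ.*-comm k N) ⟩
      ζ ^ (N ℕ.* k)  ≈⟨ ^-assocʳ ζ N k ⟨
      (ζ ^ N) ^ k    ≈⟨ ^-congˡ k ζ^N≈1 ⟩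
      1# ^ k         ≈⟨ 1^n≈1 k ⟩
      1#             ∎

    ^-periodic : ∀ m j → ζ ^ (m ℕ.+ j ℕ.* N) ≈ ζ ^ m
    ^-periodic m j = trans (^-homo-* ζ m (j ℕ.* N)) (trans (*-congˡ (^-multiple j)) (*-identityʳ _))

    ^-% : ∀ e → ζ ^ e ≈ ζ ^ (e % N)
    ^-% e = trans (^-congʳ ζ (ℕ.m≡m%n+[m/n]*n e N)) (^-periodic (e % N) (e / N))

    private
      generators = powers ζ N

    -- The values at all powers of ζ lie in one and the same finitely generated group.
    span-ev : ∀ k H → Span generators (ev (ζ ^ k) H)
    span-ev k []      = span-0 generators
    span-ev k (e ∷ H) = span-+ generators
      (span-resp generators (sym (trans (^-assocʳ ζ k e) (^-% (k ℕ.* e)))) (span-power ζ N (ℕ.m%n<n (k ℕ.* e) N)))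
      (span-ev k H)

    module _ (P Q : List ℕ) where

      private
        α : ℕ → Carrier
        α k = ev (ζ ^ k) P - ev (ζ ^ k) Q

        α-cong : ∀ k l → ζ ^ k ≈ ζ ^ l → α k ≈ α l
        α-cong k l h = +-cong (ev-cong P h) (-‿cong (ev-cong Q h))

        -- If P and Q agree at ζ^k, so do the p-th powers of their values. By `frobenius` the values
        -- at ζ^(kp) then differ by p times a difference of power sums at ζ^k.
        vanishing-multiple : ∀ k {p} → Prime p → α k ≈ 0# →
                             ∃[ β ] (Span generators β × α (k ℕ.* p) ≈ ι (+ p) * β)
        vanishing-multiple k {zero}  p-prime h = contradiction p-prime λ ()
        vanishing-multiple k {suc p} p-prime h =
          let H₁ , eq₁ = frobenius p-prime (ζ ^ k) P
              H₂ , eq₂ = frobenius p-prime (ζ ^ k) Q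
          in ev (ζ ^ k) H₂ - ev (ζ ^ k) H₁ , span-- generators (span-ev k H₂) (span-ev k H₁) , (begin
            α (k ℕ.* suc p)
              ≈⟨ +-cong (ev-cong P (^-assocʳ ζ k (suc p))) (-‿cong (ev-cong Q (^-assocʳ ζ k (suc p)))) ⟨
            ev ((ζ ^ k) ^ suc p) P - ev ((ζ ^ k) ^ suc p) Q
              ≈⟨ subtract-equals (trans (sym eq₁) (trans (^-congˡ (suc p) (x-y≈0⇒x≈y h)) eq₂)) ⟩
            ι (+ suc p) * (ev (ζ ^ k) H₂ - ev (ζ ^ k) H₁) ∎)
          where
          subtract-equals : ∀ {u v x y z} → u + z * x ≈ v + z * y → u - v ≈ z * (y - x)
          subtract-equals {u} {v} {x} {y} {z} eq = begin
            u - v                          ≈⟨ solve 4 (λ u v x z → u :- v := (u :+ z :* x) :- z :* x :- v) refl u v x z ⟩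
            (u + z * x) - z * x - v        ≈⟨ +-congʳ (+-congʳ eq) ⟩
            (v + z * y) - z * x - v        ≈⟨ solve 4 (λ v x y z → (v :+ z :* y) :- z :* x :- v := z :* (y :- x)) refl v x y z ⟩
            z * (y - x)                    ∎

        -- Conditional on α k being nonzero, since zero has arbitrarily large divisors.
        Bound : ℕ → ℕ → Set
        Bound k M = ¬ (α k ≈ 0#) → NotDivisibleAbove M generators (α k)

        bound-≤ : ∀ k {M M′} → M ℕ.≤ M′ → Bound k M → Bound k M′
        bound-≤ k M≤M′ b α≉0 m β M′<m = b α≉0 m β (ℕ.≤-<-trans M≤M′ M′<m)

        bound : ∀ k → ¬ ¬ (∃[ M ] Bound k M)
        bound k c = ¬¬-excluded-middle {A = α k ≈ 0#} λ where
          (yes α≈0) → c (0 , λ α≉0 → contradiction α≈0 α≉0)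
          (no α≉0)  → boundedly-divisible generators (α k) α≉0 λ where
            (M , h) → c (M , λ _ → h)

        -- The maximum of finitely many bounds; with n = N this covers all exponents by periodicity.
        uniform-bound : ∀ n → ¬ ¬ (∃[ M ] (∀ k → k ℕ.< n → Bound k M))
        uniform-bound zero    c = c (0 , λ _ ())
        uniform-bound (suc n) c = uniform-bound n λ where
            (M , h) → bound n λ where
              (M′ , h′) → c (M ⊔ M′ , λ k k<1+n → below M h M′ h′ k k<1+n)
          where
          below : ∀ M → (∀ k → k ℕ.< n → Bound k M) → ∀ M′ → Bound n M′ → ∀ k → k ℕ.< suc n → Bound k (M ⊔ M′)
          below M h M′ h′ k k<1+n with k ℕ.≟ n
          ... | yes ≡.refl = bound-≤ k (ℕ.m≤n⊔m M M′) h′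
          ... | no k≢n     = bound-≤ k (ℕ.m≤m⊔n M M′) (h k (ℕ.≤∧≢⇒< (ℕ.≤-pred k<1+n) k≢n))

        bound-everywhere : ∀ {M} → (∀ k → k ℕ.< N → Bound k M) → ∀ k → Bound k M
        bound-everywhere h k α≉0 m β M<m spβ α≈ =
          h (k % N) (ℕ.m%n<n k N) (λ α≈0 → α≉0 (trans (α-cong k (k % N) (^-% k)) α≈0)) m β M<m spβ
            (trans (sym (α-cong k (k % N) (^-% k))) α≈)

        -- Vanishing passes from k to k q for a prime q beyond the bound, because α (k q) is
        -- divisible by q and would violate the bound if it were nonzero.
        vanishing-product : ∀ {M} → (∀ k → Bound k M) → ∀ qs → All Prime qs → All (M ℕ.<_) qs →
                            ∀ k → α k ≈ 0# → α (k ℕ.* product qs) ≈ 0#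
        vanishing-product b []       _              _            k h = trans (reflexive (≡.cong α (ℕ.*-identityʳ k))) h
        vanishing-product b (q ∷ qs) (q-prime ∷ ps) (M<q ∷ M<qs) k h =
          trans (reflexive (≡.cong α (≡.sym (ℕ.*-assoc k q (product qs)))))
            (vanishing-product b qs ps M<qs (k ℕ.* q) (stable λ α≉0 →
              let β , spβ , eq = vanishing-multiple k q-prime h in b (k ℕ.* q) α≉0 q β M<q spβ eq))

      -- Landau's argument: α (kp) is divisible by the prime p whenever α k vanishes, so it vanishes for all
      -- large p; and m agrees modulo N with a product of large primes.
      galois : ∀ m → (∀ q → Prime q → q ∣ m → q ∤ N) → ev ζ P ≈ ev ζ Q → ev (ζ ^ m) P ≈ ev (ζ ^ m) Q
      galois m coprime h = stable λ c → uniform-bound N λ where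
        (M , b) → let qs , primes , large , j , eq = rough-residue m N M coprime in
          c (x-y≈0⇒x≈y (trans (α-cong m (1 ℕ.* product qs) (trans (sym (^-periodic m j)) (^-congʳ ζ (≡.trans (≡.sym eq) (≡.sym (ℕ.*-identityˡ _))))))
            (vanishing-product (bound-everywhere b) qs primes large 1
              (trans (+-cong (ev-cong P (*-identityʳ ζ)) (-‿cong (ev-cong Q (*-identityʳ ζ)))) (x≈y⇒x-y≈0 h)))))

-- Finite sums and residue classes of exponents

module FiniteSums where

  open import Data.Nat
  open import Data.Nat.DivMod
  open import Data.Nat.Properties
  open import Relation.Binary.PropositionalEquality hiding ([_])

  Σ< : ℕ → (ℕ → ℕ) → ℕ
  Σ< zero    f = 0
  Σ< (suc n) f = f n + Σ< n f

  Σ<-mono : ∀ n {f g} → (∀ s → s < n → f s ≤ g s) → Σ< n f ≤ Σ< n g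
  Σ<-mono zero    h = z≤n
  Σ<-mono (suc n) h = +-mono-≤ (h n ≤-refl) (Σ<-mono n λ s s<n → h s (m<n⇒m<1+n s<n))

  Σ<-cong : ∀ n {f g} → (∀ s → s < n → f s ≡ g s) → Σ< n f ≡ Σ< n g
  Σ<-cong n h = ≤-antisym (Σ<-mono n λ s s<n → ≤-reflexive (h s s<n)) (Σ<-mono n λ s s<n → ≤-reflexive (sym (h s s<n)))

  Σ<-+ : ∀ n f g → Σ< n (λ s → f s + g s) ≡ Σ< n f + Σ< n g
  Σ<-+ zero    f g = refl
  Σ<-+ (suc n) f g rewrite Σ<-+ n f g =
    solve 4 (λ a b c d → a :+ b :+ (c :+ d) := a :+ c :+ (b :+ d)) refl (f n) (g n) (Σ< n f) (Σ< n g)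
    where open +-*-Solver

  Σ<-* : ∀ n c f → Σ< n (λ s → c * f s) ≡ c * Σ< n f
  Σ<-* zero    c f = sym (*-zeroʳ c)
  Σ<-* (suc n) c f rewrite Σ<-* n c f = sym (*-distribˡ-+ c (f n) (Σ< n f))

  Σ<-const : ∀ n c → Σ< n (const c) ≡ n * c
  Σ<-const zero    c = refl
  Σ<-const (suc n) c = cong (λ k′ → c + k′) (Σ<-const n c)

  only : ℕ → ℕ → ℕ → ℕ
  only k c s = if does (s ≟ k) then c else 0

  except : ℕ → (ℕ → ℕ) → ℕ → ℕ
  except k f s = if does (s ≟ k) then 0 else f s

  only-≡ : ∀ k c → only k c k ≡ c
  only-≡ k c rewrite dec-true (k ≟ k) refl = refl

  only-≢ : ∀ {k s} c → s ≢ k → only k c s ≡ 0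
  only-≢ {k} {s} c s≢k rewrite dec-false (s ≟ k) s≢k = refl

  except-≡ : ∀ k f → except k f k ≡ 0
  except-≡ k f rewrite dec-true (k ≟ k) refl = refl

  except-≢ : ∀ {k s} f → s ≢ k → except k f s ≡ f s
  except-≢ {k} {s} f s≢k rewrite dec-false (s ≟ k) s≢k = refl

  Σ<-only : ∀ {n k} c → k < n → Σ< n (only k c) ≡ c
  Σ<-only {suc n} {k} c k<1+n with k ≟ n
  ... | yes refl = trans (cong₂ _+_ (only-≡ k c) (trans (Σ<-cong n λ s s<n → only-≢ c (<⇒≢ s<n)) (Σ<-const n 0)))
                         (trans (cong (λ k′ → c + k′) (*-zeroʳ n)) (+-identityʳ c))
  ... | no k≢n   = cong₂ _+_ (only-≢ c (k≢n ∘ sym)) (Σ<-only c (≤∧≢⇒< (≤-pred k<1+n) k≢n))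

  Σ<-only-≤ : ∀ n k c → Σ< n (only k c) ≤ c
  Σ<-only-≤ n k c with k <? n
  ... | yes k<n = ≤-reflexive (Σ<-only c k<n)
  ... | no k≮n  = ≤-trans (≤-reflexive (trans (Σ<-cong n λ s s<n → only-≢ {k} {s} c λ { refl → k≮n s<n }) (trans (Σ<-const n 0) (*-zeroʳ n)))) z≤n

  Σ<-bump : ∀ {n k a f g} → k < n → f k ≡ a + g k → (∀ s → s ≢ k → f s ≡ g s) → Σ< n f ≡ a + Σ< n g
  Σ<-bump {n} {k} {a} {f} {g} k<n eq others = begin
    Σ< n f                              ≡⟨ Σ<-cong n (λ s _ → pointwise s) ⟩
    Σ< n (λ s → only k a s + g s)       ≡⟨ Σ<-+ n (only k a) g ⟩
    Σ< n (only k a) + Σ< n g            ≡⟨ cong (_+ Σ< n g) (Σ<-only a k<n) ⟩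
    a + Σ< n g                          ∎
    where
    open ≡-Reasoning
    pointwise : ∀ s → f s ≡ only k a s + g s
    pointwise s with s ≟ k
    ... | yes refl = trans eq (cong (_+ g s) (sym (only-≡ k a)))
    ... | no s≢k   = trans (others s s≢k) (cong (_+ g s) (sym (only-≢ a s≢k)))

  Σ<-except : ∀ {n k} f → k < n → Σ< n f ≡ f k + Σ< n (except k f)
  Σ<-except {n} {k} f k<n = Σ<-bump k<n
    (trans (sym (+-identityʳ (f k))) (cong (λ k′ → f k + k′) (sym (except-≡ k f)))) (λ s s≢k → sym (except-≢ f s≢k))

  Σ<-term : ∀ {n k} f → k < n → f k ≤ Σ< n f
  Σ<-term {n} {k} f k<n = ≤-trans (m≤m+n (f k) _) (≤-reflexive (sym (Σ<-except f k<n)))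

  Σ<-two-terms : ∀ {n j k} f → j < n → k < n → j ≢ k → f j + f k ≤ Σ< n f
  Σ<-two-terms {n} {j} {k} f j<n k<n j≢k = begin
    f j + f k                       ≡⟨ +-comm (f j) (f k) ⟩
    f k + f j                       ≡⟨ cong (λ k′ → f k + k′) (except-≢ f j≢k) ⟨
    f k + except k f j              ≤⟨ +-monoʳ-≤ (f k) (Σ<-term (except k f) j<n) ⟩
    f k + Σ< n (except k f)         ≡⟨ Σ<-except f k<n ⟨
    Σ< n f                          ∎
    where open ≤-Reasoning

  -- The exceptional index `b` may lie outside the range. Its allowance is kept as a sum, which
  -- vanishes in that case.
  Σ<-lower : ∀ n a b c f → (∀ s → s < n → s ≢ a → s ≢ b → c ≤ f s) → n * c ≤ Σ< n f + c + Σ< n (only b c)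
  Σ<-lower n a b c f h = begin
    n * c                                               ≡⟨ Σ<-const n c ⟨
    Σ< n (const c)                                      ≤⟨ Σ<-mono n pointwise ⟩
    Σ< n (λ s → f s + only a c s + only b c s)          ≡⟨ Σ<-+ n (λ s → f s + only a c s) (only b c) ⟩
    Σ< n (λ s → f s + only a c s) + Σ< n (only b c)     ≡⟨ cong (_+ Σ< n (only b c)) (Σ<-+ n f (only a c)) ⟩
    Σ< n f + Σ< n (only a c) + Σ< n (only b c)          ≤⟨ +-monoˡ-≤ _ (+-monoʳ-≤ (Σ< n f) (Σ<-only-≤ n a c)) ⟩
    Σ< n f + c + Σ< n (only b c)                        ∎
    where
    open ≤-Reasoning
    pointwise : ∀ s → s < n → c ≤ f s + only a c s + only b c s
    pointwise s s<n with s ≟ a | s ≟ b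
    ... | yes refl | _        rewrite only-≡ s c = ≤-trans (m≤n+m c (f s)) (m≤m+n _ _)
    ... | no _     | yes refl rewrite only-≡ s c = m≤n+m c _
    ... | no s≢a | no s≢b = ≤-trans (h s s<n s≢a s≢b) (≤-trans (m≤m+n (f s) (only a c s)) (m≤m+n _ (only b c s)))

  argmin : ∀ n (f : ℕ → ℕ) → ∃[ o ] (o < suc n × ∀ s → s < suc n → f o ≤ f s)
  argmin zero    f = 0 , s≤s z≤n , λ { zero _ → ≤-refl ; (suc _) (s≤s ()) }
  argmin (suc n) f with argmin n f
  ... | o , o< , min with f o ≤? f (suc n)
  ...   | yes fo≤ = o , m<n⇒m<1+n o< , λ s s< → below s s<
    where
    below : ∀ s → s < suc (suc n) → f o ≤ f s
    below s s< with s ≟ suc n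
    ... | yes refl = fo≤
    ... | no s≢    = min s (≤∧≢⇒< (≤-pred s<) s≢)
  ...   | no fo≰ = suc n , ≤-refl , λ s s< → below s s<
    where
    below : ∀ s → s < suc (suc n) → f (suc n) ≤ f s
    below s s< with s ≟ suc n
    ... | yes refl = ≤-refl
    ... | no s≢    = ≤-trans (<⇒≤ (≰⇒> fo≰)) (min s (≤∧≢⇒< (≤-pred s<) s≢))

  -- The lightest class is at most the average of the other p′ classes. These have total at most p′
  -- Y, where Y is what is selected from them, so the dropped class costs at most another Y and the
  -- factor grows from p - 1 to p.
  drop-lightest : ∀ p′ (x y : ℕ → ℕ) o → .{{NonZero p′}} → o < suc p′ →
    (∀ s → s < suc p′ → x o ≤ x s) → (∀ s → s < suc p′ → x s ≤ p′ * y s) →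
    Σ< (suc p′) x ≤ suc p′ * Σ< (suc p′) (except o y)
  drop-lightest p′ x y o o<p min bound = begin
    Σ< p x              ≡⟨ Σ<-except x o<p ⟩
    x o + X             ≤⟨ +-mono-≤ (*-cancelˡ-≤ p′ (≤-trans p′*xo≤X X≤p′*Y)) X≤p′*Y ⟩
    Y + p′ * Y          ∎
    where
    open ≤-Reasoning
    p = suc p′
    X = Σ< p (except o x)
    Y = Σ< p (except o y)
    pointwise : ∀ s → s < p → except o x s ≤ p′ * except o y s
    pointwise s s<p with s ≟ o
    ... | yes refl rewrite except-≡ s x = z≤n
    ... | no s≢o   rewrite except-≢ x s≢o | except-≢ y s≢o = bound s s<p
    X≤p′*Y : X ≤ p′ * Y
    X≤p′*Y = ≤-trans (Σ<-mono p pointwise) (≤-reflexive (Σ<-* p p′ (except o y)))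
    lower : p * x o ≤ X + x o + Σ< p (only p (x o))
    -- The second exceptional index is `p`, just outside the range, so that it costs nothing.
    lower = Σ<-lower p o p (x o) (except o x) λ s s<p s≢o _ → ≤-trans (min s s<p) (≤-reflexive (sym (except-≢ x s≢o)))
    p′*xo≤X : p′ * x o ≤ X
    p′*xo≤X = +-cancelˡ-≤ (x o) _ _ (≤-trans lower (≤-reflexive (trans
      (cong (λ k′ → X + x o + k′) (trans (Σ<-cong p λ s s<p → only-≢ (x o) (<⇒≢ s<p)) (trans (Σ<-const p 0) (*-zeroʳ p))))
      (trans (+-identityʳ _) (+-comm X (x o))))))

  -- For s ≢ b the stronger bound on x s leaves A * y s to spare; over all these s this pays for x o.
  drop-lightest-small : ∀ p A σ (x y : ℕ → ℕ) o b → suc (suc σ) ≤ p → o < p →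
    (∀ s → s < p → x o ≤ x s) → (∀ s → s < p → x s ≤ A * suc σ * y s) → (∀ s → s < p → s ≢ b → x s ≤ A * σ * y s) →
    Σ< p x ≤ A * suc σ * Σ< p (except o y)
  drop-lightest-small p A σ x y o b 2+σ≤p o<p min big small = begin
    Σ< p x              ≡⟨ Σ<-except x o<p ⟩
    x o + X             ≤⟨ +-monoˡ-≤ X (xo≤A*W σ 2+σ≤p small) ⟩
    A * W + X           ≡⟨ +-comm (A * W) X ⟩
    X + A * W           ≡⟨ cong (λ k′ → X + k′) (Σ<-* p A (except b (except o y))) ⟨
    X + Σ< p (λ s → A * except b (except o y) s)   ≡⟨ Σ<-+ p (except o x) (λ s → A * except b (except o y) s) ⟨
    Σ< p (λ s → except o x s + A * except b (except o y) s)   ≤⟨ Σ<-mono p pointwise ⟩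
    Σ< p (λ s → A * suc σ * except o y s)   ≡⟨ Σ<-* p (A * suc σ) (except o y) ⟩
    A * suc σ * Y       ∎
    where
    open ≤-Reasoning
    X = Σ< p (except o x)
    Y = Σ< p (except o y)
    W = Σ< p (except b (except o y))
    pointwise : ∀ s → s < p → except o x s + A * except b (except o y) s ≤ A * suc σ * except o y s
    pointwise s s<p with s ≟ o | s ≟ b
    ... | yes refl | yes refl rewrite except-≡ s x | except-≡ s (except s y) = ≤-trans (≤-reflexive (*-zeroʳ A)) z≤n
    ... | yes refl | no s≢b   rewrite except-≡ s x | except-≢ (except s y) s≢b | except-≡ s y = ≤-trans (≤-reflexive (*-zeroʳ A)) z≤n
    ... | no s≢o   | yes refl rewrite except-≢ x s≢o | except-≡ s (except o y) | except-≢ y s≢o =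
      ≤-trans (≤-reflexive (trans (cong (λ k′ → x s + k′) (*-zeroʳ A)) (+-identityʳ (x s)))) (big s s<p)
    ... | no s≢o   | no s≢b   rewrite except-≢ x s≢o | except-≢ (except o y) s≢b | except-≢ y s≢o = begin
      x s + A * y s          ≤⟨ +-monoˡ-≤ (A * y s) (small s s<p s≢b) ⟩
      A * σ * y s + A * y s  ≡⟨ solve 3 (λ A σ y → A :* σ :* y :+ A :* y := A :* (con 1 :+ σ) :* y) refl A σ (y s) ⟩
      A * suc σ * y s        ∎
      where open +-*-Solver
    -- At least σ classes differ from both `o` and `b`, and x o ≤ x s ≤ σ (A y s) in each, so σ x o
    -- ≤ σ (A W). For σ = 0 there is nothing to cancel, but then every class other than `b` is
    -- empty, and one of the indices 0 and 1 is not `b`.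
    xo≤A*W : ∀ σ → suc (suc σ) ≤ p → (∀ s → s < p → s ≢ b → x s ≤ A * σ * y s) → x o ≤ A * W
    xo≤A*W zero    2≤p small with b ≟ 0
    ... | yes refl = ≤-trans (min 1 2≤p) (≤-trans (small 1 2≤p λ ()) (≤-trans (≤-reflexive (cong (_* y 1) (*-zeroʳ A))) z≤n))
    ... | no b≢0   = ≤-trans (min 0 (<⇒≤ 2≤p)) (≤-trans (small 0 (<⇒≤ 2≤p) (b≢0 ∘ sym)) (≤-trans (≤-reflexive (cong (_* y 0) (*-zeroʳ A))) z≤n))
    xo≤A*W σ@(suc _) 2+σ≤p small = *-cancelˡ-≤ σ (+-cancelʳ-≤ (x o + x o) _ _ (begin
      σ * x o + (x o + x o)   ≡⟨ solve 2 (λ s x → s :* x :+ (x :+ x) := (con 2 :+ s) :* x) refl σ (x o) ⟩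
      (2 + σ) * x o           ≤⟨ *-monoˡ-≤ (x o) 2+σ≤p ⟩
      p * x o                 ≤⟨ Σ<-lower p o b (x o) _ pointwise′ ⟩
      Σ< p (λ s → σ * (A * except b (except o y) s)) + x o + Σ< p (only b (x o))
                              ≤⟨ +-monoʳ-≤ _ (Σ<-only-≤ p b (x o)) ⟩
      Σ< p (λ s → σ * (A * except b (except o y) s)) + x o + x o
                              ≡⟨ +-assoc _ (x o) (x o) ⟩
      Σ< p (λ s → σ * (A * except b (except o y) s)) + (x o + x o)
                              ≡⟨ cong (_+ (x o + x o)) (trans (Σ<-* p σ _) (cong (σ *_) (Σ<-* p A _))) ⟩
      σ * (A * W) + (x o + x o) ∎))
      where
      open +-*-Solver
      pointwise′ : ∀ s → s < p → s ≢ o → s ≢ b → x o ≤ σ * (A * except b (except o y) s)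
      pointwise′ s s<p s≢o s≢b rewrite except-≢ (except o y) s≢b | except-≢ y s≢o =
        ≤-trans (min s s<p) (≤-trans (small s s<p s≢b) (≤-reflexive
          (solve 3 (λ A σ y → A :* σ :* y := σ :* (A :* y)) refl A σ (y s))))

  [_] : Bool → ℕ
  [ b ] = if b then 1 else 0

  # : (ℕ → Bool) → List ℕ → ℕ
  # B []      = 0
  # B (e ∷ L) = [ B e ] + # B L

  #-true : ∀ L → # (const true) L ≡ length L
  #-true []      = refl
  #-true (e ∷ L) = cong suc (#-true L)

  #-false : ∀ L → # (const false) L ≡ 0
  #-false []      = refl
  #-false (e ∷ L) = #-false L

  count : ℕ → List ℕ → ℕ
  count e = # (λ x → does (x ≟ e))

  module Pieces (p : ℕ) .{{_ : NonZero p}} where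

    -- Since ζ^e = ζ^(e % p) (ζ^p)^(e / p), the quotients are exponents for ζ^p, whose order is
    -- smaller by the factor p.
    piece : ℕ → List ℕ → List ℕ
    piece s []      = []
    piece s (e ∷ L) = if does (e % p ≟ s) then e / p ∷ piece s L else piece s L

    piece-≡ : ∀ {e s} L → e % p ≡ s → piece s (e ∷ L) ≡ e / p ∷ piece s L
    piece-≡ {e} {s} L eq rewrite dec-true (e % p ≟ s) eq = refl

    piece-≢ : ∀ {e s} L → e % p ≢ s → piece s (e ∷ L) ≡ piece s L
    piece-≢ {e} {s} L neq rewrite dec-false (e % p ≟ s) neq = refl

    assemble : (ℕ → ℕ → Bool) → ℕ → Bool
    assemble B e = B (e % p) (e / p)

    #-assemble : ∀ B L → # (assemble B) L ≡ Σ< p (λ s → # (B s) (piece s L))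
    #-assemble B []      = sym (trans (Σ<-const p 0) (*-zeroʳ p))
    #-assemble B (e ∷ L) = trans (cong (λ k′ → [ assemble B e ] + k′) (#-assemble B L)) (sym (Σ<-bump (m%n<n e p)
      (cong (# (B (e % p))) (piece-≡ {e} L refl))
      (λ s s≢ → cong (# (B s)) (piece-≢ {e} L (s≢ ∘ sym)))))

    length-pieces : ∀ L → length L ≡ Σ< p (λ s → length (piece s L))
    length-pieces L = trans (sym (#-true L)) (trans (#-assemble (λ _ _ → true) L) (Σ<-cong p λ s _ → #-true (piece s L)))

    length-piece≤ : ∀ s L → length (piece s L) ≤ length L
    length-piece≤ s []      = z≤n
    length-piece≤ s (e ∷ L) with does (e % p ≟ s)
    ... | true  = s≤s (length-piece≤ s L)
    ... | false = m≤n⇒m≤1+n (length-piece≤ s L)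

    -- An exponent is determined by its remainder and its quotient.
    count-piece : ∀ e L → count e L ≡ count (e / p) (piece (e % p) L)
    count-piece e []      = refl
    count-piece e (x ∷ L) with x ≟ e | x % p ≟ e % p
    ... | yes refl | no r≢  = contradiction refl r≢
    ... | yes refl | yes _  rewrite dec-true (e ≟ e) refl | piece-≡ {e} L refl | dec-true (e / p ≟ e / p) refl =
      cong suc (count-piece e L)
    ... | no x≢e   | no r≢  rewrite dec-false (x ≟ e) x≢e | piece-≢ {x} L r≢ = count-piece e L
    ... | no x≢e   | yes r≡ rewrite dec-false (x ≟ e) x≢e | piece-≡ {x} L r≡
      | dec-false (x / p ≟ e / p) (λ q≡ → x≢e (trans (m≡m%n+[m/n]*n x p)
          (trans (cong₂ (λ r q → r + q * p) r≡ q≡) (sym (m≡m%n+[m/n]*n e p))))) = count-piece e L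

    All-piece : ∀ {P : ℕ → Set} {Q : ℕ → ℕ → Set} → (∀ e → P e → Q (e % p) (e / p)) →
                ∀ s L → All P L → All (Q s) (piece s L)
    All-piece h s []      []         = []
    All-piece {Q = Q} h s (e ∷ L) (pe ∷ pL) with e % p ≟ s
    ... | yes refl rewrite piece-≡ {e} L refl = h e pe ∷ All-piece {Q = Q} h s L pL
    ... | no r≢    rewrite piece-≢ {e} L r≢   = All-piece {Q = Q} h s L pL

open FiniteSums

-- Exponents are natural numbers, so p - s takes the place of -s.
residue-∣ : ∀ p .{{_ : NonZero p}} {s} e → s ℕ.< p → e % p ≡ s → p ∣ e ℕ.+ (p ∸ s)
residue-∣ p {s} e s<p ≡.refl = divides (suc (e / p)) (begin
  e ℕ.+ (p ∸ s)                              ≡⟨ ≡.cong (ℕ._+ (p ∸ s)) (ℕ.m≡m%n+[m/n]*n e p) ⟩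
  s ℕ.+ e / p ℕ.* p ℕ.+ (p ∸ s)              ≡⟨ solve 3 (λ s q r → s :+ q :+ r := s :+ r :+ q) ≡.refl s (e / p ℕ.* p) (p ∸ s) ⟩
  s ℕ.+ (p ∸ s) ℕ.+ e / p ℕ.* p              ≡⟨ ≡.cong (ℕ._+ e / p ℕ.* p) (ℕ.m+[n∸m]≡n (ℕ.<⇒≤ s<p)) ⟩
  p ℕ.+ e / p ℕ.* p                          ∎)
  where
  open ≡.≡-Reasoning
  open +-*-Solver

∣-residue : ∀ p .{{_ : NonZero p}} {s} e → s ℕ.< p → p ∣ e ℕ.+ (p ∸ s) → e % p ≡ s
∣-residue p {s} e s<p (divides q eq) = begin
  e % p                            ≡⟨ ℕ.[m+n]%n≡m%n e p ⟨
  (e ℕ.+ p) % p                    ≡⟨ ≡.cong (λ m → (e ℕ.+ m) % p) (ℕ.m∸n+n≡m (ℕ.<⇒≤ s<p)) ⟨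
  (e ℕ.+ (p ∸ s ℕ.+ s)) % p        ≡⟨ ≡.cong (_% p) (ℕ.+-assoc e (p ∸ s) s) ⟨
  (e ℕ.+ (p ∸ s) ℕ.+ s) % p        ≡⟨ ≡.cong (λ m → (m ℕ.+ s) % p) eq ⟩
  (q ℕ.* p ℕ.+ s) % p              ≡⟨ ≡.cong (_% p) (ℕ.+-comm (q ℕ.* p) s) ⟩
  (s ℕ.+ q ℕ.* p) % p              ≡⟨ ℕ.[m+kn]%n≡m%n s q p ⟩
  s % p                            ≡⟨ ℕ.m<n⇒m%n≡m s<p ⟩
  s                                ∎
  where open ≡.≡-Reasoning

-- The two numbers differ by (u - t) N′, and p cannot divide N′ since it would then divide 1. Hence
-- at most one of the conjugations ζ ↦ ζ^(1+tN′) with t < p is inadmissible.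
∣1+tN-unique-≤ : ∀ p N′ {t u} → Prime p → t ℕ.≤ u → u ℕ.< p → p ∣ 1 ℕ.+ t ℕ.* N′ → p ∣ 1 ℕ.+ u ℕ.* N′ → t ≡ u
∣1+tN-unique-≤ p N′ {t} {u} p-prime t≤u u<p p∣t p∣u with euclidsLemma (u ∸ t) N′ p-prime (∣m+n∣m⇒∣n (≡.subst (p ∣_) eq p∣u) p∣t)
  where
  eq : 1 ℕ.+ u ℕ.* N′ ≡ 1 ℕ.+ t ℕ.* N′ ℕ.+ (u ∸ t) ℕ.* N′
  eq = ≡.cong suc (≡.trans (≡.cong (ℕ._* N′) (≡.sym (ℕ.m+[n∸m]≡n t≤u))) (ℕ.*-distribʳ-+ N′ t (u ∸ t)))
... | inj₂ p∣N′ = contradiction (∣1⇒≡1 (∣m+n∣m⇒∣n (≡.subst (p ∣_) (ℕ.+-comm 1 (t ℕ.* N′)) p∣t) (∣n⇒∣m*n t p∣N′)))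
                                λ { ≡.refl → ¬prime[1] p-prime }
... | inj₁ p∣d with u ∸ t in eq
...   | zero  = ℕ.≤-antisym t≤u (ℕ.m∸n≡0⇒m≤n eq)
...   | suc d = contradiction (ℕ.≤-<-trans (ℕ.m∸n≤m u t) u<p) (ℕ.≤⇒≯ (≡.subst (p ℕ.≤_) (≡.sym eq) (∣⇒≤ p∣d)))

∣1+tN-unique : ∀ p N′ {t u} → Prime p → t ℕ.< p → u ℕ.< p → p ∣ 1 ℕ.+ t ℕ.* N′ → p ∣ 1 ℕ.+ u ℕ.* N′ → t ≡ u
∣1+tN-unique p N′ {t} {u} p-prime t<p u<p p∣t p∣u with ℕ.≤-total t u
... | inj₁ t≤u = ∣1+tN-unique-≤ p N′ p-prime t≤u u<p p∣t p∣u
... | inj₂ u≤t = ≡.sym (∣1+tN-unique-≤ p N′ p-prime u≤t t<p p∣u p∣t)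

-- Splitting relations into residue classes

module Orders (K : CharZeroDomain) where

  open CharZeroDomain K
  open CommutativeRing commutativeRing
  open PowerSums commutativeRing
  open Spans K
  open Galois K
  open import Relation.Binary.Reasoning.Setoid setoid
  open Solver

  Order : Carrier → ℕ → Set
  Order ζ N = ζ ^ N ≈ 1# × (∀ k → ζ ^ k ≈ 1# → N ∣ k)

  order-power : ∀ ζ p N′ .{{_ : NonZero p}} → Order ζ (p ℕ.* N′) → Order (ζ ^ p) N′
  order-power ζ p N′ (ζ^N≈1 , least) =
    trans (^-assocʳ ζ p N′) ζ^N≈1 , λ k h → *-cancelˡ-∣ p (least (p ℕ.* k) (trans (sym (^-assocʳ ζ p k)) h))

  ∑ : ℕ → (ℕ → Carrier) → Carrier
  ∑ zero    f = 0#
  ∑ (suc n) f = f n + ∑ n f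

  ∑-cong : ∀ n {f g} → (∀ t → t ℕ.< n → f t ≈ g t) → ∑ n f ≈ ∑ n g
  ∑-cong zero    h = refl
  ∑-cong (suc n) h = +-cong (h n ℕ.≤-refl) (∑-cong n λ t t<n → h t (ℕ.m<n⇒m<1+n t<n))

  ∑-+ : ∀ n f g → ∑ n (λ t → f t + g t) ≈ ∑ n f + ∑ n g
  ∑-+ zero    f g = sym (+-identityˡ 0#)
  ∑-+ (suc n) f g = trans (+-congˡ (∑-+ n f g))
    (solve 4 (λ a b c d → a :+ b :+ (c :+ d) := a :+ c :+ (b :+ d)) refl (f n) (g n) (∑ n f) (∑ n g))

  ∑-* : ∀ n c f → ∑ n (λ t → c * f t) ≈ c * ∑ n f
  ∑-* zero    c f = sym (zeroʳ c)
  ∑-* (suc n) c f = trans (+-congˡ (∑-* n c f)) (sym (distribˡ c _ _))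

  ∑-0 : ∀ n f → (∀ t → t ℕ.< n → f t ≈ 0#) → ∑ n f ≈ 0#
  ∑-0 zero    f h = refl
  ∑-0 (suc n) f h = trans (+-cong (h n ℕ.≤-refl) (∑-0 n f λ t t<n → h t (ℕ.m<n⇒m<1+n t<n))) (+-identityˡ 0#)

  ∑-single : ∀ n f k → k ℕ.< n → (∀ t → t ℕ.< n → t ≢ k → f t ≈ 0#) → ∑ n f ≈ f k
  ∑-single (suc n) f k k<1+n h with k ℕ.≟ n
  ... | yes ≡.refl = trans (+-congˡ (∑-0 n f λ t t<n → h t (ℕ.m<n⇒m<1+n t<n) (ℕ.<⇒≢ t<n))) (+-identityʳ _)
  ... | no k≢n     = trans (+-cong (h n ℕ.≤-refl λ n≡k → k≢n (≡.sym n≡k))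
    (∑-single n f k (ℕ.≤∧≢⇒< (ℕ.≤-pred k<1+n) k≢n) λ t t<n → h t (ℕ.m<n⇒m<1+n t<n))) (+-identityˡ _)

  geometric : ∀ n y → (y - 1#) * ∑ n (y ^_) ≈ y ^ n - 1#
  geometric zero    y = trans (zeroʳ _) (sym (-‿inverseʳ 1#))
  geometric (suc n) y = begin
    (y - 1#) * (y ^ n + ∑ n (y ^_))                ≈⟨ distribˡ _ _ _ ⟩
    (y - 1#) * y ^ n + (y - 1#) * ∑ n (y ^_)       ≈⟨ +-congˡ (geometric n y) ⟩
    (y - 1#) * y ^ n + (y ^ n - 1#)                ≈⟨ +-congʳ (distribʳ _ _ _) ⟩
    y * y ^ n + (- 1#) * y ^ n + (y ^ n - 1#)      ≈⟨ +-congʳ (+-congˡ (-1*x≈-x _)) ⟩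
    y * y ^ n - y ^ n + (y ^ n - 1#)               ≈⟨ solve 3 (λ a b c → a :- b :+ (b :- c) := a :- c) refl (y * y ^ n) (y ^ n) 1# ⟩
    y * y ^ n - 1#                                 ∎

  geometric-1 : ∀ n {y} → y ≈ 1# → ∑ n (y ^_) ≈ ι (+ n)
  geometric-1 zero    y≈1 = refl
  geometric-1 (suc n) y≈1 = +-cong (trans (^-congˡ n y≈1) (1^n≈1 n)) (geometric-1 n y≈1)

  geometric-0 : ∀ n {y} → y ^ n ≈ 1# → ¬ (y ≈ 1#) → ∑ n (y ^_) ≈ 0#
  geometric-0 n {y} y^n≈1 y≉1 = noZeroDivisors (trans (geometric n y) (x≈y⇒x-y≈0 y^n≈1)) (λ h → y≉1 (x-y≈0⇒x≈y h))

  -- For N = N′ + 1 the power ζ^(kN′) is an inverse of ζ^k.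
  cancel-power : ∀ {ζ N} k {x} → .{{NonZero N}} → ζ ^ N ≈ 1# → ζ ^ k * x ≈ 0# → x ≈ 0#
  cancel-power {ζ} {suc N′} k {x} ζ^N≈1 h = begin
    x                                  ≈⟨ *-identityˡ x ⟨
    1# * x                             ≈⟨ *-congʳ (^-multiple ζ (suc N′) ζ^N≈1 k) ⟨
    ζ ^ (k ℕ.* suc N′) * x             ≡⟨ ≡.cong (λ m → ζ ^ m * x) (≡.trans (ℕ.*-suc k N′) (ℕ.+-comm k (k ℕ.* N′))) ⟩
    ζ ^ (k ℕ.* N′ ℕ.+ k) * x           ≈⟨ *-congʳ (^-homo-* ζ (k ℕ.* N′) k) ⟩
    ζ ^ (k ℕ.* N′) * ζ ^ k * x         ≈⟨ *-assoc _ _ _ ⟩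
    ζ ^ (k ℕ.* N′) * (ζ ^ k * x)       ≈⟨ *-congˡ h ⟩
    ζ ^ (k ℕ.* N′) * 0#                ≈⟨ zeroʳ _ ⟩
    0#                                 ∎

  module _ (ζ : Carrier) (p N′ : ℕ) {{_ : NonZero p}} {{_ : NonZero N′}} (p-prime : Prime p)
           (order : Order ζ (p ℕ.* N′)) where

    open Pieces p

    private
      instance
        N≢0 : NonZero (p ℕ.* N′)
        N≢0 = ℕ.m*n≢0 p N′

      ζ^N≈1 = proj₁ order
      ω = ζ ^ N′

      ω^p≈1 : ω ^ p ≈ 1#
      ω^p≈1 = trans (^-assocʳ ζ N′ p) (trans (^-congʳ ζ (ℕ.*-comm N′ p)) ζ^N≈1)

      ω^k≈1⇒p∣k : ∀ k → ω ^ k ≈ 1# → p ∣ k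
      ω^k≈1⇒p∣k k h = *-cancelˡ-∣ N′ (≡.subst (_∣ N′ ℕ.* k) (ℕ.*-comm p N′) (proj₂ order (N′ ℕ.* k) (trans (sym (^-assocʳ ζ N′ k)) h)))

      p∣k⇒ω^k≈1 : ∀ {k} → p ∣ k → ω ^ k ≈ 1#
      p∣k⇒ω^k≈1 (divides q ≡.refl) = ^-multiple ω p ω^p≈1 q

      -- The exponent is 1 modulo N′, so this conjugation fixes ζ^p and multiplies ζ by ω^t.
      conjugate : ℕ → Carrier
      conjugate t = ζ ^ (1 ℕ.+ t ℕ.* N′)

      -- The character value ω^(-ts), with p - s in place of -s.
      weight : ℕ → ℕ → Carrier
      weight s t = ω ^ (t ℕ.* (p ∸ s))

    private
      weighted-term : ∀ s t e → weight s t * conjugate t ^ e ≈ ζ ^ e * (ω ^ (e ℕ.+ (p ∸ s))) ^ t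
      weighted-term s t e = begin
        ω ^ (t ℕ.* (p ∸ s)) * conjugate t ^ e
          ≈⟨ *-cong (^-assocʳ ζ N′ (t ℕ.* (p ∸ s))) (^-assocʳ ζ (1 ℕ.+ t ℕ.* N′) e) ⟩
        ζ ^ (N′ ℕ.* (t ℕ.* (p ∸ s))) * ζ ^ ((1 ℕ.+ t ℕ.* N′) ℕ.* e)
          ≈⟨ ^-homo-* ζ (N′ ℕ.* (t ℕ.* (p ∸ s))) ((1 ℕ.+ t ℕ.* N′) ℕ.* e) ⟨
        ζ ^ (N′ ℕ.* (t ℕ.* (p ∸ s)) ℕ.+ (1 ℕ.+ t ℕ.* N′) ℕ.* e)
          ≡⟨ ≡.cong (ζ ^_) (exponents N′ t (p ∸ s) e) ⟩
        ζ ^ (e ℕ.+ N′ ℕ.* ((e ℕ.+ (p ∸ s)) ℕ.* t))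
          ≈⟨ ^-homo-* ζ e _ ⟩
        ζ ^ e * ζ ^ (N′ ℕ.* ((e ℕ.+ (p ∸ s)) ℕ.* t))
          ≈⟨ *-congˡ (trans (^-assocʳ ω (e ℕ.+ (p ∸ s)) t) (^-assocʳ ζ N′ ((e ℕ.+ (p ∸ s)) ℕ.* t))) ⟨
        ζ ^ e * (ω ^ (e ℕ.+ (p ∸ s))) ^ t ∎
        where
        exponents : ∀ N t r e → N ℕ.* (t ℕ.* r) ℕ.+ (1 ℕ.+ t ℕ.* N) ℕ.* e ≡ e ℕ.+ N ℕ.* ((e ℕ.+ r) ℕ.* t)
        exponents = S.solve 4 (λ N t r e → N S.:* (t S.:* r) S.:+ (S.con 1 S.:+ t S.:* N) S.:* e
                                     S.:= e S.:+ N S.:* ((e S.:+ r) S.:* t)) ≡.refl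
          where
          module S = +-*-Solver

      weighted-sum : ∀ s e → ∑ p (λ t → weight s t * conjugate t ^ e) ≈ ζ ^ e * ∑ p ((ω ^ (e ℕ.+ (p ∸ s))) ^_)
      weighted-sum s e = trans (∑-cong p λ t _ → weighted-term s t e) (∑-* p (ζ ^ e) ((ω ^ (e ℕ.+ (p ∸ s))) ^_))

      weighted-sum-≡ : ∀ s e → s ℕ.< p → e % p ≡ s → ∑ p (λ t → weight s t * conjugate t ^ e) ≈ ι (+ p) * (ζ ^ s * (ζ ^ p) ^ (e / p))
      weighted-sum-≡ s e s<p e≡s = begin
        ∑ p (λ t → weight s t * conjugate t ^ e)
          ≈⟨ weighted-sum s e ⟩
        ζ ^ e * ∑ p ((ω ^ (e ℕ.+ (p ∸ s))) ^_)
          ≈⟨ *-cong (^-congʳ ζ (≡.trans (ℕ.m≡m%n+[m/n]*n e p) (≡.cong₂ ℕ._+_ e≡s (ℕ.*-comm (e / p) p))))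
                    (geometric-1 p (p∣k⇒ω^k≈1 (residue-∣ p e s<p e≡s))) ⟩
        ζ ^ (s ℕ.+ p ℕ.* (e / p)) * ι (+ p)
          ≈⟨ *-comm _ _ ⟩
        ι (+ p) * ζ ^ (s ℕ.+ p ℕ.* (e / p))
          ≈⟨ *-congˡ (trans (^-homo-* ζ s (p ℕ.* (e / p))) (*-congˡ (sym (^-assocʳ ζ p (e / p))))) ⟩
        ι (+ p) * (ζ ^ s * (ζ ^ p) ^ (e / p)) ∎

      weighted-sum-≢ : ∀ s e → s ℕ.< p → e % p ≢ s → ∑ p (λ t → weight s t * conjugate t ^ e) ≈ 0#
      weighted-sum-≢ s e s<p e≢s = begin
        ∑ p (λ t → weight s t * conjugate t ^ e)   ≈⟨ weighted-sum s e ⟩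
        ζ ^ e * ∑ p ((ω ^ (e ℕ.+ (p ∸ s))) ^_)
          ≈⟨ *-congˡ (geometric-0 p (trans (^-assocʳ ω (e ℕ.+ (p ∸ s)) p) (^-multiple ω p ω^p≈1 (e ℕ.+ (p ∸ s))))
                                    (λ h → e≢s (∣-residue p e s<p (ω^k≈1⇒p∣k (e ℕ.+ (p ∸ s)) h)))) ⟩
        ζ ^ e * 0#                                 ≈⟨ zeroʳ _ ⟩
        0#                                         ∎

    -- Orthogonality of the characters of ℤ/p: the sum of ω^(t(e-s)) over t is p if e lies in the
    -- class of s and 0 otherwise. This is Fourier inversion recovering one class from all the
    -- conjugates.
    extract-piece : ∀ s L → s ℕ.< p →
      ∑ p (λ t → weight s t * ev (conjugate t) L) ≈ ι (+ p) * (ζ ^ s * ev (ζ ^ p) (piece s L))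
    extract-piece s []      s<p = trans (∑-0 p _ λ t _ → zeroʳ _) (sym (trans (*-congˡ (zeroʳ _)) (zeroʳ _)))
    extract-piece s (e ∷ L) s<p = begin
      ∑ p (λ t → weight s t * (conjugate t ^ e + ev (conjugate t) L))
        ≈⟨ ∑-cong p (λ t _ → distribˡ _ _ _) ⟩
      ∑ p (λ t → weight s t * conjugate t ^ e + weight s t * ev (conjugate t) L)
        ≈⟨ ∑-+ p _ _ ⟩
      ∑ p (λ t → weight s t * conjugate t ^ e) + ∑ p (λ t → weight s t * ev (conjugate t) L)
        ≈⟨ +-congˡ (extract-piece s L s<p) ⟩
      ∑ p (λ t → weight s t * conjugate t ^ e) + ι (+ p) * (ζ ^ s * ev (ζ ^ p) (piece s L))
        ≈⟨ by-residue (e % p ℕ.≟ s) ⟩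
      ι (+ p) * (ζ ^ s * ev (ζ ^ p) (piece s (e ∷ L))) ∎
      where
      by-residue : Dec (e % p ≡ s) →
        ∑ p (λ t → weight s t * conjugate t ^ e) + ι (+ p) * (ζ ^ s * ev (ζ ^ p) (piece s L))
          ≈ ι (+ p) * (ζ ^ s * ev (ζ ^ p) (piece s (e ∷ L)))
      by-residue (yes e≡s) = begin
        _                  ≈⟨ +-congʳ (weighted-sum-≡ s e s<p e≡s) ⟩
        ι (+ p) * (ζ ^ s * (ζ ^ p) ^ (e / p)) + ι (+ p) * (ζ ^ s * ev (ζ ^ p) (piece s L))
                           ≈⟨ solve 4 (λ p z a b → p :* (z :* a) :+ p :* (z :* b) := p :* (z :* (a :+ b))) refl
                                (ι (+ p)) (ζ ^ s) ((ζ ^ p) ^ (e / p)) (ev (ζ ^ p) (piece s L)) ⟩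
        ι (+ p) * (ζ ^ s * ev (ζ ^ p) (e / p ∷ piece s L))
                           ≡⟨ ≡.cong (λ M → ι (+ p) * (ζ ^ s * ev (ζ ^ p) M)) (piece-≡ {e} L e≡s) ⟨
        _                  ∎
      by-residue (no e≢s) = begin
        _                  ≈⟨ +-congʳ (weighted-sum-≢ s e s<p e≢s) ⟩
        0# + ι (+ p) * (ζ ^ s * ev (ζ ^ p) (piece s L))
                           ≈⟨ +-identityˡ _ ⟩
        ι (+ p) * (ζ ^ s * ev (ζ ^ p) (piece s L))
                           ≡⟨ ≡.cong (λ M → ι (+ p) * (ζ ^ s * ev (ζ ^ p) M)) (piece-≢ {e} L e≢s) ⟨
        _                  ∎

    module _ (P Q : List ℕ) (evP≈evQ : ev ζ P ≈ ev ζ Q) where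

      private
        δ : ℕ → Carrier
        δ s = ev (ζ ^ p) (piece s P) - ev (ζ ^ p) (piece s Q)

        D : ℕ → Carrier
        D t = ev (conjugate t) P - ev (conjugate t) Q

        extract-δ : ∀ s → s ℕ.< p → ∑ p (λ t → weight s t * D t) ≈ ι (+ p) * (ζ ^ s * δ s)
        extract-δ s s<p = begin
          ∑ p (λ t → weight s t * D t)
            ≈⟨ ∑-cong p (λ t _ → solve 3 (λ w a b → w :* (a :- b) := w :* a :+ con -[1+ 0 ] :* (w :* b)) refl
                                   (weight s t) (ev (conjugate t) P) (ev (conjugate t) Q)) ⟩
          ∑ p (λ t → weight s t * ev (conjugate t) P + ι -[1+ 0 ] * (weight s t * ev (conjugate t) Q))
            ≈⟨ ∑-+ p _ _ ⟩
          ∑ p (λ t → weight s t * ev (conjugate t) P) + ∑ p (λ t → ι -[1+ 0 ] * (weight s t * ev (conjugate t) Q))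
            ≈⟨ +-cong (extract-piece s P s<p) (trans (∑-* p (ι -[1+ 0 ]) _) (*-congˡ (extract-piece s Q s<p))) ⟩
          ι (+ p) * (ζ ^ s * ev (ζ ^ p) (piece s P)) + ι -[1+ 0 ] * (ι (+ p) * (ζ ^ s * ev (ζ ^ p) (piece s Q)))
            ≈⟨ solve 4 (λ p z a b → p :* (z :* a) :+ con -[1+ 0 ] :* (p :* (z :* b)) := p :* (z :* (a :- b))) refl
                 (ι (+ p)) (ζ ^ s) (ev (ζ ^ p) (piece s P)) (ev (ζ ^ p) (piece s Q)) ⟩
          ι (+ p) * (ζ ^ s * δ s) ∎

        -- 1 + tN′ is always prime to N′, so it is prime to p N′ as soon as p does not divide it,
        -- and `galois` applies.
        D-vanishes : ∀ t → p ∤ 1 ℕ.+ t ℕ.* N′ → D t ≈ 0#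
        D-vanishes t p∤ = x≈y⇒x-y≈0 (galois ζ (p ℕ.* N′) ζ^N≈1 P Q (1 ℕ.+ t ℕ.* N′) coprime evP≈evQ)
          where
          coprime : ∀ q → Prime q → q ∣ 1 ℕ.+ t ℕ.* N′ → q ∤ p ℕ.* N′
          coprime q q-prime q∣m q∣N with euclidsLemma p N′ q-prime q∣N
          ... | inj₁ q∣p  = p∤ (≡.subst (_∣ 1 ℕ.+ t ℕ.* N′) (prime∣prime⇒≡ q-prime p-prime q∣p) q∣m)
          ... | inj₂ q∣N′ = ¬prime[1] (≡.subst Prime (∣1⇒≡1 (∣m+n∣m⇒∣n (≡.subst (q ∣_) (ℕ.+-comm 1 (t ℕ.* N′)) q∣m) (∣n⇒∣m*n t q∣N′))) q-prime)

        δ-vanishes : ∀ s → s ℕ.< p → ∑ p (λ t → weight s t * D t) ≈ 0# → δ s ≈ 0#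
        δ-vanishes s s<p h = cancel-power {N = p ℕ.* N′} s ζ^N≈1
          (torsionFree′ (+ p) (trans (sym (extract-δ s s<p)) h) λ { ≡.refl → contradiction p-prime λ () })

        weight-vanishes : ∀ s t → weight s t * D t ≈ 0# → D t ≈ 0#
        weight-vanishes s t = cancel-power {N = p} (t ℕ.* (p ∸ s)) ω^p≈1

      -- Summing the conjugate relations ζ ↦ ζ^(1+tN′) against the weights ω^(-ts) isolates the class of s.
      -- If p ∤ N′ exactly one t is not admissible, and it contributes the same value to all classes up to a unit.
      split-relation : (p ∣ N′ ⊎ (∃[ o ] (o ℕ.< p × ev (ζ ^ p) (piece o P) ≈ ev (ζ ^ p) (piece o Q)))) →
                       ∀ s → s ℕ.< p → ev (ζ ^ p) (piece s P) ≈ ev (ζ ^ p) (piece s Q)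
      split-relation hyp s s<p = x-y≈0⇒x≈y (δ-vanishes s s<p (∑-0 p _ λ t t<p → trans (*-congˡ (D≈0 t t<p)) (zeroʳ _)))
        where
        -- In the sum that extracts the class o only the inadmissible t survives, and the sum is
        -- zero because the relation holds in that class. The weight is a unit.
        only-exception : ∀ t → t ℕ.< p → p ∣ 1 ℕ.+ t ℕ.* N′ → ∃[ o ] (o ℕ.< p × ev (ζ ^ p) (piece o P) ≈ ev (ζ ^ p) (piece o Q)) → D t ≈ 0#
        only-exception t t<p p∣ (o , o<p , eq) = weight-vanishes o t (begin
          weight o t * D t                  ≈⟨ ∑-single p _ t t<p (λ u u<p u≢t → trans (*-congˡ (D-vanishes u λ p∣u →
                                                 u≢t (∣1+tN-unique p N′ p-prime u<p t<p p∣u p∣))) (zeroʳ _)) ⟨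
          ∑ p (λ u → weight o u * D u)      ≈⟨ extract-δ o o<p ⟩
          ι (+ p) * (ζ ^ o * δ o)           ≈⟨ *-congˡ (trans (*-congˡ (x≈y⇒x-y≈0 eq)) (zeroʳ _)) ⟩
          ι (+ p) * 0#                      ≈⟨ zeroʳ _ ⟩
          0#                                ∎)

        by-divisibility : ∀ t → t ℕ.< p → Dec (p ∣ 1 ℕ.+ t ℕ.* N′) → p ∣ N′ ⊎ (∃[ o ] (o ℕ.< p × ev (ζ ^ p) (piece o P) ≈ ev (ζ ^ p) (piece o Q))) → D t ≈ 0#
        by-divisibility t t<p (no p∤)  _           = D-vanishes t p∤
        by-divisibility t t<p (yes p∣) (inj₁ p∣N′) = contradiction
          (∣1⇒≡1 (∣m+n∣m⇒∣n (≡.subst (p ∣_) (ℕ.+-comm 1 (t ℕ.* N′)) p∣) (∣n⇒∣m*n t p∣N′)))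
          λ p≡1 → ¬prime[1] (≡.subst Prime p≡1 p-prime)
        by-divisibility t t<p (yes p∣) (inj₂ o)    = only-exception t t<p p∣ o

        D≈0 : ∀ t → t ℕ.< p → D t ≈ 0#
        D≈0 t t<p = by-divisibility t t<p (p ∣? (1 ℕ.+ t ℕ.* N′)) hyp

  -- Descent: an exponent k with ζ^k = 1 that N does not divide yields the smaller nonzero exponent
  -- k % N. The existence of such a k cannot be decided, whence the double negation.
  order-exists : ∀ ζ N → .{{NonZero N}} → ζ ^ N ≈ 1# → ¬ ¬ (∃[ M ] (NonZero M × Order ζ M))
  order-exists ζ = <-rec (λ N → .{{_ : NonZero N}} → ζ ^ N ≈ 1# → ¬ ¬ (∃[ M ] (NonZero M × Order ζ M))) step
    where
    step : ∀ N → (∀ {M} → M ℕ.< N → .{{_ : NonZero M}} → ζ ^ M ≈ 1# → ¬ ¬ (∃[ M ] (NonZero M × Order ζ M))) →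
           .{{_ : NonZero N}} → ζ ^ N ≈ 1# → ¬ ¬ (∃[ M ] (NonZero M × Order ζ M))
    step N@(suc _) smaller ζ^N≈1 c = ¬¬-excluded-middle {A = ∃[ k ] (ζ ^ k ≈ 1# × ¬ (N ∣ k))} λ where
      (no none) → c (N , _ , ζ^N≈1 , λ k h → decidable-stable (N ∣? k) λ N∤k → none (k , h , N∤k))
      (yes (k , h , N∤k)) → smaller (ℕ.m%n<n k N) {{ℕ.≢-nonZero λ eq → N∤k (m%n≡0⇒n∣m k N eq)}}
        (trans (sym (^-% ζ N ζ^N≈1 k)) h) c

-- Independent families of powers

no-prime-divisor⇒≡1 : ∀ N .{{_ : NonZero N}} → (∀ q → Prime q → q ∤ N) → N ≡ 1
no-prime-divisor⇒≡1 N no-prime with factorise N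
... | record { factors = []     ; isFactorisation = eq } = eq
... | record { factors = q ∷ qs ; isFactorisation = eq ; factorsPrime = q-prime ∷ _ } =
  contradiction (≡.subst (q ∣_) (≡.sym eq) (m∣m*n _)) (no-prime q q-prime)

Smooth : ℕ → ℕ → Set
Smooth P N = ∀ q → Prime q → q ∣ N → q ℕ.≤ P

smooth-∣ : ∀ {P M N} → M ∣ N → Smooth P N → Smooth P M
smooth-∣ M∣N smooth q q-prime q∣M = smooth q q-prime (∣-trans q∣M M∣N)

smooth-pred : ∀ {P N} → ¬ (Prime (suc P) × suc P ∣ N) → Smooth (suc P) N → Smooth P N
smooth-pred ¬both smooth q q-prime q∣N =
  ℕ.≤-pred (ℕ.≤∧≢⇒< (smooth q q-prime q∣N) λ { ≡.refl → ¬both (q-prime , q∣N) })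

∣N′<N : ∀ {p N N′} → .{{NonZero N}} → Prime p → N ≡ p ℕ.* N′ → N′ ℕ.< N
∣N′<N {p} {N} {zero}   {{N≢0}} _       _      = ℕ.n≢0⇒n>0 (ℕ.≢-nonZero⁻¹ N {{N≢0}})
∣N′<N {0}           {N′ = suc N′} p-prime ≡.refl = contradiction p-prime λ ()
∣N′<N {1}           {N′ = suc N′} p-prime ≡.refl = contradiction p-prime ¬prime[1]
∣N′<N {suc (suc p)} {N′ = suc N′} p-prime ≡.refl =
  ≡.subst (suc N′ ℕ.<_) (ℕ.*-comm (suc N′) (suc (suc p))) (ℕ.m<m*n (suc N′) (suc (suc p)) (ℕ.s≤s (ℕ.s≤s ℕ.z≤n)))

omit : ℕ → (ℕ → ℕ → Bool) → ℕ → ℕ → Bool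
omit o B s e with s ℕ.≟ o
... | yes _ = false
... | no _  = B s e

omit-≡ : ∀ o B e → omit o B o e ≡ false
omit-≡ o B e with o ℕ.≟ o
... | yes _  = ≡.refl
... | no o≢o = contradiction ≡.refl o≢o

#-cong : ∀ {B B′} → (∀ e → B e ≡ B′ e) → ∀ L → # B L ≡ # B′ L
#-cong h []      = ≡.refl
#-cong h (e ∷ L) = ≡.cong₂ (λ b n → [ b ] ℕ.+ n) (h e) (#-cong h L)

#-omit : ∀ o B (L : ℕ → List ℕ) s → # (omit o B s) (L s) ≡ except o (λ s → # (B s) (L s)) s
#-omit o B L s = by-cases (s ℕ.≟ o)
  where
  omit-≢ : s ≢ o → ∀ e → omit o B s e ≡ B s e
  omit-≢ s≢o e with s ℕ.≟ o
  ... | yes s≡o = contradiction s≡o s≢o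
  ... | no _    = ≡.refl
  by-cases : Dec (s ≡ o) → # (omit o B s) (L s) ≡ except o (λ s → # (B s) (L s)) s
  by-cases (yes ≡.refl) = ≡.trans (#-cong (omit-≡ s B) (L s)) (≡.trans (#-false (L s)) (≡.sym (except-≡ s (λ s → # (B s) (L s)))))
  by-cases (no s≢o)     = ≡.trans (#-cong (omit-≢ s≢o) (L s)) (≡.sym (except-≢ (λ s → # (B s) (L s)) s≢o))

module Selections (K : CharZeroDomain) where

  open CharZeroDomain K
  open CommutativeRing commutativeRing
  open PowerSums commutativeRing
  open Spans K
  open Galois K
  open Orders K

  Admissible : ℕ → (ℕ → Bool) → ℕ → Set
  Admissible N B e = e ℕ.< N × B e ≡ true

  -- The powers ζ^e with e < N and B e are linearly independent over ℤ.
  Independent : Carrier → ℕ → (ℕ → Bool) → Set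
  Independent ζ N B = ∀ P Q → All (Admissible N B) P → All (Admissible N B) Q →
                      ev ζ P ≈ ev ζ Q → ∀ e → count e P ≡ count e Q

  -- `L` may repeat exponents. It will have one entry per pair of points, so the fraction 1/c is
  -- measured in pairs and not in distinct directions.
  Selection : Carrier → ℕ → List ℕ → ℕ → Set
  Selection ζ N L c = ∃[ B ] (Independent ζ N B × length L ℕ.≤ c ℕ.* # B L)

  selection-weaken : ∀ {ζ N} L c d → c ℕ.≤ d → Selection ζ N L c → Selection ζ N L d
  selection-weaken L c d c≤d (B , ind , le) = B , ind , ℕ.≤-trans le (ℕ.*-monoˡ-≤ (# B L) c≤d)

  all-false : ∀ N B L → (∀ e → B e ≡ false) → All (Admissible N B) L → L ≡ []
  all-false N B []      h []             = ≡.refl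
  all-false N B (e ∷ L) h ((_ , Be) ∷ _) = contradiction (≡.trans (≡.sym (h e)) Be) λ ()

  independent-false : ∀ ζ N B → (∀ e → B e ≡ false) → Independent ζ N B
  independent-false ζ N B h P Q aP aQ _ e =
    ≡.cong (count e) (≡.trans (all-false N B P h aP) (≡.sym (all-false N B Q h aQ)))

  selection-[] : ∀ ζ N L c → length L ℕ.< 1 → Selection ζ N L c
  selection-[] ζ N L c L<1 = const false , independent-false ζ N (const false) (λ _ → ≡.refl) ,
    ℕ.≤-trans (ℕ.≤-pred L<1) ℕ.z≤n

  ι-injective : ∀ m n → ι (+ m) ≈ ι (+ n) → m ≡ n
  ι-injective m n h = ℤ.+-injective (ℤ.i-j≡0⇒i≡j (+ m) (+ n) (difference≡0 (+ m ℤ.- + n ℤ.≟ + 0)))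
    where
    difference≡0 : Dec (+ m ℤ.- + n ≡ + 0) → + m ℤ.- + n ≡ + 0
    difference≡0 (yes eq) = eq
    difference≡0 (no neq) = contradiction (sym (torsionFree′ (+ m ℤ.- + n) {1#} (trans (*-identityʳ _)
      (trans (ι-+ (+ m) (ℤ.- + n)) (trans (+-congˡ (ι-neg (+ n))) (x≈y⇒x-y≈0 h)))) neq)) 0≉1

  -- The only admissible exponent is 0, so a value is the number of terms, and characteristic zero
  -- recovers that number.
  independent-1 : ∀ ζ B → Independent ζ 1 B
  independent-1 ζ B P Q aP aQ h = equal
    where
    evaluate : ∀ L → All (Admissible 1 B) L → ev ζ L ≈ ι (+ count 0 L)
    evaluate []      []                     = refl
    evaluate (0 ∷ L) (_ ∷ aL)               = +-congˡ (evaluate L aL)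
    evaluate (suc e ∷ L) ((ℕ.s≤s () , _) ∷ _)
    count-suc : ∀ e L → All (Admissible 1 B) L → count (suc e) L ≡ 0
    count-suc e []          []              = ≡.refl
    count-suc e (0 ∷ L)     (_ ∷ aL)        = count-suc e L aL
    count-suc e (suc _ ∷ L) ((ℕ.s≤s () , _) ∷ _)
    equal : ∀ e → count e P ≡ count e Q
    equal 0       = ι-injective _ _ (trans (sym (evaluate P aP)) (trans h (evaluate Q aQ)))
    equal (suc e) = ≡.trans (count-suc e P aP) (≡.sym (count-suc e Q aQ))

  module _ (ζ : Carrier) (p N′ : ℕ) {{_ : NonZero p}} {{_ : NonZero N′}} (p-prime : Prime p)
           (order : Order ζ (p ℕ.* N′)) where

    open Pieces p

    -- `split-relation` restricts a relation to each class, where the selected powers of ζ^p are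
    -- independent. A class from which nothing is selected gives two empty lists, and so the one
    -- valid relation that is demanded in the second case.
    independent-assemble : ∀ B → (∀ s → Independent (ζ ^ p) N′ (B s)) →
      (p ∣ N′ ⊎ (∃[ o ] (o ℕ.< p × (∀ e → B o e ≡ false)))) → Independent ζ (p ℕ.* N′) (assemble B)
    independent-assemble B ind hyp P Q aP aQ h e = ≡.trans (count-piece e P) (≡.trans
      (ind (e % p) (piece (e % p) P) (piece (e % p) Q) (pieces P aP) (pieces Q aQ)
        (split-relation ζ p N′ p-prime order P Q h hyp′ (e % p) (ℕ.m%n<n e p)) (e / p))
      (≡.sym (count-piece e Q)))
      where
      pieces : ∀ L → All (Admissible (p ℕ.* N′) (assemble B)) L → ∀ {s} → All (Admissible N′ (B s)) (piece s L)
      pieces L aL {s} = All-piece {Q = λ s → Admissible N′ (B s)}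
        (λ e (e<N , Be) → ℕ.m<n*o⇒m/o<n (≡.subst (e ℕ.<_) (ℕ.*-comm p N′) e<N) , Be) s L aL
      hyp′ : p ∣ N′ ⊎ (∃[ o ] (o ℕ.< p × ev (ζ ^ p) (piece o P) ≈ ev (ζ ^ p) (piece o Q)))
      hyp′ = [ inj₁ , (λ (o , o<p , Bo) → inj₂ (o , o<p , reflexive (≡.cong (ev (ζ ^ p)) (≡.trans
        (all-false N′ (B o) (piece o P) Bo (pieces P aP)) (≡.sym (all-false N′ (B o) (piece o Q) Bo (pieces Q aQ))))))) ]′ hyp

    selection-assemble : p ∣ N′ → ∀ L c → (∀ s → Selection (ζ ^ p) N′ (piece s L) c) → Selection ζ (p ℕ.* N′) L c
    selection-assemble p∣N′ L c sel = assemble B , independent-assemble B (λ s → proj₁ (proj₂ (sel s))) (inj₁ p∣N′) , (begin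
      length L                                       ≡⟨ length-pieces L ⟩
      Σ< p (λ s → length (piece s L))                ≤⟨ Σ<-mono p (λ s _ → proj₂ (proj₂ (sel s))) ⟩
      Σ< p (λ s → c ℕ.* # (B s) (piece s L))         ≡⟨ Σ<-* p c _ ⟩
      c ℕ.* Σ< p (λ s → # (B s) (piece s L))         ≡⟨ ≡.cong (c ℕ.*_) (#-assemble B L) ⟨
      c ℕ.* # (assemble B) L                         ∎)
      where
      open ℕ.≤-Reasoning
      B : ℕ → ℕ → Bool
      B s = proj₁ (sel s)

    selection-omit : ∀ L c o → o ℕ.< p → (B : ℕ → ℕ → Bool) → (∀ s → Independent (ζ ^ p) N′ (B s)) →
      Σ< p (λ s → length (piece s L)) ℕ.≤ c ℕ.* Σ< p (except o (λ s → # (B s) (piece s L))) →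
      Selection ζ (p ℕ.* N′) L c
    selection-omit L c o o<p B ind le = assemble (omit o B) ,
      independent-assemble (omit o B) ind′ (inj₂ (o , o<p , omit-≡ o B)) , (begin
      length L                                                   ≡⟨ length-pieces L ⟩
      Σ< p (λ s → length (piece s L))                            ≤⟨ le ⟩
      c ℕ.* Σ< p (except o (λ s → # (B s) (piece s L)))          ≡⟨ ≡.cong (c ℕ.*_) (Σ<-cong p λ s _ → #-omit o B (λ s → piece s L) s) ⟨
      c ℕ.* Σ< p (λ s → # (omit o B s) (piece s L))              ≡⟨ ≡.cong (c ℕ.*_) (#-assemble (omit o B) L) ⟨
      c ℕ.* # (assemble (omit o B)) L                            ∎)
      where
      open ℕ.≤-Reasoning
      ind′ : ∀ s → Independent (ζ ^ p) N′ (omit o B s)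
      ind′ s P Q aP aQ with s ℕ.≟ o
      ... | yes _ = independent-false (ζ ^ p) N′ (const false) (λ _ → ≡.refl) P Q aP aQ
      ... | no _  = ind s P Q aP aQ

  -- The loss factor equals the bound on the primes because p/(p-1) telescopes over all integers up
  -- to that bound, prime or not.
  SmoothSelection : ℕ → ℕ → Set
  SmoothSelection P N = .{{_ : NonZero N}} → ∀ ζ → Order ζ N → Smooth P N → ∀ L → Selection ζ N L P

  smooth-selection-1 : ∀ N → SmoothSelection 1 N
  smooth-selection-1 N ζ order smooth L = const true ,
    ≡.subst (λ N → Independent ζ N (const true)) (≡.sym N≡1) (independent-1 ζ (const true)) ,
    ℕ.≤-reflexive (≡.sym (≡.trans (ℕ.*-identityˡ _) (#-true L)))
    where
    N≡1 : N ≡ 1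
    N≡1 = no-prime-divisor⇒≡1 N λ q q-prime q∣N → ¬prime[1] (≡.subst Prime
      (ℕ.≤-antisym (smooth q q-prime q∣N) (ℕ.n≢0⇒n>0 λ { ≡.refl → contradiction q-prime λ () })) q-prime)

  -- If p divides N′, no class is dropped and the recursion is on N with the same bound. Otherwise
  -- N′ has only primes below p, and `drop-lightest` turns their factor p - 1 into p.
  smooth-selection-step : ∀ P → (∀ N → SmoothSelection (suc P) N) →
    ∀ N → (∀ {N′} → N′ ℕ.< N → SmoothSelection (suc (suc P)) N′) → SmoothSelection (suc (suc P)) N
  smooth-selection-step P below N smaller ζ order smooth L with prime? (suc (suc P)) | suc (suc P) ∣? N
  ... | no ¬prime   | _      = selection-weaken L (suc P) (suc (suc P)) (ℕ.n≤1+n _)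
    (below N ζ order (smooth-pred (λ (p-prime , _) → ¬prime p-prime) smooth) L)
  ... | yes _       | no p∤N = selection-weaken L (suc P) (suc (suc P)) (ℕ.n≤1+n _)
    (below N ζ order (smooth-pred (λ (_ , p∣N) → p∤N p∣N) smooth) L)
  ... | yes p-prime | yes (divides N′ eq) = ≡.subst (λ N → Selection ζ N L p) (≡.sym N≡pN′) (by-divisibility (p ∣? N′))
    where
    p = suc (suc P)
    N≡pN′ : N ≡ p ℕ.* N′
    N≡pN′ = ≡.trans eq (ℕ.*-comm N′ p)
    N′∣N : N′ ∣ N
    N′∣N = divides p N≡pN′
    instance
      N′≢0 : NonZero N′
      N′≢0 = ℕ.≢-nonZero λ { ≡.refl → ℕ.≢-nonZero⁻¹ N eq }
    order′ : Order ζ (p ℕ.* N′)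
    order′ = ≡.subst (Order ζ) N≡pN′ order
    open Pieces p
    by-divisibility : Dec (p ∣ N′) → Selection ζ (p ℕ.* N′) L p
    by-divisibility (yes p∣N′) = selection-assemble ζ p N′ p-prime order′ p∣N′ L p λ s →
      smaller (∣N′<N p-prime N≡pN′) (ζ ^ p) (order-power ζ p N′ order′) (smooth-∣ N′∣N smooth) (piece s L)
    by-divisibility (no p∤N′) =
      let o , o<p , min = argmin (suc P) (λ s → length (piece s L))
      in selection-omit ζ p N′ p-prime order′ L p o o<p (λ s → proj₁ (sel s)) (λ s → proj₁ (proj₂ (sel s)))
           (drop-lightest (suc P) _ _ o o<p min (λ s _ → proj₂ (proj₂ (sel s))))
      where
      sel : ∀ s → Selection (ζ ^ p) N′ (piece s L) (suc P)
      sel s = below N′ (ζ ^ p) (order-power ζ p N′ order′)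
        (smooth-pred (λ (_ , p∣N′) → p∤N′ p∣N′) (smooth-∣ N′∣N smooth)) (piece s L)

  smooth-selection : ∀ P N → SmoothSelection (suc P) N
  smooth-selection zero    = smooth-selection-1
  smooth-selection (suc P) = <-rec (SmoothSelection (suc (suc P))) (smooth-selection-step P (smooth-selection P))

  -- `A` accounts for the primes up to A and τ for the larger ones, however many there are. The
  -- condition τ ≤ A makes every prime above A exceed τ, as `drop-lightest-small` demands.
  FewSelection : ℕ → ℕ → ℕ → Set
  FewSelection A P N = .{{_ : NonZero N}} → ∀ ζ → Order ζ N → Smooth P N →
                       ∀ τ → τ ℕ.≤ A → ∀ L → length L ℕ.< 2 ℕ.^ τ → Selection ζ N L (A ℕ.* τ)

  -- For τ = 0 the list is empty, its length being below 2^0. For τ > 0 the factor of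
  -- `smooth-selection` is already small enough.
  few-selection-≤ : ∀ A P → P ℕ.≤ suc A → ∀ N → FewSelection (suc A) P N
  few-selection-≤ A P P≤1+A N ζ order smooth zero      _ L L<1 = selection-[] ζ N L (suc A ℕ.* 0) L<1
  few-selection-≤ A P P≤1+A N ζ order smooth τ@(suc _) _ L _   = selection-weaken L (suc A) (suc A ℕ.* τ) (ℕ.m≤m*n (suc A) τ)
    (smooth-selection A N ζ order (λ q q-prime q∣N → ℕ.≤-trans (smooth q q-prime q∣N) P≤1+A) L)

  few-selection-step : ∀ A P → A ℕ.≤ P → (∀ N → FewSelection A P N) →
    ∀ N → (∀ {N′} → N′ ℕ.< N → FewSelection A (suc P) N′) → FewSelection A (suc P) N
  few-selection-step A P A≤P below N smaller ζ order smooth zero _ L L<1 = selection-[] ζ N L (A ℕ.* 0) L<1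
  few-selection-step A P A≤P below N smaller ζ order smooth τ@(suc σ) τ≤A L L<2^τ with prime? (suc P) | suc P ∣? N
  ... | no ¬prime   | _      = below N ζ order (smooth-pred (λ (p-prime , _) → ¬prime p-prime) smooth) τ τ≤A L L<2^τ
  ... | yes _       | no p∤N = below N ζ order (smooth-pred (λ (_ , p∣N) → p∤N p∣N) smooth) τ τ≤A L L<2^τ
  ... | yes p-prime | yes (divides N′ eq) = ≡.subst (λ N → Selection ζ N L (A ℕ.* τ)) (≡.sym N≡pN′) (by-divisibility (p ∣? N′))
    where
    p = suc P
    N≡pN′ : N ≡ p ℕ.* N′
    N≡pN′ = ≡.trans eq (ℕ.*-comm N′ p)
    N′∣N : N′ ∣ N
    N′∣N = divides p N≡pN′
    instance
      N′≢0 : NonZero N′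
      N′≢0 = ℕ.≢-nonZero λ { ≡.refl → ℕ.≢-nonZero⁻¹ N eq }
    order′ : Order ζ (p ℕ.* N′)
    order′ = ≡.subst (Order ζ) N≡pN′ order
    open Pieces p
    size : ℕ → ℕ
    size s = length (piece s L)
    size< : ∀ s → size s ℕ.< 2 ℕ.^ τ
    size< s = ℕ.≤-<-trans (length-piece≤ s L) L<2^τ
    by-divisibility : Dec (p ∣ N′) → Selection ζ (p ℕ.* N′) L (A ℕ.* τ)
    by-divisibility (yes p∣N′) = selection-assemble ζ p N′ p-prime order′ p∣N′ L (A ℕ.* τ) λ s →
      smaller (∣N′<N p-prime N≡pN′) (ζ ^ p) (order-power ζ p N′ order′) (smooth-∣ N′∣N smooth)
        τ τ≤A (piece s L) (size< s)
    by-divisibility (no p∤N′) =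
      let o , o<p , min = argmin P size
          b , small     = exceptional (ℕ.anyUpTo? (λ s → 2 ℕ.^ σ ℕ.≤? size s) p)
      in selection-omit ζ p N′ p-prime order′ L (A ℕ.* τ) o o<p (λ s → proj₁ (sel s)) (λ s → proj₁ (proj₂ (sel s)))
           (drop-lightest-small p A σ size _ o b (ℕ.s≤s (ℕ.≤-trans τ≤A A≤P)) o<p min
             (λ s _ → proj₁ (proj₂ (proj₂ (sel s))))
             (λ s s<p s≢b → proj₂ (proj₂ (proj₂ (sel s))) (small s s<p s≢b)))
      where
      select : ∀ υ → υ ℕ.≤ A → ∀ M → length M ℕ.< 2 ℕ.^ υ → Selection (ζ ^ p) N′ M (A ℕ.* υ)
      select = below N′ (ζ ^ p) (order-power ζ p N′ order′)
        (smooth-pred (λ (_ , p∣N′) → p∤N′ p∣N′) (smooth-∣ N′∣N smooth))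
      -- One selection has to serve both bounds: a small class is treated with σ, whose factor
      -- implies that for τ, and a large class with τ.
      sel′ : ∀ s → Dec (size s ℕ.< 2 ℕ.^ σ) → ∃[ B ] (Independent (ζ ^ p) N′ B × size s ℕ.≤ A ℕ.* τ ℕ.* # B (piece s L)
               × (size s ℕ.< 2 ℕ.^ σ → size s ℕ.≤ A ℕ.* σ ℕ.* # B (piece s L)))
      sel′ s (yes small) = let B , ind , le = select σ (ℕ.<⇒≤ τ≤A) (piece s L) small in
        B , ind , ℕ.≤-trans le (ℕ.*-monoˡ-≤ (# B (piece s L)) (ℕ.*-monoʳ-≤ A (ℕ.n≤1+n σ))) , λ _ → le
      sel′ s (no ¬small) = let B , ind , le = select τ τ≤A (piece s L) (size< s) in
        B , ind , le , λ small → contradiction small ¬small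
      sel : ∀ s → ∃[ B ] (Independent (ζ ^ p) N′ B × size s ℕ.≤ A ℕ.* τ ℕ.* # B (piece s L)
               × (size s ℕ.< 2 ℕ.^ σ → size s ℕ.≤ A ℕ.* σ ℕ.* # B (piece s L)))
      sel s = sel′ s (size s ℕ.<? 2 ℕ.^ σ)
      -- Two classes with at least 2^σ entries would together reach 2^τ. If there is no such class
      -- at all, 0 is an arbitrary choice of the exception.
      exceptional : Dec (∃[ s ] (s ℕ.< p × 2 ℕ.^ σ ℕ.≤ size s)) → ∃[ b ] (∀ s → s ℕ.< p → s ≢ b → size s ℕ.< 2 ℕ.^ σ)
      exceptional (no none) = 0 , λ s s<p _ → ℕ.≰⇒> λ big → none (s , s<p , big)
      exceptional (yes (b , b<p , b-big)) = b , λ s s<p s≢b → ℕ.≰⇒> λ s-big → ℕ.<⇒≱ L<2^τ (begin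
        2 ℕ.^ τ                       ≡⟨ ≡.cong (2 ℕ.^ σ ℕ.+_) (ℕ.+-identityʳ _) ⟩
        2 ℕ.^ σ ℕ.+ 2 ℕ.^ σ           ≤⟨ ℕ.+-mono-≤ s-big b-big ⟩
        size s ℕ.+ size b             ≤⟨ Σ<-two-terms size s<p b<p s≢b ⟩
        Σ< p size                     ≡⟨ length-pieces L ⟨
        length L                      ∎)
        where open ℕ.≤-Reasoning

  few-selection : ∀ A P N → FewSelection (suc A) P N
  few-selection A zero    = few-selection-≤ A 0 ℕ.z≤n
  few-selection A (suc P) with suc P ℕ.≤? suc A
  ... | yes P<A = few-selection-≤ A (suc P) P<A
  ... | no P≮A  = <-rec (FewSelection (suc A) (suc P)) (few-selection-step (suc A) P (ℕ.≤-pred (ℕ.≰⇒> P≮A)) (few-selection A P))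

  -- Every N is N-smooth, so the loss does not depend on the order. The least A allowed by τ ≤ A
  -- produces the square.
  selection : ∀ {ζ N} → .{{_ : NonZero N}} → Order ζ N → ∀ τ L → length L ℕ.< 2 ℕ.^ suc τ → Selection ζ N L (suc τ ℕ.* suc τ)
  selection {ζ} {N} order τ L L<2^τ =
    few-selection τ N N ζ order (λ q _ q∣N → ∣⇒≤ q∣N) (suc τ) ℕ.≤-refl L L<2^τ

-- Counting in lists and finite sets

module _ {A B : Set} (f : A → B) where

  length-≤ : ∀ xs ys → Unique xs → (∀ {x} → x ∈ xs → f x ∈ ys) →
             (∀ {x y} → x ∈ xs → y ∈ xs → f x ≡ f y → x ≡ y) → length xs ℕ.≤ length ys
  length-≤ []       ys _              _  _   = ℕ.z≤n
  length-≤ (x ∷ xs) ys (x∉xs ∷ uniq) f∈ inj with ∈-∃++ (f∈ (here ≡.refl))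
  ... | as , bs , ≡.refl = begin
    suc (length xs)                      ≤⟨ ℕ.s≤s (length-≤ xs (as ++ bs) uniq f∈′ (λ x∈ y∈ → inj (there x∈) (there y∈))) ⟩
    suc (length (as ++ bs))              ≡⟨ ≡.cong suc (length-++ as) ⟩
    suc (length as ℕ.+ length bs)        ≡⟨ ℕ.+-suc (length as) (length bs) ⟨
    length as ℕ.+ suc (length bs)        ≡⟨ length-++ as ⟨
    length (as ++ f x ∷ bs)              ∎
    where
    open ℕ.≤-Reasoning
    f∈′ : ∀ {y} → y ∈ xs → f y ∈ as ++ bs
    f∈′ {y} y∈ with ∈-++⁻ as (f∈ (there y∈))
    ... | inj₁ fy∈as         = ∈-++⁺ˡ fy∈as
    ... | inj₂ (there fy∈bs) = ∈-++⁺ʳ as fy∈bs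
    ... | inj₂ (here fy≡fx)  = contradiction (≡.sym (inj (there y∈) (here ≡.refl) fy≡fx)) (All.lookup x∉xs y∈)

length-filter-split : ∀ {A : Set} {P : A → Set} (P? : Decidable P) xs →
                      length xs ≡ length (filter P? xs) ℕ.+ length (filter (¬? ∘ P?) xs)
length-filter-split P? []       = ≡.refl
length-filter-split P? (x ∷ xs) with does (P? x)
... | true  = ≡.cong suc (length-filter-split P? xs)
... | false = ≡.trans (≡.cong suc (length-filter-split P? xs)) (≡.sym (ℕ.+-suc _ _))

pairs≤n² : ∀ {n} (xs : List (Fin n × Fin n)) → Unique xs → length xs ℕ.≤ n ℕ.* n
pairs≤n² {n} xs uniq = ≡.subst (length xs ℕ.≤_) (length-tabulate id)
  (length-≤ (uncurry Fin.combine) xs (allFin (n ℕ.* n)) uniq (λ _ → ∈-allFin _)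
    λ {x} {y} _ _ eq → let eq₁ , eq₂ = Fin.combine-injective (proj₁ x) (proj₂ x) (proj₁ y) (proj₂ y) eq in ≡.cong₂ _,_ eq₁ eq₂)

-- Double negation shift, which is constructive over a finite set. It makes it possible to filter
-- points by an undecidable predicate.
¬¬-decide-all : ∀ {n} (P : Fin n → Set) → ¬ ¬ (∀ x → Dec (P x))
¬¬-decide-all {zero}  P k = k λ ()
¬¬-decide-all {suc n} P k = ¬¬-excluded-middle λ d → ¬¬-decide-all (P ∘ Fin.suc) λ ds →
  k λ { Fin.zero → d ; (Fin.suc x) → ds x }

count-here : ∀ e L → count e (e ∷ L) ≡ suc (count e L)
count-here e L rewrite dec-true (e ℕ.≟ e) ≡.refl = ≡.refl

count-there : ∀ {e x} L → x ≢ e → count e (x ∷ L) ≡ count e L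
count-there {e} {x} L x≢e rewrite dec-false (x ℕ.≟ e) x≢e = ≡.refl

count-∷-≤ : ∀ e x L → count e L ℕ.≤ count e (x ∷ L)
count-∷-≤ e x L = ℕ.m≤n+m (count e L) _

-- Counting edges with independent directions

module Grids (K : CharZeroDomain) where

  open CharZeroDomain K
  open CommutativeRing commutativeRing
  open PowerSums commutativeRing
  open Orders K
  open Selections K

  module _ {n : ℕ} (S : Fin n → Carrier) (S-injective : ∀ {i j} → S i ≈ S j → i ≡ j)
           (ζ : Carrier) (N : ℕ) where

    HasDirection : ℕ → Fin n × Fin n → Set
    HasDirection e (i , j) = S j ≈ S i + ζ ^ e

    private
      translate : ∀ {x y s q p z} → y ≈ x + z → x + q ≈ s + p → y + q ≈ s + (z + p)
      translate {x} {y} {s} {q} {p} {z} y≈ eq = begin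
        y + q           ≈⟨ +-congʳ y≈ ⟩
        x + z + q       ≈⟨ solve 3 (λ x z q → x :+ z :+ q := x :+ q :+ z) refl x z q ⟩
        x + q + z       ≈⟨ +-congʳ eq ⟩
        s + p + z       ≈⟨ solve 3 (λ s p z → s :+ p :+ z := s :+ (z :+ p)) refl s p z ⟩
        s + (z + p)     ∎
        where
        open import Relation.Binary.Reasoning.Setoid setoid
        open Solver

      translate⁻¹ : ∀ {x y s q p z} → y ≈ x + z → y + q ≈ s + p → x + (z + q) ≈ s + p
      translate⁻¹ {x} {y} {s} {q} {p} {z} y≈ eq = trans (sym (+-assoc x z q)) (trans (+-congʳ (sym y≈)) eq)

      cancel : ∀ {s p q} → s + q ≈ s + p → q ≈ p
      cancel {s} {p} {q} = +-cancelˡ s q p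

    module _ (B : ℕ → Bool) (ind : Independent ζ N B) where

      Edge : Fin n × Fin n → Set
      Edge ij = ∃[ e ] (Admissible N B e × HasDirection e ij)

      private
        -- The half space of the points whose d-th coordinate relative to u is positive.
        Beyond : Fin n → ℕ → Fin n → Set
        Beyond u d x = ∃[ P ] ∃[ Q ] (All (Admissible N B) P × All (Admissible N B) Q ×
          S x + ev ζ Q ≈ S u + ev ζ P × count d Q ℕ.< count d P)

        -- Cancelling `S u` leaves a relation between admissible powers with different
        -- multiplicities of d, against independence.
        ¬beyond-self : ∀ u d → ¬ Beyond u d u
        ¬beyond-self u d (P , Q , aP , aQ , eq , lt) = ℕ.<⇒≢ lt (ind Q P aQ aP (cancel eq) d)

        beyond-edge : ∀ {u v d} → Admissible N B d → HasDirection d (u , v) → Beyond u d v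
        beyond-edge {u} {v} {d} ad dir = d ∷ [] , [] , ad ∷ [] , [] ,
          trans (+-identityʳ (S v)) (trans dir (+-congˡ (sym (+-identityʳ (ζ ^ d))))) ,
          ≡.subst (0 ℕ.<_) (≡.sym (count-here d [])) (ℕ.s≤s ℕ.z≤n)

        beyond-forward : ∀ u d {x y} → Edge (x , y) → Beyond u d x → Beyond u d y
        beyond-forward u d (e , ae , dir) (P , Q , aP , aQ , eq , lt) =
          e ∷ P , Q , ae ∷ aP , aQ , translate dir eq , ℕ.<-≤-trans lt (count-∷-≤ d e P)

        -- Going back along an edge adds e to Q, which leaves the count of d unchanged if e is not
        -- d. With `beyond-forward` this says that edges never leave the half space and enter it in
        -- direction d only.
        beyond-backward : ∀ u d {x y e} → Admissible N B e → HasDirection e (x , y) → e ≢ d → Beyond u d y → Beyond u d x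
        beyond-backward u d {e = e} ae dir e≢d (P , Q , aP , aQ , eq , lt) =
          P , e ∷ Q , aP , ae ∷ aQ , translate⁻¹ dir eq , ≡.subst (ℕ._< count d P) (≡.sym (count-there Q e≢d)) lt

        crossing-direction : ∀ u d {x y} → Edge (x , y) → ¬ Beyond u d x → Beyond u d y → HasDirection d (x , y)
        crossing-direction u d (e , ae , dir) x∉ y∈ with e ℕ.≟ d
        ... | yes ≡.refl = dir
        ... | no e≢d     = contradiction (beyond-backward u d ae dir e≢d y∈) x∉

        -- The quantifier over t is inside because the smaller side of a cut is counted with a
        -- smaller t than the whole.
        Bounded : ℕ → Set
        Bounded k = ∀ t V E → length V ≡ k → Unique V → Unique E →
          (∀ {ij} → ij ∈ E → Edge ij × proj₁ ij ∈ V × proj₂ ij ∈ V) → length V ℕ.< 2 ℕ.^ suc t → length E ℕ.≤ length V ℕ.* t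

        -- The cut edges number at most a, the size of the smaller side, and that side is charged
        -- only t per vertex: a t + a = a (t + 1).
        arithmetic : ∀ t {a b c e f v} → a ℕ.≤ b → v ≡ a ℕ.+ b → c ℕ.≤ a →
          e ℕ.≤ a ℕ.* t → f ℕ.≤ b ℕ.* suc t → e ℕ.+ c ℕ.+ f ℕ.≤ v ℕ.* suc t
        arithmetic t {a} {b} {c} {e} {f} {v} a≤b ≡.refl c≤a e≤ f≤ = begin
          e ℕ.+ c ℕ.+ f                          ≤⟨ ℕ.+-mono-≤ (ℕ.+-mono-≤ e≤ c≤a) f≤ ⟩
          a ℕ.* t ℕ.+ a ℕ.+ b ℕ.* suc t          ≡⟨ solve 3 (λ a t b → a :* t :+ a :+ b :* (con 1 :+ t) := (a :+ b) :* (con 1 :+ t)) ≡.refl a t b ⟩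
          (a ℕ.+ b) ℕ.* suc t                    ∎
          where
          open ℕ.≤-Reasoning
          open +-*-Solver

        halve : ∀ t {a b v} → a ℕ.≤ b → v ≡ a ℕ.+ b → v ℕ.< 2 ℕ.^ suc t → a ℕ.< 2 ℕ.^ t
        halve t {a} {b} a≤b ≡.refl v< = ℕ.≰⇒> λ a≥ → ℕ.<⇒≱ v<
          (ℕ.+-mono-≤ a≥ (≡.subst (ℕ._≤ b) (≡.sym (ℕ.+-identityʳ (2 ℕ.^ t))) (ℕ.≤-trans a≥ a≤b)))

        module Cut (k : ℕ) (smaller : ∀ {m} → m ℕ.< k → Bounded m) (V : List (Fin n)) (E : List (Fin n × Fin n))
          (∣V∣≡k : length V ≡ k) (V-unique : Unique V) (E-unique : Unique E)
          (edges : ∀ {ij} → ij ∈ E → Edge ij × proj₁ ij ∈ V × proj₂ ij ∈ V)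
          (u v : Fin n) (u∈V : u ∈ V) (v∈V : v ∈ V) (d : ℕ) (ad : Admissible N B d) (dir : HasDirection d (u , v))
          (beyond? : ∀ x → Dec (Beyond u d x)) where

          V₁ V₀ : List (Fin n)
          V₁ = filter beyond? V
          V₀ = filter (¬? ∘ beyond?) V

          E₁ E₀₁ E₀₀ E₀ : List (Fin n × Fin n)
          E₁  = filter (beyond? ∘ proj₁) E
          E₀  = filter (¬? ∘ beyond? ∘ proj₁) E
          E₀₁ = filter (beyond? ∘ proj₂) E₀
          E₀₀ = filter (¬? ∘ beyond? ∘ proj₂) E₀

          ∣V∣ : length V ≡ length V₁ ℕ.+ length V₀
          ∣V∣ = length-filter-split beyond? V

          ∣E∣ : length E ≡ length E₁ ℕ.+ (length E₀₁ ℕ.+ length E₀₀)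
          ∣E∣ = ≡.trans (length-filter-split (beyond? ∘ proj₁) E)
                       (≡.cong (length E₁ ℕ.+_) (length-filter-split (beyond? ∘ proj₂) E₀))

          V₁>0 : 0 ℕ.< length V₁
          V₁>0 = ∈-length (∈-filter⁺ beyond? v∈V (beyond-edge ad dir))

          V₀>0 : 0 ℕ.< length V₀
          V₀>0 = ∈-length (∈-filter⁺ (¬? ∘ beyond?) u∈V (¬beyond-self u d))

          edges₁ : ∀ {ij} → ij ∈ E₁ → Edge ij × proj₁ ij ∈ V₁ × proj₂ ij ∈ V₁
          edges₁ ij∈ = let ij∈E , i∈ = ∈-filter⁻ (beyond? ∘ proj₁) ij∈
                           edge , i∈V , j∈V = edges ij∈E
                       in edge , ∈-filter⁺ beyond? i∈V i∈ , ∈-filter⁺ beyond? j∈V (beyond-forward u d edge i∈)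

          edges₀₀ : ∀ {ij} → ij ∈ E₀₀ → Edge ij × proj₁ ij ∈ V₀ × proj₂ ij ∈ V₀
          edges₀₀ ij∈ = let ij∈E₀ , j∉ = ∈-filter⁻ (¬? ∘ beyond? ∘ proj₂) {xs = E₀} ij∈
                            ij∈E , i∉ = ∈-filter⁻ (¬? ∘ beyond? ∘ proj₁) {xs = E} ij∈E₀
                            edge , i∈V , j∈V = edges ij∈E
                        in edge , ∈-filter⁺ (¬? ∘ beyond?) i∈V i∉ , ∈-filter⁺ (¬? ∘ beyond?) j∈V j∉

          edges₀₁ : ∀ {ij} → ij ∈ E₀₁ → HasDirection d ij × proj₁ ij ∈ V₀ × proj₂ ij ∈ V₁
          edges₀₁ ij∈ = let ij∈E₀ , j∈ = ∈-filter⁻ (beyond? ∘ proj₂) {xs = E₀} ij∈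
                            ij∈E , i∉ = ∈-filter⁻ (¬? ∘ beyond? ∘ proj₁) {xs = E} ij∈E₀
                            edge , i∈V , j∈V = edges ij∈E
                        in crossing-direction u d edge i∉ j∈ , ∈-filter⁺ (¬? ∘ beyond?) i∈V i∉ , ∈-filter⁺ beyond? j∈V j∈

          E₀-unique = Unique.filter⁺ (¬? ∘ beyond? ∘ proj₁) E-unique
          E₀₁-unique = Unique.filter⁺ (beyond? ∘ proj₂) E₀-unique

          -- All cut edges have direction d and the points are distinct, so a cut edge is determined
          -- by its tail, and likewise by its head.
          E₀₁≤V₀ : length E₀₁ ℕ.≤ length V₀
          E₀₁≤V₀ = length-≤ proj₁ E₀₁ V₀ E₀₁-unique (proj₁ ∘ proj₂ ∘ edges₀₁) same
            where
            same : ∀ {x y} → x ∈ E₀₁ → y ∈ E₀₁ → proj₁ x ≡ proj₁ y → x ≡ y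
            same {i , j} {.i , k} x∈ y∈ ≡.refl =
              ≡.cong (i ,_) (S-injective (trans (proj₁ (edges₀₁ x∈)) (sym (proj₁ (edges₀₁ y∈)))))

          E₀₁≤V₁ : length E₀₁ ℕ.≤ length V₁
          E₀₁≤V₁ = length-≤ proj₂ E₀₁ V₁ E₀₁-unique (proj₂ ∘ proj₂ ∘ edges₀₁) same
            where
            same : ∀ {x y} → x ∈ E₀₁ → y ∈ E₀₁ → proj₂ x ≡ proj₂ y → x ≡ y
            same {i , j} {k , .j} x∈ y∈ ≡.refl =
              ≡.cong (_, j) (S-injective (+-cancelʳ (ζ ^ d) (S i) (S k) (trans (sym (proj₁ (edges₀₁ x∈))) (proj₁ (edges₀₁ y∈)))))

          bound₁ : ∀ t → length V₁ ℕ.< 2 ℕ.^ suc t → length E₁ ℕ.≤ length V₁ ℕ.* t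
          bound₁ t = smaller (≡.subst (length V₁ ℕ.<_) ∣V∣≡k (≡.subst (length V₁ ℕ.<_) (≡.sym ∣V∣)
            (ℕ.m<m+n (length V₁) V₀>0))) t V₁ E₁ ≡.refl (Unique.filter⁺ beyond? V-unique)
            (Unique.filter⁺ (beyond? ∘ proj₁) E-unique) edges₁

          bound₀ : ∀ t → length V₀ ℕ.< 2 ℕ.^ suc t → length E₀₀ ℕ.≤ length V₀ ℕ.* t
          bound₀ t = smaller (≡.subst (length V₀ ℕ.<_) ∣V∣≡k (≡.subst (length V₀ ℕ.<_) (≡.sym ∣V∣)
            (ℕ.m<n+m (length V₀) V₁>0))) t V₀ E₀₀ ≡.refl (Unique.filter⁺ (¬? ∘ beyond?) V-unique)
            (Unique.filter⁺ (¬? ∘ beyond? ∘ proj₂) E₀-unique) edges₀₀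

          bound : ∀ t → length V ℕ.< 2 ℕ.^ suc t → length E ℕ.≤ length V ℕ.* t
          -- Both sides of the cut are nonempty, so `V` has at least two points.
          bound zero V<2 = contradiction (≡.subst (ℕ._< 2) ∣V∣ V<2) (ℕ.≤⇒≯ (ℕ.+-mono-≤ V₁>0 V₀>0))
          bound (suc t) V< with ℕ.≤-total (length V₁) (length V₀)
          ... | inj₁ V₁≤V₀ = ≡.subst (ℕ._≤ length V ℕ.* suc t) (≡.trans (ℕ.+-assoc (length E₁) _ _) (≡.sym ∣E∣))
            (arithmetic t V₁≤V₀ ∣V∣ E₀₁≤V₁ (bound₁ t (halve (suc t) V₁≤V₀ ∣V∣ V<))
              (bound₀ (suc t) (ℕ.≤-<-trans (≡.subst (length V₀ ℕ.≤_) (≡.sym ∣V∣) (ℕ.m≤n+m _ _)) V<)))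
          ... | inj₂ V₀≤V₁ = ≡.subst (ℕ._≤ length V ℕ.* suc t) (≡.trans reorder (≡.sym ∣E∣))
            (arithmetic t V₀≤V₁ ∣V∣′ E₀₁≤V₀ (bound₀ t (halve (suc t) V₀≤V₁ ∣V∣′ V<))
              (bound₁ (suc t) (ℕ.≤-<-trans (≡.subst (length V₁ ℕ.≤_) (≡.sym ∣V∣) (ℕ.m≤m+n _ _)) V<)))
            where
            ∣V∣′ = ≡.trans ∣V∣ (ℕ.+-comm (length V₁) (length V₀))
            reorder : length E₀₀ ℕ.+ length E₀₁ ℕ.+ length E₁ ≡ length E₁ ℕ.+ (length E₀₁ ℕ.+ length E₀₀)
            reorder = ≡.trans (ℕ.+-comm _ (length E₁)) (≡.cong (length E₁ ℕ.+_) (ℕ.+-comm (length E₀₀) (length E₀₁)))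

        -- The first edge supplies the point u and the direction d of the cut. The half space may be
        -- decided under a double negation because the conclusion compares natural numbers.
        bounded-step : ∀ k → (∀ {m} → m ℕ.< k → Bounded m) → Bounded k
        bounded-step k smaller t V []            _     _     _     _     _  = ℕ.z≤n
        bounded-step k smaller t V E@((u , v) ∷ _) ∣V∣≡k V-uniq E-uniq edges V< =
          let (d , ad , dir) , u∈V , v∈V = edges (here ≡.refl) in
          decidable-stable (length E ℕ.≤? length V ℕ.* t) λ ¬bound → ¬¬-decide-all (Beyond u d) λ beyond? →
            ¬bound (Cut.bound k smaller V E ∣V∣≡k V-uniq E-uniq edges u v u∈V v∈V d ad dir beyond? t V<)

      grid-edges : ∀ t E → n ℕ.< 2 ℕ.^ suc t → Unique E → (∀ {ij} → ij ∈ E → Edge ij) → length E ℕ.≤ n ℕ.* t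
      grid-edges t E n< E-unique edges = ≡.subst (λ k → length E ℕ.≤ k ℕ.* t) ∣allFin∣
        (<-rec Bounded bounded-step (length (allFin n)) t (allFin n) E ≡.refl (Unique.allFin⁺ n) E-unique
          (λ ij∈ → edges ij∈ , ∈-allFin _ , ∈-allFin _) (≡.subst (ℕ._< 2 ℕ.^ suc t) (≡.sym ∣allFin∣) n<))
        where
        ∣allFin∣ : length (allFin n) ≡ n
        ∣allFin∣ = length-tabulate id

    Labelled : Fin n × Fin n → Set
    Labelled ij = ∃[ e ] (e ℕ.< N × HasDirection e ij)

    labels : ∀ {xs} → All Labelled xs → List ℕ
    labels []              = []
    labels ((e , _) ∷ all) = e ∷ labels all

    length-labels : ∀ {xs} (all : All Labelled xs) → length (labels all) ≡ length xs
    length-labels []        = ≡.refl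
    length-labels (_ ∷ all) = ≡.cong suc (length-labels all)

    module _ (B : ℕ → Bool) (ind : Independent ζ N B) where

      selected : ∀ {xs} → Unique xs → (all : All Labelled xs) →
        ∃[ E ] (Unique E × (∀ {ij} → ij ∈ E → ij ∈ xs × Edge B ind ij) × # B (labels all) ≡ length E)
      selected []             []                      = [] , [] , (λ ()) , ≡.refl
      selected {ij ∷ xs} (x∉ ∷ uniq) ((e , e<N , dir) ∷ all) with selected uniq all | B e in Be
      ... | E , E-uniq , E-edges , eq | false = E , E-uniq , (λ h → let h₁ , h₂ = E-edges h in there h₁ , h₂) , eq
      ... | E , E-uniq , E-edges , eq | true  =
        ij ∷ E , All.tabulate (λ h → All.lookup x∉ (proj₁ (E-edges h))) ∷ E-uniq ,
        (λ { (here ≡.refl) → here ≡.refl , e , (e<N , Be) , dir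
           ; (there h)     → let h₁ , h₂ = E-edges h in there h₁ , h₂ }) , ≡.cong suc eq

    few-edges : .{{_ : NonZero N}} → Order ζ N → ∀ t → n ℕ.< 2 ℕ.^ suc t → ∀ xs → Unique xs → All Labelled xs →
                length xs ℕ.≤ 2 ℕ.* suc t ℕ.* (2 ℕ.* suc t) ℕ.* (n ℕ.* t)
    few-edges order t n< xs uniq all =
      -- The successor of `t + suc (t + 0)` is `2 * suc t` by computation, and the number of pairs
      -- is at most n² < 2^(2t+2).
      let B , ind , le = selection order (t ℕ.+ suc (t ℕ.+ 0)) (labels all)
                           (≡.subst (ℕ._< 2 ℕ.^ (2 ℕ.* suc t)) (≡.sym (length-labels all)) (ℕ.≤-<-trans (pairs≤n² xs uniq) n²<))
          E , E-uniq , E-edges , eq = selected B ind uniq all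
      in begin
        length xs                        ≡⟨ length-labels all ⟨
        length (labels all)              ≤⟨ le ⟩
        c ℕ.* # B (labels all)           ≡⟨ ≡.cong (c ℕ.*_) eq ⟩
        c ℕ.* length E                   ≤⟨ ℕ.*-monoʳ-≤ c (grid-edges B ind t E n< E-uniq (proj₂ ∘ E-edges)) ⟩
        c ℕ.* (n ℕ.* t)                  ∎
      where
      open ℕ.≤-Reasoning
      c = 2 ℕ.* suc t ℕ.* (2 ℕ.* suc t)
      n²< : n ℕ.* n ℕ.< 2 ℕ.^ (2 ℕ.* suc t)
      n²< = ≡.subst (n ℕ.* n ℕ.<_) (≡.trans (≡.sym (ℕ.^-distribˡ-+-* 2 (suc t) (suc t)))
        (≡.cong (λ k → 2 ℕ.^ (suc t ℕ.+ k)) (≡.sym (ℕ.+-identityʳ (suc t))))) (ℕ.*-mono-< n< n<)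

-- Proved for an abstract ring, where the ring solver does not unfold the definitions of ℝ.
module RingIdentities (R : CommutativeRing 0ℓ 0ℓ) where
  open CommutativeRing R
  open IntegerMultiples.Solver R

  neg-neg : ∀ x → - (- x) ≈ x
  neg-neg = solve 1 (λ x → :- (:- x) := x) refl

  -0≈0 : - 0# ≈ 0#
  -0≈0 = solve 0 (:- con (+ 0) := con (+ 0)) refl

  -x*y : ∀ x y → (- x) * y ≈ - (x * y)
  -x*y = solve 2 (λ x y → (:- x) :* y := :- (x :* y)) refl

  x*-y : ∀ x y → x * (- y) ≈ (- x) * y
  x*-y = solve 2 (λ x y → x :* (:- y) := (:- x) :* y) refl

  re-assoc : ∀ a b c d e f → (a * c - b * d) * e - (a * d + b * c) * f ≈ a * (c * e - d * f) - b * (c * f + d * e)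
  re-assoc = solve 6 (λ a b c d e f → (a :* c :- b :* d) :* e :- (a :* d :+ b :* c) :* f := a :* (c :* e :- d :* f) :- b :* (c :* f :+ d :* e)) refl

  im-assoc : ∀ a b c d e f → (a * c - b * d) * f + (a * d + b * c) * e ≈ a * (c * f + d * e) + b * (c * e - d * f)
  im-assoc = solve 6 (λ a b c d e f → (a :* c :- b :* d) :* f :+ (a :* d :+ b :* c) :* e := a :* (c :* f :+ d :* e) :+ b :* (c :* e :- d :* f)) refl

  re-comm : ∀ a b c d → a * c - b * d ≈ c * a - d * b
  re-comm = solve 4 (λ a b c d → a :* c :- b :* d := c :* a :- d :* b) refl

  im-comm : ∀ a b c d → a * d + b * c ≈ c * b + d * a
  im-comm = solve 4 (λ a b c d → a :* d :+ b :* c := c :* b :+ d :* a) refl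

  re-identity : ∀ a b → 1# * a - 0# * b ≈ a
  re-identity a b = trans (+-cong (*-identityˡ a) (-‿cong (zeroˡ b))) (solve 1 (λ a → a :- con (+ 0) := a) refl a)

  im-identity : ∀ a b → 1# * b + 0# * a ≈ b
  im-identity a b = trans (+-cong (*-identityˡ b) (zeroˡ a)) (+-identityʳ b)

  re-distrib : ∀ a b c d e f → a * (c + e) - b * (d + f) ≈ (a * c - b * d) + (a * e - b * f)
  re-distrib = solve 6 (λ a b c d e f → a :* (c :+ e) :- b :* (d :+ f) := (a :* c :- b :* d) :+ (a :* e :- b :* f)) refl

  im-distrib : ∀ a b c d e f → a * (d + f) + b * (c + e) ≈ (a * d + b * c) + (a * f + b * e)
  im-distrib = solve 6 (λ a b c d e f → a :* (d :+ f) :+ b :* (c :+ e) := (a :* d :+ b :* c) :+ (a :* f :+ b :* e)) refl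

  divide-re : ∀ a b c d → (a * a + b * b) * c ≈ a * (a * c - b * d) + b * (a * d + b * c)
  divide-re = solve 4 (λ a b c d → (a :* a :+ b :* b) :* c := a :* (a :* c :- b :* d) :+ b :* (a :* d :+ b :* c)) refl

  divide-im : ∀ a b c d → (a * a + b * b) * d ≈ (- b) * (a * c - b * d) + a * (a * d + b * c)
  divide-im = solve 4 (λ a b c d → (a :* a :+ b :* b) :* d := (:- b) :* (a :* c :- b :* d) :+ a :* (a :* d :+ b :* c)) refl

  re-real : ∀ a b → a * b - 0# * 0# ≈ a * b
  re-real = solve 2 (λ a b → a :* b :- con (+ 0) :* con (+ 0) := a :* b) refl

  im-real : ∀ a b → a * 0# + 0# * b ≈ 0#
  im-real = solve 2 (λ a b → a :* con (+ 0) :+ con (+ 0) :* b := con (+ 0)) refl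

  re-conj : ∀ a b c d → a * c - b * d ≈ a * c - (- b) * (- d)
  re-conj = solve 4 (λ a b c d → a :* c :- b :* d := a :* c :- (:- b) :* (:- d)) refl

  im-conj : ∀ a b c d → - (a * d + b * c) ≈ a * (- d) + (- b) * c
  im-conj = solve 4 (λ a b c d → :- (a :* d :+ b :* c) := a :* (:- d) :+ (:- b) :* c) refl

  neg-+ : ∀ a b → - (a + b) ≈ - a + - b
  neg-+ = solve 2 (λ a b → :- (a :+ b) := :- a :+ :- b) refl

  norm²-conj : ∀ a b → a * a + b * b ≈ a * a - b * (- b)
  norm²-conj = solve 2 (λ a b → a :* a :+ b :* b := a :* a :- b :* (:- b)) refl

  re-scale : ∀ a b → a * 0# - 0# * b ≈ 0#
  re-scale = solve 2 (λ a b → a :* con (+ 0) :- con (+ 0) :* b := con (+ 0)) refl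

  im-scale : ∀ a b c → a * (b * c) + 0# * 0# ≈ b * (a * c)
  im-scale = solve 3 (λ a b c → a :* (b :* c) :+ con (+ 0) :* con (+ 0) := b :* (a :* c)) refl

  re-square : ∀ a → (- a) * (- a) - 0# * 0# ≈ a * a
  re-square = solve 1 (λ a → (:- a) :* (:- a) :- con (+ 0) :* con (+ 0) := a :* a) refl

  im-square : ∀ a → a * 0# + 0# * a ≈ 0#
  im-square = solve 1 (λ a → a :* con (+ 0) :+ con (+ 0) :* a := con (+ 0)) refl

  re-rotate : ∀ a b → 0# * a - b * 0# ≈ 0#
  re-rotate = solve 2 (λ a b → con (+ 0) :* a :- b :* con (+ 0) := con (+ 0)) refl

  im-rotate : ∀ a b → 0# * 0# + b * a ≈ b * a
  im-rotate = solve 2 (λ a b → con (+ 0) :* con (+ 0) :+ b :* a := b :* a) refl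

  add-back : ∀ a b → a ≈ (a - b) + b
  add-back = solve 2 (λ a b → a := (a :- b) :+ b) refl

  difference-of-squares : ∀ a b → (a + b) * (a - b) ≈ a * a - b * b
  difference-of-squares = solve 2 (λ a b → (a :+ b) :* (a :- b) := a :* a :- b :* b) refl

  norm²-scale : ∀ r a b → (r * a - 0# * b) * (r * a - 0# * b) + (r * b + 0# * a) * (r * b + 0# * a) ≈ (r * r) * (a * a + b * b)
  norm²-scale = solve 3 (λ r a b → (r :* a :- con (+ 0) :* b) :* (r :* a :- con (+ 0) :* b) :+ (r :* b :+ con (+ 0) :* a) :* (r :* b :+ con (+ 0) :* a)
    := (r :* r) :* (a :* a :+ b :* b)) refl

  norm²-swap : ∀ a b c d → (a - b) * (a - b) + (c - d) * (c - d) ≈ (b - a) * (b - a) + (d - c) * (d - c)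
  norm²-swap = solve 4 (λ a b c d → (a :- b) :* (a :- b) :+ (c :- d) :* (c :- d) := (b :- a) :* (b :- a) :+ (d :- c) :* (d :- c)) refl

  product-difference : ∀ a b c d → b * (d - c) + (b - a) * c ≈ b * d - a * c
  product-difference = solve 4 (λ a b c d → b :* (d :- c) :+ (b :- a) :* c := b :* d :- a :* c) refl

  factor-difference : ∀ a b c → a * (b - c) ≈ a * b - a * c
  factor-difference = solve 3 (λ a b c → a :* (b :- c) := a :* b :- a :* c) refl

  subtract-one : ∀ a b → a ≈ (b + a) - b
  subtract-one = solve 2 (λ a b → a := (b :+ a) :- b) refl

-- Products of exponential series

module Series (R : CommutativeRing 0ℓ 0ℓ) where

  open CommutativeRing R hiding (zero)
  open PowerSums R
  open Solver
  open import Relation.Binary.Reasoning.Setoid setoid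

  psum : (ℕ → Carrier) → ℕ → Carrier
  psum f zero    = 0#
  psum f (suc K) = psum f K + f K

  psum-cong : ∀ {f g} → (∀ k → f k ≈ g k) → ∀ K → psum f K ≈ psum g K
  psum-cong h zero    = refl
  psum-cong h (suc K) = +-cong (psum-cong h K) (h K)

  psum-head : ∀ f K → psum f (suc K) ≈ f 0 + psum (f ∘ suc) K
  psum-head f zero    = +-comm 0# (f 0)
  psum-head f (suc K) = trans (+-congʳ (psum-head f K)) (+-assoc _ _ _)

  psum-append : ∀ f K a → psum f (K ℕ.+ a) ≈ psum f K + psum (f ∘ (K ℕ.+_)) a
  psum-append f K zero    = trans (reflexive (≡.cong (psum f) (ℕ.+-identityʳ K))) (sym (+-identityʳ _))
  psum-append f K (suc a) = begin
    psum f (K ℕ.+ suc a)                                     ≡⟨ ≡.cong (psum f) (ℕ.+-suc K a) ⟩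
    psum f (K ℕ.+ a) + f (K ℕ.+ a)                           ≈⟨ +-congʳ (psum-append f K a) ⟩
    psum f K + psum (f ∘ (K ℕ.+_)) a + f (K ℕ.+ a)           ≈⟨ +-assoc _ _ _ ⟩
    psum f K + psum (f ∘ (K ℕ.+_)) (suc a)                   ∎

  conv : (f g : ℕ → Carrier) → ℕ → Carrier
  conv f g zero    = f 0 * g 0
  conv f g (suc m) = f 0 * g (suc m) + conv (f ∘ suc) g m

  conv-cong : ∀ {f f′ g g′} → (∀ k → f k ≈ f′ k) → (∀ k → g k ≈ g′ k) → ∀ m → conv f g m ≈ conv f′ g′ m
  conv-cong hf hg zero    = *-cong (hf 0) (hg 0)
  conv-cong hf hg (suc m) = +-cong (*-cong (hf 0) (hg (suc m))) (conv-cong (hf ∘ suc) hg m)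

  conv-+ˡ : ∀ f f′ g m → conv (λ k → f k + f′ k) g m ≈ conv f g m + conv f′ g m
  conv-+ˡ f f′ g zero    = distribʳ _ _ _
  conv-+ˡ f f′ g (suc m) = trans (+-congˡ (conv-+ˡ (f ∘ suc) (f′ ∘ suc) g m))
    (solve 5 (λ a b c d e → (a :+ b) :* c :+ (d :+ e) := (a :* c :+ d) :+ (b :* c :+ e)) refl
      (f 0) (f′ 0) (g (suc m)) (conv (f ∘ suc) g m) (conv (f′ ∘ suc) g m))

  conv-*ˡ : ∀ c f g m → conv (λ k → c * f k) g m ≈ c * conv f g m
  conv-*ˡ c f g zero    = *-assoc _ _ _
  conv-*ˡ c f g (suc m) = trans (+-congˡ (conv-*ˡ c (f ∘ suc) g m))
    (solve 4 (λ c a b d → c :* a :* b :+ c :* d := c :* (a :* b :+ d)) refl c (f 0) (g (suc m)) (conv (f ∘ suc) g m))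

  conv-*ʳ : ∀ c f g m → conv f (λ k → c * g k) m ≈ c * conv f g m
  conv-*ʳ c f g zero    = solve 3 (λ c a b → a :* (c :* b) := c :* (a :* b)) refl c (f 0) (g 0)
  conv-*ʳ c f g (suc m) = trans (+-congˡ (conv-*ʳ c (f ∘ suc) g m))
    (solve 4 (λ c a b d → a :* (c :* b) :+ c :* d := c :* (a :* b :+ d)) refl c (f 0) (g (suc m)) (conv (f ∘ suc) g m))

  -- Formal differentiation of the power series with coefficients f.
  ∂ : (ℕ → Carrier) → ℕ → Carrier
  ∂ f k = ι (+ suc k) * f (suc k)

  leibniz : ∀ f g m → ι (+ suc m) * conv f g (suc m) ≈ conv (∂ f) g m + conv f (∂ g) m
  leibniz f g zero = solve 5 (λ i a b c d → i :* (a :* b :+ c :* d) := i :* c :* d :+ a :* (i :* b)) refl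
    (ι (+ 1)) (f 0) (g 1) (f 1) (g 0)
  leibniz f g (suc m) = begin
    (1# + i) * (f 0 * g₂ + C)
      ≈⟨ trans (distribʳ _ _ _) (+-congʳ (*-identityˡ _)) ⟩
    (f 0 * g₂ + C) + i * (f 0 * g₂ + C)
      ≈⟨ solve 4 (λ i a b c → (a :* b :+ c) :+ i :* (a :* b :+ c) := (a :* b :+ i :* (a :* b)) :+ (c :+ i :* c)) refl i (f 0) g₂ C ⟩
    (f 0 * g₂ + i * (f 0 * g₂)) + (C + i * C)
      ≈⟨ +-congˡ (+-congˡ (leibniz (f ∘ suc) g m)) ⟩
    (f 0 * g₂ + i * (f 0 * g₂)) + ((f 1 * g (suc m) + X) + (Y + Z))
      ≈⟨ +-congʳ (+-congʳ (sym (*-identityˡ _))) ⟩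
    (1# * (f 0 * g₂) + i * (f 0 * g₂)) + ((f 1 * g (suc m) + X) + (Y + Z))
      ≈⟨ solve 9 (λ u i a b c d x y z → (u :* (a :* b) :+ i :* (a :* b)) :+ ((c :* d :+ x) :+ (y :+ z))
            := (c :* d :+ (x :+ y)) :+ (a :* ((u :+ i) :* b) :+ z)) refl 1# i (f 0) g₂ (f 1) (g (suc m)) X Y Z ⟩
    (f 1 * g (suc m) + (X + Y)) + (f 0 * ((1# + i) * g₂) + Z)
      ≈⟨ +-congʳ (+-cong (*-congʳ one*) (sym shift)) ⟩
    conv (∂ f) g (suc m) + conv f (∂ g) (suc m) ∎
    where
    i = ι (+ suc m)
    g₂ = g (suc (suc m))
    C = conv (f ∘ suc) g (suc m)
    X = conv (f ∘ suc ∘ suc) g m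
    Y = conv (∂ (f ∘ suc)) g m
    Z = conv (f ∘ suc) (∂ g) m
    one* : f 1 ≈ ι (+ 1) * f 1
    one* = solve 1 (λ x → x := con (+ 1) :* x) refl (f 1)
    shift : conv (∂ f ∘ suc) g m ≈ X + Y
    shift = trans (conv-cong (λ k → trans (distribʳ _ _ _) (+-congʳ (*-identityˡ _))) (λ _ → refl) m)
      (conv-+ˡ (f ∘ suc ∘ suc) (∂ (f ∘ suc)) g m)

  -- The sum of f i · g j over the triangle i + j < K, row by row.
  tri : (f g : ℕ → Carrier) → ℕ → Carrier
  tri f g zero    = 0#
  tri f g (suc K) = f 0 * psum g (suc K) + tri (f ∘ suc) g K

  tri-suc : ∀ f g K → tri f g (suc K) ≈ tri f g K + conv f g K
  tri-suc f g zero    = solve 2 (λ a b → a :* (con (+ 0) :+ b) :+ con (+ 0) := con (+ 0) :+ a :* b) refl (f 0) (g 0)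
  tri-suc f g (suc K) = trans (+-congˡ (tri-suc (f ∘ suc) g K))
    (solve 5 (λ a b c d e → a :* (b :+ c) :+ (d :+ e) := (a :* b :+ d) :+ (a :* c :+ e)) refl
      (f 0) (psum g (suc K)) (g (suc K)) (tri (f ∘ suc) g K) (conv (f ∘ suc) g K))

  tri≈psum-conv : ∀ f g K → tri f g K ≈ psum (conv f g) K
  tri≈psum-conv f g zero    = refl
  tri≈psum-conv f g (suc K) = trans (tri-suc f g K) (+-congʳ (tri≈psum-conv f g K))

  -- The part i + j ≥ K of the rectangle i < K, j < K + a. The surplus `a` is there for the
  -- recursion: without its first row a square is no longer square.
  rest : (f g : ℕ → Carrier) → ℕ → ℕ → Carrier
  rest f g a zero    = 0#
  rest f g a (suc K) = f 0 * psum (g ∘ (suc K ℕ.+_)) a + rest (f ∘ suc) g (suc a) K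

  product-split : ∀ f g a K → psum f K * psum g (K ℕ.+ a) ≈ tri f g K + rest f g a K
  product-split f g a zero    = trans (zeroˡ _) (sym (+-identityˡ 0#))
  product-split f g a (suc K) = begin
    psum f (suc K) * psum g (suc K ℕ.+ a)
      ≈⟨ *-congʳ (psum-head f K) ⟩
    (f 0 + psum (f ∘ suc) K) * psum g (suc K ℕ.+ a)
      ≈⟨ distribʳ _ _ _ ⟩
    f 0 * psum g (suc K ℕ.+ a) + psum (f ∘ suc) K * psum g (suc K ℕ.+ a)
      ≈⟨ +-cong (*-congˡ (psum-append g (suc K) a)) (*-congˡ (reflexive (≡.cong (psum g) (≡.sym (ℕ.+-suc K a))))) ⟩
    f 0 * (psum g (suc K) + psum (g ∘ (suc K ℕ.+_)) a) + psum (f ∘ suc) K * psum g (K ℕ.+ suc a)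
      ≈⟨ +-congˡ (product-split (f ∘ suc) g (suc a) K) ⟩
    f 0 * (psum g (suc K) + psum (g ∘ (suc K ℕ.+_)) a) + (tri (f ∘ suc) g K + rest (f ∘ suc) g (suc a) K)
      ≈⟨ solve 5 (λ a b c d e → a :* (b :+ c) :+ (d :+ e) := (a :* b :+ d) :+ (a :* c :+ e)) refl
           (f 0) (psum g (suc K)) (psum (g ∘ (suc K ℕ.+_)) a) (tri (f ∘ suc) g K) (rest (f ∘ suc) g (suc a) K) ⟩
    tri f g (suc K) + rest f g a (suc K) ∎

  -- The coefficients are given by the recursion of 1/k! only, so that one development serves both
  -- the rational majorants and the complex series.
  module Exponential (c : ℕ → Carrier) (c0≈1 : c 0 ≈ 1#) (c-suc : ∀ k → ι (+ suc k) * c (suc k) ≈ c k)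
                     (cancel : ∀ n {x y} → ι (+ suc n) * x ≈ ι (+ suc n) * y → x ≈ y) where

    term : Carrier → ℕ → Carrier
    term z k = c k * z ^ k

    term-cong : ∀ {z w} k → z ≈ w → term z k ≈ term w k
    term-cong k z≈w = *-congˡ (^-congˡ k z≈w)

    term-suc : ∀ z k → ι (+ suc k) * term z (suc k) ≈ z * term z k
    term-suc z k = trans (solve 4 (λ i c z w → i :* (c :* (z :* w)) := z :* ((i :* c) :* w)) refl (ι (+ suc k)) (c (suc k)) z (z ^ k))
      (*-congˡ (*-congʳ (c-suc k)))

    -- Both sides obey the recursion of `term-suc` for z + w, the coefficient form of y′ = (z + w)
    -- y; for the convolution this is the product rule `leibniz`. No binomial expansion is involved.
    conv-term : ∀ z w m → conv (term z) (term w) m ≈ term (z + w) m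
    conv-term z w zero    = trans (*-congʳ (trans (*-identityʳ _) c0≈1)) (*-identityˡ _)
    conv-term z w (suc m) = cancel m (begin
      ι (+ suc m) * conv (term z) (term w) (suc m)
        ≈⟨ leibniz (term z) (term w) m ⟩
      conv (∂ (term z)) (term w) m + conv (term z) (∂ (term w)) m
        ≈⟨ +-cong (conv-cong (term-suc z) (λ _ → refl) m) (conv-cong (λ _ → refl) (term-suc w) m) ⟩
      conv (λ k → z * term z k) (term w) m + conv (term z) (λ k → w * term w k) m
        ≈⟨ +-cong (conv-*ˡ z (term z) (term w) m) (conv-*ʳ w (term z) (term w) m) ⟩
      z * conv (term z) (term w) m + w * conv (term z) (term w) m
        ≈⟨ distribʳ _ _ _ ⟨
      (z + w) * conv (term z) (term w) m
        ≈⟨ *-congˡ (conv-term z w m) ⟩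
      (z + w) * term (z + w) m
        ≈⟨ term-suc (z + w) m ⟨
      ι (+ suc m) * term (z + w) (suc m) ∎)

    product-of-sums : ∀ z w K → psum (term z) K * psum (term w) K ≈ psum (term (z + w)) K + rest (term z) (term w) 0 K
    product-of-sums z w K = begin
      psum (term z) K * psum (term w) K
        ≡⟨ ≡.cong (λ k → psum (term z) K * psum (term w) k) (ℕ.+-identityʳ K) ⟨
      psum (term z) K * psum (term w) (K ℕ.+ 0)
        ≈⟨ product-split (term z) (term w) 0 K ⟩
      tri (term z) (term w) K + rest (term z) (term w) 0 K
        ≈⟨ +-congʳ (trans (tri≈psum-conv (term z) (term w) K) (psum-cong (conv-term z w) K)) ⟩
      psum (term (z + w)) K + rest (term z) (term w) 0 K ∎

open import Defs

-- Order and limits of real numbers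

Eventually : (ℕ → Set) → Set
Eventually P = ∃[ N ] (∀ n → N ℕ.≤ n → P n)

module _ {P Q : ℕ → Set} where

  ev-map : (∀ n → P n → Q n) → Eventually P → Eventually Q
  ev-map f (N , h) = N , λ n N≤n → f n (h n N≤n)

  ev-zip : ∀ {R : ℕ → Set} → (∀ n → P n → Q n → R n) → Eventually P → Eventually Q → Eventually R
  ev-zip f (M , h) (N , k) = M ℕ.⊔ N , λ n le → f n (h n (ℕ.m⊔n≤o⇒m≤o M N le)) (k n (ℕ.m⊔n≤o⇒n≤o M N le))

ev-always : ∀ {P : ℕ → Set} → (∀ n → P n) → Eventually P
ev-always h = 0 , λ n _ → h n

ev-witness : ∀ {P : ℕ → Set} {A : Set} → Eventually P → (∀ n → P n → A) → A
ev-witness (N , h) f = f N (h N ℕ.≤-refl)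

module ℚ-Solver = IntegerMultiples.Solver ℚ.+-*-commutativeRing

q≤∣q∣ : ∀ q → q ℚ.≤ ∣ q ∣
q≤∣q∣ q with ℚ.≤-total 0ℚ q
... | inj₁ 0≤q = ℚ.≤-reflexive (≡.sym (ℚ.0≤p⇒∣p∣≡p 0≤q))
... | inj₂ q≤0 = ℚ.≤-trans q≤0 (ℚ.0≤∣p∣ q)

-q≤∣q∣ : ∀ q → ℚ.- q ℚ.≤ ∣ q ∣
-q≤∣q∣ q = ≡.subst (ℚ.- q ℚ.≤_) (ℚ.∣-p∣≡∣p∣ q) (q≤∣q∣ (ℚ.- q))

∣-∣-≤ : ∀ {q ε} → q ℚ.≤ ε → ℚ.- q ℚ.≤ ε → ∣ q ∣ ℚ.≤ ε
∣-∣-≤ {q} {ε} q≤ -q≤ with ℚ.∣p∣≡p∨∣p∣≡-p q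
... | inj₁ eq = ≡.subst (ℚ._≤ ε) (≡.sym eq) q≤
... | inj₂ eq = ≡.subst (ℚ._≤ ε) (≡.sym eq) -q≤

∣-∣-comm : ∀ p q → ∣ p ℚ.- q ∣ ≡ ∣ q ℚ.- p ∣
∣-∣-comm p q = ≡.trans (≡.sym (ℚ.∣-p∣≡∣p∣ (p ℚ.- q))) (≡.cong ∣_∣ (solve 2 (λ p q → :- (p :- q) := q :- p) ≡.refl p q))
  where open ℚ-Solver

∣-∣-triangle : ∀ p q r {δ ε} → ∣ p ℚ.- q ∣ ℚ.< δ → ∣ q ℚ.- r ∣ ℚ.< ε → ∣ p ℚ.- r ∣ ℚ.< δ ℚ.+ ε
∣-∣-triangle p q r {δ} {ε} h k = begin-strict
  ∣ p ℚ.- r ∣                        ≡⟨ ≡.cong ∣_∣ (solve 3 (λ p q r → p :- r := (p :- q) :+ (q :- r)) ≡.refl p q r) ⟩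
  ∣ (p ℚ.- q) ℚ.+ (q ℚ.- r) ∣        ≤⟨ ℚ.∣p+q∣≤∣p∣+∣q∣ (p ℚ.- q) (q ℚ.- r) ⟩
  ∣ p ℚ.- q ∣ ℚ.+ ∣ q ℚ.- r ∣        <⟨ ℚ.+-mono-< h k ⟩
  δ ℚ.+ ε                            ∎
  where
  open ℚ.≤-Reasoning
  open ℚ-Solver

∣p-q∣≤ε⇒p≤q+ε : ∀ p q {ε} → ∣ p ℚ.- q ∣ ℚ.≤ ε → p ℚ.≤ q ℚ.+ ε
∣p-q∣≤ε⇒p≤q+ε p q {ε} h = begin
  p                  ≡⟨ solve 2 (λ p q → p := q :+ (p :- q)) ≡.refl p q ⟩
  q ℚ.+ (p ℚ.- q)    ≤⟨ ℚ.+-monoʳ-≤ q (ℚ.≤-trans (q≤∣q∣ (p ℚ.- q)) h) ⟩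
  q ℚ.+ ε            ∎
  where
  open ℚ.≤-Reasoning
  open ℚ-Solver

∣p-q∣≤ε⇐ : ∀ p q {ε} → p ℚ.≤ q ℚ.+ ε → q ℚ.≤ p ℚ.+ ε → ∣ p ℚ.- q ∣ ℚ.≤ ε
∣p-q∣≤ε⇐ p q {ε} h k = ∣-∣-≤
  (≡.subst (p ℚ.- q ℚ.≤_) (solve 2 (λ q e → q :+ e :- q := e) ≡.refl q ε) (ℚ.+-monoˡ-≤ (ℚ.- q) h))
  (≡.subst₂ ℚ._≤_ (solve 2 (λ p q → q :- p := :- (p :- q)) ≡.refl p q) (solve 2 (λ p e → p :+ e :- p := e) ≡.refl p ε)
    (ℚ.+-monoˡ-≤ (ℚ.- p) k))
  where open ℚ-Solver

½ε<ε : ∀ {ε} → 0ℚ ℚ.< ε → ½ ℚ.* ε ℚ.< ε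
½ε<ε {ε} 0<ε = ≡.subst₂ ℚ._<_ (ℚ.+-identityˡ _) (½+½ ε) (ℚ.+-monoˡ-< (½ ℚ.* ε) (0<½* 0<ε))

Near : ℝ → ℝ → ℚ → Set
Near x y ε = Eventually λ n → ∣ seq x n ℚ.- seq y n ∣ ℚ.< ε

near-sym : ∀ x y {ε} → Near x y ε → Near y x ε
near-sym x y = ev-map λ n → ≡.subst (ℚ._< _) (∣-∣-comm (seq x n) (seq y n))

near-trans : ∀ x y z {δ ε} → Near x y δ → Near y z ε → Near x z (δ ℚ.+ ε)
near-trans x y z = ev-zip λ n → ∣-∣-triangle (seq x n) (seq y n) (seq z n)

near-½ : ∀ x y z {ε} → Near x y (½ ℚ.* ε) → Near y z (½ ℚ.* ε) → Near x z ε
near-½ x y z {ε} h k = ≡.subst (Near x z) (½+½ ε) (near-trans x y z h k)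

≗⇒≈ : ∀ {x y} → (∀ n → seq x n ≡ seq y n) → x ≈ y
≗⇒≈ {x} {y} h ε 0<ε = ev-always λ n →
  ≡.subst (ℚ._< ε) (≡.sym (≡.trans (≡.cong (λ q → ∣ q ℚ.- seq y n ∣) (h n)) (≡.cong ∣_∣ (ℚ.+-inverseʳ (seq y n))))) 0<ε

≈-refl : ∀ {x} → x ≈ x
≈-refl {x} = ≗⇒≈ {x} {x} λ _ → ≡.refl

≈-sym : ∀ {x y} → x ≈ y → y ≈ x
≈-sym {x} {y} h ε 0<ε = near-sym x y (h ε 0<ε)

≈-trans : ∀ {x y z} → x ≈ y → y ≈ z → x ≈ z
≈-trans {x} {y} {z} h k ε 0<ε = near-½ x y z (h _ (0<½* 0<ε)) (k _ (0<½* 0<ε))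

near-+ : ∀ x y x′ y′ {δ ε} → Near x x′ δ → Near y y′ ε → Near (x + y) (x′ + y′) (δ ℚ.+ ε)
near-+ x y x′ y′ {δ} {ε} = ev-zip λ n → close (seq x n) (seq y n) (seq x′ n) (seq y′ n)
  where
  open ℚ.≤-Reasoning
  open ℚ-Solver
  close : ∀ a b c d → ∣ a ℚ.- c ∣ ℚ.< δ → ∣ b ℚ.- d ∣ ℚ.< ε → ∣ (a ℚ.+ b) ℚ.- (c ℚ.+ d) ∣ ℚ.< δ ℚ.+ ε
  close a b c d h k = begin-strict
    ∣ (a ℚ.+ b) ℚ.- (c ℚ.+ d) ∣     ≡⟨ ≡.cong ∣_∣ (solve 4 (λ a b c d → (a :+ b) :- (c :+ d) := (a :- c) :+ (b :- d)) ≡.refl a b c d) ⟩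
    ∣ (a ℚ.- c) ℚ.+ (b ℚ.- d) ∣     ≤⟨ ℚ.∣p+q∣≤∣p∣+∣q∣ (a ℚ.- c) (b ℚ.- d) ⟩
    ∣ a ℚ.- c ∣ ℚ.+ ∣ b ℚ.- d ∣     <⟨ ℚ.+-mono-< h k ⟩
    δ ℚ.+ ε                         ∎

near-neg : ∀ x x′ {ε} → Near x x′ ε → Near (- x) (- x′) ε
near-neg x x′ = ev-map λ n h → ≡.subst (ℚ._< _) (≡.trans (≡.sym (ℚ.∣-p∣≡∣p∣ _))
  (≡.cong ∣_∣ (solve 2 (λ a b → :- (a :- b) := (:- a) :- (:- b)) ≡.refl (seq x n) (seq x′ n)))) h
  where open ℚ-Solver

<⊓ : ∀ {p q r} → p ℚ.< q → p ℚ.< r → p ℚ.< q ℚ.⊓ r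
<⊓ {p} {q} {r} p<q p<r with ℚ.⊓-sel q r
... | inj₁ eq = ≡.subst (p ℚ.<_) (≡.sym eq) p<q
... | inj₂ eq = ≡.subst (p ℚ.<_) (≡.sym eq) p<r

near-* : ∀ L M ε → 0ℚ ℚ.< ε → ∃[ δ ] (0ℚ ℚ.< δ × (∀ x y → Near x L δ → Near y M δ → Near (x * y) (L * M) ε))
near-* L M ε 0<ε =
  let A , A>0 , ∣L∣≤A = bounded (cauchy L)
      B , B>0 , ∣M∣≤B = bounded (cauchy M)
      δ₁ , 0<δ₁ , f = scaled (B ℚ.+ 1ℚ) (½ ℚ.* ε) (ℚ.pos+nonNeg⇒pos B {{B>0}} 1ℚ) (0<½* 0<ε)
      δ₂ , 0<δ₂ , g = scaled A (½ ℚ.* ε) A>0 (0<½* 0<ε)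
      -- The cap at 1 bounds the varying factor y by B + 1.
      δ = (δ₁ ℚ.⊓ δ₂) ℚ.⊓ 1ℚ
      δ≤δ₁ = ℚ.≤-trans (ℚ.p⊓q≤p (δ₁ ℚ.⊓ δ₂) 1ℚ) (ℚ.p⊓q≤p δ₁ δ₂)
      δ≤δ₂ = ℚ.≤-trans (ℚ.p⊓q≤p (δ₁ ℚ.⊓ δ₂) 1ℚ) (ℚ.p⊓q≤q δ₁ δ₂)
      δ≤1  = ℚ.p⊓q≤q (δ₁ ℚ.⊓ δ₂) 1ℚ
  in δ , <⊓ (<⊓ 0<δ₁ 0<δ₂) (ℚ.positive⁻¹ 1ℚ) , λ x y hx hy →
     ev-zip (λ n (hL , hM) (hx , hy) → close (seq x n) (seq y n) (seq L n) (seq M n)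
              (f _ _ (ℚ.<-≤-trans hx δ≤δ₁) (near-bound (seq y n) (seq M n) hM (ℚ.<-≤-trans hy δ≤1)))
              (g _ _ (ℚ.<-≤-trans hy δ≤δ₂) hL))
       (ev-zip (λ _ → _,_) ∣L∣≤A ∣M∣≤B) (ev-zip (λ _ → _,_) hx hy)
  where
  open ℚ.≤-Reasoning
  open ℚ-Solver
  near-bound : ∀ y m {B} → ∣ m ∣ ℚ.≤ B → ∣ y ℚ.- m ∣ ℚ.< 1ℚ → ∣ y ∣ ℚ.≤ B ℚ.+ 1ℚ
  near-bound y m {B} hm h = begin
    ∣ y ∣                       ≡⟨ ≡.cong ∣_∣ (solve 2 (λ y m → y := m :+ (y :- m)) ≡.refl y m) ⟩
    ∣ m ℚ.+ (y ℚ.- m) ∣         ≤⟨ ℚ.∣p+q∣≤∣p∣+∣q∣ m (y ℚ.- m) ⟩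
    ∣ m ∣ ℚ.+ ∣ y ℚ.- m ∣       ≤⟨ ℚ.+-mono-≤ hm (ℚ.<⇒≤ h) ⟩
    B ℚ.+ 1ℚ                    ∎
  close : ∀ x y l m → ∣ (x ℚ.- l) ℚ.* y ∣ ℚ.< ½ ℚ.* ε → ∣ (y ℚ.- m) ℚ.* l ∣ ℚ.< ½ ℚ.* ε →
          ∣ x ℚ.* y ℚ.- l ℚ.* m ∣ ℚ.< ε
  close x y l m h k = begin-strict
    ∣ x ℚ.* y ℚ.- l ℚ.* m ∣                              ≡⟨ ≡.cong ∣_∣ (solve 4 (λ x y l m → x :* y :- l :* m := (x :- l) :* y :+ (y :- m) :* l) ≡.refl x y l m) ⟩
    ∣ (x ℚ.- l) ℚ.* y ℚ.+ (y ℚ.- m) ℚ.* l ∣              ≤⟨ ℚ.∣p+q∣≤∣p∣+∣q∣ ((x ℚ.- l) ℚ.* y) ((y ℚ.- m) ℚ.* l) ⟩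
    ∣ (x ℚ.- l) ℚ.* y ∣ ℚ.+ ∣ (y ℚ.- m) ℚ.* l ∣          <⟨ ℚ.+-mono-< h k ⟩
    ½ ℚ.* ε ℚ.+ ½ ℚ.* ε                                  ≡⟨ ½+½ ε ⟩
    ε                                                    ∎

≈-+ : ∀ {x x′ y y′} → x ≈ x′ → y ≈ y′ → x + y ≈ x′ + y′
≈-+ {x} {x′} {y} {y′} h k ε 0<ε = ≡.subst (Near (x + y) (x′ + y′)) (½+½ ε) (near-+ x y x′ y′ (h _ (0<½* 0<ε)) (k _ (0<½* 0<ε)))

≈-neg : ∀ {x x′} → x ≈ x′ → - x ≈ - x′
≈-neg {x} {x′} h ε 0<ε = near-neg x x′ (h ε 0<ε)

≈-* : ∀ {x x′ y y′} → x ≈ x′ → y ≈ y′ → x * y ≈ x′ * y′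
≈-* {x} {x′} {y} {y′} h k ε 0<ε = let δ , 0<δ , f = near-* x′ y′ ε 0<ε in f x y (h δ 0<δ) (k δ 0<δ)

-- Records, so that the two sides can be inferred.
infix 4 _≋_ _≼_

record _≋_ (x y : ℝ) : Set where
  constructor mk≋
  field ≋⇒≈ : x ≈ y

open _≋_ public

≗⇒≋ : ∀ {x y} → (∀ n → seq x n ≡ seq y n) → x ≋ y
≗⇒≋ {x} {y} h = mk≋ (≗⇒≈ {x} {y} h)

infixl 6 _⊕_
infixl 7 _⊗_
infix  8 ⊝_

-- Unfolding the operations of ℝ makes Agda compare Cauchy proofs, so everything below uses abstract copies.
abstract

  fr : ℚ → ℝ
  fr = fromℚ

  _⊕_ _⊗_ : ℝ → ℝ → ℝ
  _⊕_ = _+_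
  _⊗_ = _*_

  ⊝_ : ℝ → ℝ
  ⊝_ = -_

  fr≋ : ∀ q → fr q ≋ fromℚ q
  fr≋ q = ≗⇒≋ λ _ → ≡.refl

  ⊕≋+ : ∀ x y → x ⊕ y ≋ x + y
  ⊕≋+ x y = ≗⇒≋ λ _ → ≡.refl

  ⊗≋* : ∀ x y → x ⊗ y ≋ x * y
  ⊗≋* x y = ≗⇒≋ λ _ → ≡.refl

  ⊝≋- : ∀ x → ⊝ x ≋ - x
  ⊝≋- x = ≗⇒≋ λ _ → ≡.refl

  seq-fr : ∀ q n → seq (fr q) n ≡ q
  seq-fr q n = ≡.refl

  ℝ-isCommutativeRing : IsCommutativeRing _≋_ _⊕_ _⊗_ ⊝_ (fr 0ℚ) (fr 1ℚ)
  ℝ-isCommutativeRing = record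
      { isRing = record
        { +-isAbelianGroup = record
          { isGroup = record
            { isMonoid = record
              { isSemigroup = record
                { isMagma = record
                  { isEquivalence = record
                    { refl  = λ {x} → mk≋ (≈-refl {x})
                    ; sym   = λ { {x} {y} (mk≋ h) → mk≋ (≈-sym {x} {y} h) }
                    ; trans = λ { {x} {y} {z} (mk≋ h) (mk≋ k) → mk≋ (≈-trans {x} {y} {z} h k) } }
                  ; ∙-cong = λ { {x} {x′} {y} {y′} (mk≋ h) (mk≋ k) → mk≋ (≈-+ {x} {x′} {y} {y′} h k) } }
                ; assoc = λ x y z → ≗⇒≋ λ n → ℚ.+-assoc (seq x n) (seq y n) (seq z n) }
              ; identity = (λ x → ≗⇒≋ λ n → ℚ.+-identityˡ (seq x n)) , (λ x → ≗⇒≋ λ n → ℚ.+-identityʳ (seq x n)) }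
            ; inverse = (λ x → ≗⇒≋ λ n → ℚ.+-inverseˡ (seq x n)) , (λ x → ≗⇒≋ λ n → ℚ.+-inverseʳ (seq x n))
            ; ⁻¹-cong = λ { {x} {x′} (mk≋ h) → mk≋ (≈-neg {x} {x′} h) } }
          ; comm = λ x y → ≗⇒≋ λ n → ℚ.+-comm (seq x n) (seq y n) }
        ; *-cong = λ { {x} {x′} {y} {y′} (mk≋ h) (mk≋ k) → mk≋ (≈-* {x} {x′} {y} {y′} h k) }
        ; *-assoc = λ x y z → ≗⇒≋ λ n → ℚ.*-assoc (seq x n) (seq y n) (seq z n)
        ; *-identity = (λ x → ≗⇒≋ λ n → ℚ.*-identityˡ (seq x n)) , (λ x → ≗⇒≋ λ n → ℚ.*-identityʳ (seq x n))
        ; distrib = (λ x y z → ≗⇒≋ λ n → ℚ.*-distribˡ-+ (seq x n) (seq y n) (seq z n))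
                  , (λ x y z → ≗⇒≋ λ n → ℚ.*-distribʳ-+ (seq x n) (seq y n) (seq z n)) }
      ; *-comm = λ x y → ≗⇒≋ λ n → ℚ.*-comm (seq x n) (seq y n) }

𝟘 𝟙 : ℝ
𝟘 = fr 0ℚ
𝟙 = fr 1ℚ

ℝ-ring : CommutativeRing 0ℓ 0ℓ
ℝ-ring = record { isCommutativeRing = ℝ-isCommutativeRing }

module ℝR = CommutativeRing ℝ-ring
module ℝ-Identities = RingIdentities ℝ-ring

-- The positive form of x ≤ y.
record _≼_ (x y : ℝ) : Set where
  constructor mk≼
  field ≼-within : ∀ ε → 0ℚ ℚ.< ε → Eventually λ n → seq x n ℚ.≤ seq y n ℚ.+ ε

open _≼_ public

≼-trans : ∀ {x y z} → x ≼ y → y ≼ z → x ≼ z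
≼-trans {x} {y} {z} (mk≼ h) (mk≼ k) = mk≼ λ ε 0<ε → ev-zip (λ n p q → ℚ.≤-trans p (ℚ.≤-trans (ℚ.+-monoˡ-≤ (½ ℚ.* ε) q)
  (ℚ.≤-reflexive (≡.trans (ℚ.+-assoc (seq z n) _ _) (≡.cong (seq z n ℚ.+_) (½+½ ε))))))
  (h _ (0<½* 0<ε)) (k _ (0<½* 0<ε))

≼-reflexive : ∀ {x y} → x ≋ y → x ≼ y
≼-reflexive {x} {y} (mk≋ h) = mk≼ λ ε 0<ε → ev-map (λ n p → ∣p-q∣≤ε⇒p≤q+ε (seq x n) (seq y n) (ℚ.<⇒≤ p)) (h ε 0<ε)

≼-refl : ∀ {x} → x ≼ x
≼-refl = ≼-reflexive ℝR.refl

≼-antisym : ∀ {x y} → x ≼ y → y ≼ x → x ≋ y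
≼-antisym {x} {y} (mk≼ h) (mk≼ k) = mk≋ λ ε 0<ε → ev-zip (λ n p q → ℚ.≤-<-trans (∣p-q∣≤ε⇐ (seq x n) (seq y n) p q) (½ε<ε 0<ε))
  (h _ (0<½* 0<ε)) (k _ (0<½* 0<ε))

≼-+ : ∀ {x x′ y y′} → x ≼ x′ → y ≼ y′ → x + y ≼ x′ + y′
≼-+ {x} {x′} {y} {y′} (mk≼ h) (mk≼ k) = mk≼ λ ε 0<ε → ev-zip (λ n p q → ℚ.≤-trans (ℚ.+-mono-≤ p q) (ℚ.≤-reflexive (≡.trans
    (solve 3 (λ a b e → (a :+ e) :+ (b :+ e) := (a :+ b) :+ (e :+ e)) ≡.refl (seq x′ n) (seq y′ n) (½ ℚ.* ε))
    (≡.cong ((seq x′ n ℚ.+ seq y′ n) ℚ.+_) (½+½ ε)))))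
  (h _ (0<½* 0<ε)) (k _ (0<½* 0<ε))
  where open ℚ-Solver

≼-pointwise : ∀ {x y} → Eventually (λ n → seq x n ℚ.≤ seq y n) → x ≼ y
≼-pointwise {x} {y} h = mk≼ λ ε 0<ε → ev-map (λ n p → ℚ.≤-trans p
  (≡.subst (ℚ._≤ seq y n ℚ.+ ε) (ℚ.+-identityʳ (seq y n)) (ℚ.+-monoʳ-≤ (seq y n) (ℚ.<⇒≤ 0<ε)))) h

-- If one approximation is not positive, it is at most slightly negative, and the product is small
-- because the other factor is bounded. Otherwise both are nonnegative.
0≼-* : ∀ {x y} → 0ℝ ≼ x → 0ℝ ≼ y → 0ℝ ≼ x * y
0≼-* {x} {y} (mk≼ hx) (mk≼ hy) = mk≼ bound
  where
  module _ (ε : ℚ) (0<ε : 0ℚ ℚ.< ε) where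
    open ℚ.≤-Reasoning
    from-abs : ∀ q → ∣ q ∣ ℚ.< ε → 0ℚ ℚ.≤ q ℚ.+ ε
    from-abs q lt = ≡.subst (ℚ._≤ q ℚ.+ ε) (ℚ.+-inverseʳ q) (ℚ.+-monoʳ-≤ q (ℚ.≤-trans (-q≤∣q∣ q) (ℚ.<⇒≤ lt)))
    small : ∀ q {δ} → 0ℚ ℚ.< δ → q ℚ.≤ 0ℚ → 0ℚ ℚ.≤ q ℚ.+ ½ ℚ.* δ → ∣ q ∣ ℚ.< δ
    small q {δ} 0<δ q≤0 h = ℚ.≤-<-trans (∣-∣-≤ (ℚ.≤-trans q≤0 (ℚ.<⇒≤ (0<½* 0<δ)))
      (≡.subst₂ ℚ._≤_ (ℚ.+-identityˡ (ℚ.- q)) (solve 2 (λ q d → q :+ d :- q := d) ≡.refl q (½ ℚ.* δ)) (ℚ.+-monoˡ-≤ (ℚ.- q) h)))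
      (½ε<ε 0<δ)
      where open ℚ-Solver
    product′ : ∀ a b {δ η} → 0ℚ ℚ.≤ a ℚ.+ ½ ℚ.* δ → 0ℚ ℚ.≤ b ℚ.+ ½ ℚ.* η →
              (∣ a ∣ ℚ.< δ → ∣ a ℚ.* b ∣ ℚ.< ε) → (∣ b ∣ ℚ.< η → ∣ b ℚ.* a ∣ ℚ.< ε) →
              0ℚ ℚ.< δ → 0ℚ ℚ.< η → 0ℚ ℚ.≤ a ℚ.* b ℚ.+ ε
    product′ a b ha hb f g 0<δ 0<η with ℚ.≤-total a 0ℚ | ℚ.≤-total b 0ℚ
    ... | inj₁ a≤0 | _        = from-abs (a ℚ.* b) (f (small a 0<δ a≤0 ha))
    ... | inj₂ 0≤a | inj₁ b≤0 = from-abs (a ℚ.* b) (≡.subst (λ q → ∣ q ∣ ℚ.< ε) (ℚ.*-comm b a) (g (small b 0<η b≤0 hb)))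
    ... | inj₂ 0≤a | inj₂ 0≤b = begin
      0ℚ                ≡⟨ ℚ.*-zeroʳ a ⟨
      a ℚ.* 0ℚ          ≤⟨ ℚ.*-monoˡ-≤-nonNeg a {{ℚ.nonNegative 0≤a}} 0≤b ⟩
      a ℚ.* b           ≡⟨ ℚ.+-identityʳ _ ⟨
      a ℚ.* b ℚ.+ 0ℚ    ≤⟨ ℚ.+-monoʳ-≤ (a ℚ.* b) (ℚ.<⇒≤ 0<ε) ⟩
      a ℚ.* b ℚ.+ ε     ∎
    bound : Eventually λ n → 0ℚ ℚ.≤ seq x n ℚ.* seq y n ℚ.+ ε
    bound =
      let A , A>0 , ∣x∣≤A = bounded (cauchy x)
          B , B>0 , ∣y∣≤B = bounded (cauchy y)
          δ , 0<δ , f = scaled B ε B>0 0<ε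
          η , 0<η , g = scaled A ε A>0 0<ε
      in ev-zip (λ n (hA , hB) (p , q) → product′ (seq x n) (seq y n) p q
                  (λ lt → f (seq x n) (seq y n) lt hB) (λ lt → g (seq y n) (seq x n) lt hA) 0<δ 0<η)
           (ev-zip (λ _ → _,_) ∣x∣≤A ∣y∣≤B) (ev-zip (λ _ → _,_) (hx _ (0<½* 0<δ)) (hy _ (0<½* 0<η)))

<⇒≼ : ∀ {x y} → x < y → x ≼ y
<⇒≼ {x} {y} (ε , 0<ε , h) = ≼-pointwise (ev-map (λ n p → ℚ.<⇒≤ (ℚ.≤-<-trans
  (≡.subst (ℚ._≤ seq x n ℚ.+ ε) (ℚ.+-identityʳ (seq x n)) (ℚ.+-monoʳ-≤ (seq x n) (ℚ.<⇒≤ 0<ε))) p)) h)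

-- Beyond some index N the difference x - y varies by less than ε/4. Its rational value at N can be
-- compared with ε/2: a larger value would give y < x, and a smaller one gives the claim.
≤⇒≼ : ∀ {x y} → x ≤ y → x ≼ y
≤⇒≼ {x} {y} ¬y<x = mk≼ bound
  where
  module _ (ε : ℚ) (0<ε : 0ℚ ℚ.< ε) where
    open ℚ.≤-Reasoning
    open ℚ-Solver
    η = ½ ℚ.* (½ ℚ.* ε)
    0<η = 0<½* (0<½* 0<ε)
    below : ∀ a b d → d ℚ.≤ ½ ℚ.* ε → ∣ (a ℚ.- b) ℚ.- d ∣ ℚ.< η → a ℚ.≤ b ℚ.+ ε
    below a b d small close = begin
      a                                    ≡⟨ solve 2 (λ x y → x := y :+ (x :- y)) ≡.refl a b ⟩
      b ℚ.+ (a ℚ.- b)                      ≤⟨ ℚ.+-monoʳ-≤ b (∣p-q∣≤ε⇒p≤q+ε (a ℚ.- b) d (ℚ.<⇒≤ close)) ⟩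
      b ℚ.+ (d ℚ.+ η)                      ≤⟨ ℚ.+-monoʳ-≤ b (ℚ.+-mono-≤ small (ℚ.<⇒≤ (½ε<ε (0<½* 0<ε)))) ⟩
      b ℚ.+ (½ ℚ.* ε ℚ.+ ½ ℚ.* ε)          ≡⟨ ≡.cong (b ℚ.+_) (½+½ ε) ⟩
      b ℚ.+ ε                              ∎
    above : ∀ a b d → ½ ℚ.* ε ℚ.< d → ∣ d ℚ.- (a ℚ.- b) ∣ ℚ.< η → b ℚ.+ η ℚ.< a
    above a b d large close = begin-strict
      b ℚ.+ η                              ≡⟨ solve 2 (λ y e → y :+ e := y :- e :+ (e :+ e)) ≡.refl b η ⟩
      b ℚ.- η ℚ.+ (η ℚ.+ η)                ≡⟨ ≡.cong (b ℚ.- η ℚ.+_) (½+½ (½ ℚ.* ε)) ⟩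
      b ℚ.- η ℚ.+ ½ ℚ.* ε                  <⟨ ℚ.+-monoʳ-< (b ℚ.- η) large ⟩
      b ℚ.- η ℚ.+ d                        ≤⟨ ℚ.+-monoʳ-≤ (b ℚ.- η) (∣p-q∣≤ε⇒p≤q+ε d (a ℚ.- b) (ℚ.<⇒≤ close)) ⟩
      b ℚ.- η ℚ.+ ((a ℚ.- b) ℚ.+ η)        ≡⟨ solve 3 (λ x y e → y :- e :+ ((x :- y) :+ e) := x) ≡.refl a b η ⟩
      a                                    ∎
    by-cases : ∀ N → (∀ m n → N ℕ.≤ m → N ℕ.≤ n → ∣ (seq x m ℚ.- seq y m) ℚ.- (seq x n ℚ.- seq y n) ∣ ℚ.< η) →
               Dec (seq x N ℚ.- seq y N ℚ.≤ ½ ℚ.* ε) → Eventually λ n → seq x n ℚ.≤ seq y n ℚ.+ ε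
    by-cases N close (yes small) = N , λ n N≤n → below (seq x n) (seq y n) (seq x N ℚ.- seq y N) small (close n N N≤n ℕ.≤-refl)
    by-cases N close (no large)  = contradiction (η , 0<η , N , λ n N≤n →
      above (seq x n) (seq y n) (seq x N ℚ.- seq y N) (ℚ.≰⇒> large) (close N n ℕ.≤-refl N≤n)) ¬y<x
    bound : Eventually λ n → seq x n ℚ.≤ seq y n ℚ.+ ε
    bound = let N , close = cauchy (x - y) η 0<η in by-cases N close (seq x N ℚ.- seq y N ℚ.≤? ½ ℚ.* ε)

≼⇒≤ : ∀ {x y} → x ≼ y → x ≤ y
≼⇒≤ {x} {y} (mk≼ h) (ε , 0<ε , k) = ev-witness {A = ⊥} (ev-zip {R = λ _ → ⊥} (λ n p q →
  ℚ.<-irrefl ≡.refl (ℚ.<-≤-trans (ℚ.<-≤-trans q p) (ℚ.+-monoʳ-≤ (seq y n) (ℚ.<⇒≤ (½ε<ε 0<ε))))) (h _ (0<½* 0<ε)) k) (λ _ ())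

-- An equality amounts to two inequalities, and these are negations by `≤⇒≼`.
≋-stable : ∀ {x y} → ¬ ¬ (x ≋ y) → x ≋ y
≋-stable h = ≼-antisym
  (≤⇒≼ λ y<x → h λ x≋y → ≼⇒≤ (≼-reflexive x≋y) y<x)
  (≤⇒≼ λ x<y → h λ x≋y → ≼⇒≤ (≼-reflexive (ℝR.sym x≋y)) x<y)

0≤q*q : ∀ q → 0ℚ ℚ.≤ q ℚ.* q
0≤q*q q with ℚ.≤-total 0ℚ q
... | inj₁ 0≤q = ≡.subst (ℚ._≤ q ℚ.* q) (ℚ.*-zeroʳ q) (ℚ.*-monoˡ-≤-nonNeg q {{ℚ.nonNegative 0≤q}} 0≤q)
... | inj₂ q≤0 = ≡.subst (ℚ._≤ q ℚ.* q) (ℚ.*-zeroʳ q) (ℚ.*-monoˡ-≤-nonPos q {{ℚ.nonPositive q≤0}} q≤0)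

0<-* : ∀ {x y} → 0ℝ < x → 0ℝ < y → 0ℝ < x * y
0<-* {x} {y} (ε , 0<ε , h) (δ , 0<δ , k) = ε ℚ.* δ ,
  ℚ.positive⁻¹ (ε ℚ.* δ) {{ℚ.pos*pos⇒pos ε {{ℚ.positive 0<ε}} δ {{ℚ.positive 0<δ}}}} ,
  ev-zip (λ n p q → ≡.subst (ℚ._< seq x n ℚ.* seq y n) (≡.sym (ℚ.+-identityˡ (ε ℚ.* δ)))
    (product′ (seq x n) (seq y n) (≡.subst (ℚ._< seq x n) (ℚ.+-identityˡ ε) p) (≡.subst (ℚ._< seq y n) (ℚ.+-identityˡ δ) q))) h k
  where
  product′ : ∀ a b → ε ℚ.< a → δ ℚ.< b → ε ℚ.* δ ℚ.< a ℚ.* b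
  product′ a b ε<a δ<b = ℚ.<-trans (ℚ.*-monoˡ-<-pos δ {{ℚ.positive 0<δ}} ε<a)
    (ℚ.*-monoʳ-<-pos a {{ℚ.positive (ℚ.<-trans 0<ε ε<a)}} δ<b)

0<-neg : ∀ {x} → x < 0ℝ → 0ℝ < - x
0<-neg {x} (ε , 0<ε , h) = ε , 0<ε , ev-map (λ n p → ≡.subst₂ ℚ._<_ (solve 2 (λ x e → x :+ e :- x := con (+ 0) :+ e) ≡.refl (seq x n) ε)
  (ℚ.+-identityˡ (ℚ.- seq x n)) (ℚ.+-monoˡ-< (ℚ.- seq x n) p)) h
  where open ℚ-Solver

≼-neg : ∀ {x y} → x ≼ y → - y ≼ - x
≼-neg {x} {y} (mk≼ h) = mk≼ λ ε 0<ε → ev-map (λ n p → flip ε (seq x n) (seq y n) p) (h ε 0<ε)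
  where
  open ℚ-Solver
  flip : ∀ ε u v → u ℚ.≤ v ℚ.+ ε → ℚ.- v ℚ.≤ ℚ.- u ℚ.+ ε
  flip ε u v p = ≡.subst₂ ℚ._≤_ (solve 2 (λ u v → u :+ (:- u :- v) := :- v) ≡.refl u v)
    (solve 3 (λ u v e → v :+ e :+ (:- u :- v) := :- u :+ e) ≡.refl u v ε) (ℚ.+-monoˡ-≤ (ℚ.- u ℚ.- v) p)

0≼x*x : ∀ x → 0ℝ ≼ x * x
0≼x*x x = ≼-pointwise (ev-always λ n → 0≤q*q (seq x n))

0<1 : 0ℝ < 1ℝ
0<1 = ½ , ℚ.positive⁻¹ ½ , ev-always λ _ → ≡.subst (ℚ._< 1ℚ) (≡.sym (ℚ.+-identityˡ ½)) (½ε<ε {1ℚ} (ℚ.positive⁻¹ 1ℚ))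

<⇒≉ : ∀ {x y} → x < y → ¬ (x ≋ y)
<⇒≉ x<y x≋y = ≼⇒≤ (≼-reflexive (ℝR.sym x≋y)) x<y

abstract

  ≼-⊕ : ∀ {x x′ y y′} → x ≼ x′ → y ≼ y′ → x ⊕ y ≼ x′ ⊕ y′
  ≼-⊕ = ≼-+

  fr-mono : ∀ {p q} → p ℚ.≤ q → fr p ≼ fr q
  fr-mono p≤q = ≼-pointwise (ev-always λ _ → p≤q)

  0≼-⊗ : ∀ {x y} → 𝟘 ≼ x → 𝟘 ≼ y → 𝟘 ≼ x ⊗ y
  0≼-⊗ = 0≼-*

  0<-⊗ : ∀ x y → 𝟘 < x → 𝟘 < y → 𝟘 < x ⊗ y
  0<-⊗ x y = 0<-* {x} {y}

  0<-⊝ : ∀ x → x < 𝟘 → 𝟘 < ⊝ x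
  0<-⊝ x = 0<-neg {x}

  ≼-⊝ : ∀ {x y} → x ≼ y → ⊝ y ≼ ⊝ x
  ≼-⊝ = ≼-neg

  0≼x⊗x : ∀ x → 𝟘 ≼ x ⊗ x
  0≼x⊗x = 0≼x*x

  𝟘<𝟙 : 𝟘 < 𝟙
  𝟘<𝟙 = 0<1

  near-⊕ : ∀ x y x′ y′ {δ ε} → Near x x′ δ → Near y y′ ε → Near (x ⊕ y) (x′ ⊕ y′) (δ ℚ.+ ε)
  near-⊕ = near-+

  near-⊝ : ∀ x x′ {ε} → Near x x′ ε → Near (⊝ x) (⊝ x′) ε
  near-⊝ = near-neg

  near-⊗ : ∀ L M ε → 0ℚ ℚ.< ε → ∃[ δ ] (0ℚ ℚ.< δ × (∀ x y → Near x L δ → Near y M δ → Near (x ⊗ y) (L ⊗ M) ε))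
  near-⊗ = near-*

  fr-+ : ∀ p q → fr (p ℚ.+ q) ≋ fr p ⊕ fr q
  fr-+ p q = ≗⇒≋ λ _ → ≡.refl

  fr-* : ∀ p q → fr (p ℚ.* q) ≋ fr p ⊗ fr q
  fr-* p q = ≗⇒≋ λ _ → ≡.refl

-- Rational bounds on a tail of the sequence, in place of an absolute value on ℝ.
record Bd (x : ℝ) (q : ℚ) : Set where
  constructor mkBd
  field bd-within : Eventually λ n → ∣ seq x n ∣ ℚ.≤ q

open Bd public

bd-weaken : ∀ {x q r} → q ℚ.≤ r → Bd x q → Bd x r
bd-weaken q≤r (mkBd h) = mkBd (ev-map (λ _ p → ℚ.≤-trans p q≤r) h)

bd-exists : ∀ x → ∃[ q ] (0ℚ ℚ.≤ q × Bd x q)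
bd-exists x = let M , M>0 , h = bounded (cauchy x) in M , ℚ.<⇒≤ (ℚ.positive⁻¹ M {{M>0}}) , mkBd h

abstract

  bd-fr : ∀ {q} → 0ℚ ℚ.≤ q → Bd (fr q) q
  bd-fr 0≤q = mkBd (ev-always λ _ → ℚ.≤-reflexive (ℚ.0≤p⇒∣p∣≡p 0≤q))

  bd-⊕ : ∀ {x y q r} → Bd x q → Bd y r → Bd (x ⊕ y) (q ℚ.+ r)
  bd-⊕ {x} {y} (mkBd h) (mkBd k) = mkBd (ev-zip (λ n p q → ℚ.≤-trans (ℚ.∣p+q∣≤∣p∣+∣q∣ (seq x n) (seq y n)) (ℚ.+-mono-≤ p q)) h k)

  bd-⊝ : ∀ {x q} → Bd x q → Bd (⊝ x) q
  bd-⊝ {x} {q} (mkBd h) = mkBd (ev-map (λ n → ≡.subst (ℚ._≤ q) (≡.sym (ℚ.∣-p∣≡∣p∣ (seq x n)))) h)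

  bd-⊗ : ∀ {x y q r} → Bd x q → Bd y r → Bd (x ⊗ y) (q ℚ.* r)
  bd-⊗ {x} {y} {q} {r} (mkBd h) (mkBd k) = mkBd (ev-zip (λ n → product′ (seq x n) (seq y n)) h k)
    where
    product′ : ∀ a b → ∣ a ∣ ℚ.≤ q → ∣ b ∣ ℚ.≤ r → ∣ a ℚ.* b ∣ ℚ.≤ q ℚ.* r
    product′ a b ha hb = ≡.subst (ℚ._≤ q ℚ.* r) (≡.sym (ℚ.∣p*q∣≡∣p∣*∣q∣ a b)) (ℚ.≤-trans
      (ℚ.*-monoˡ-≤-nonNeg ∣ a ∣ {{ℚ.∣-∣-nonNeg a}} hb)
      (ℚ.*-monoʳ-≤-nonNeg r {{ℚ.nonNegative (ℚ.≤-trans (ℚ.0≤∣p∣ b) hb)}} ha))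

  near-bd : ∀ {x y d q ε} → x ≋ y ⊕ d → Bd d q → q ℚ.< ε → Near x y ε
  near-bd {x} {y} {d} {q} {ε} (mk≋ h) (mkBd k) q<ε =
    ev-zip (λ n → close (seq x n) (seq y n) (seq d n)) (h (ε ℚ.- q) 0<ε-q) k
    where
    open ℚ-Solver
    open ℚ.≤-Reasoning
    0<ε-q : 0ℚ ℚ.< ε ℚ.- q
    0<ε-q = ≡.subst (ℚ._< ε ℚ.- q) (ℚ.+-inverseʳ q) (ℚ.+-monoˡ-< (ℚ.- q) q<ε)
    close : ∀ a b c → ∣ a ℚ.- (b ℚ.+ c) ∣ ℚ.< ε ℚ.- q → ∣ c ∣ ℚ.≤ q → ∣ a ℚ.- b ∣ ℚ.< ε
    close a b c p r = begin-strict
      ∣ a ℚ.- b ∣                              ≡⟨ ≡.cong ∣_∣ (solve 3 (λ a b c → a :- b := (a :- (b :+ c)) :+ c) ≡.refl a b c) ⟩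
      ∣ (a ℚ.- (b ℚ.+ c)) ℚ.+ c ∣              ≤⟨ ℚ.∣p+q∣≤∣p∣+∣q∣ (a ℚ.- (b ℚ.+ c)) c ⟩
      ∣ a ℚ.- (b ℚ.+ c) ∣ ℚ.+ ∣ c ∣            <⟨ ℚ.+-mono-<-≤ p r ⟩
      ε ℚ.- q ℚ.+ q                            ≡⟨ solve 2 (λ e q → e :- q :+ q := e) ≡.refl ε q ⟩
      ε                                        ∎

record Lim (a : ℕ → ℝ) (L : ℝ) : Set where
  constructor mkLim
  field lim-within : ∀ ε → 0ℚ ℚ.< ε → Eventually λ k → Near (a k) L ε

open Lim public

⟶⇒Lim : ∀ {a L} → a ⟶ L → Lim a L
⟶⇒Lim {a} {L} h = mkLim λ ε 0<ε → ev-map (λ k (below , above) → near ε k below above) (h ε 0<ε)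
  where
  near : ∀ ε k → L - fromℚ ε < a k → a k < L + fromℚ ε → Near (a k) L ε
  near ε k (δ , 0<δ , lo) (η , 0<η , hi) = ev-zip (λ n p q → abs (seq (a k) n) (seq L n) 0<δ p 0<η q) lo hi
    where
    open ℚ-Solver
    abs : ∀ x l {δ η} → 0ℚ ℚ.< δ → l ℚ.- ε ℚ.+ δ ℚ.< x → 0ℚ ℚ.< η → x ℚ.+ η ℚ.< l ℚ.+ ε → ∣ x ℚ.- l ∣ ℚ.< ε
    abs x l {δ} {η} 0<δ lo 0<η hi with ℚ.∣p∣≡p∨∣p∣≡-p (x ℚ.- l)
    ... | inj₁ eq = ≡.subst (ℚ._< ε) (≡.sym eq) (≡.subst₂ ℚ._<_ (solve 2 (λ x l → x :+ (:- l) := x :- l) ≡.refl x l)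
      (solve 2 (λ l e → l :+ e :- l := e) ≡.refl l ε) (ℚ.+-monoˡ-< (ℚ.- l)
        (ℚ.≤-<-trans (≡.subst (ℚ._≤ x ℚ.+ η) (ℚ.+-identityʳ x) (ℚ.+-monoʳ-≤ x (ℚ.<⇒≤ 0<η))) hi)))
    ... | inj₂ eq = ≡.subst (ℚ._< ε) (≡.sym eq) (≡.subst₂ ℚ._<_ (solve 3 (λ x l e → (l :- e) :+ (e :- x) := :- (x :- l)) ≡.refl x l ε)
      (solve 2 (λ x e → x :+ (e :- x) := e) ≡.refl x ε) (ℚ.+-monoˡ-< (ε ℚ.- x)
        (ℚ.≤-<-trans (≡.subst (ℚ._≤ l ℚ.- ε ℚ.+ δ) (ℚ.+-identityʳ (l ℚ.- ε)) (ℚ.+-monoʳ-≤ (l ℚ.- ε) (ℚ.<⇒≤ 0<δ))) lo)))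

lim-close : ∀ {a b L} → (∀ ε → 0ℚ ℚ.< ε → Eventually λ k → Near (a k) (b k) ε) → Lim a L → Lim b L
lim-close {a} {b} {L} ab (mkLim h) = mkLim λ ε 0<ε → ev-zip (λ k p q → near-½ (b k) (a k) L (near-sym (a k) (b k) p) q)
  (ab _ (0<½* 0<ε)) (h _ (0<½* 0<ε))

lim-≋ : ∀ {a b L} → (∀ k → a k ≋ b k) → Lim a L → Lim b L
lim-≋ ab = lim-close λ ε 0<ε → ev-always λ k → ≋⇒≈ (ab k) ε 0<ε

lim-resp : ∀ {a L M} → L ≋ M → Lim a L → Lim a M
lim-resp {a} {L} {M} (mk≋ L≈M) (mkLim h) = mkLim λ ε 0<ε → ev-map (λ k p → near-½ (a k) L M p (L≈M _ (0<½* 0<ε))) (h _ (0<½* 0<ε))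

lim-unique : ∀ {a L M} → Lim a L → Lim a M → L ≋ M
lim-unique {a} {L} {M} (mkLim h) (mkLim k) = mk≋ λ ε 0<ε → ev-witness (ev-zip (λ i p q → near-½ L (a i) M (near-sym (a i) L p) q)
  (h _ (0<½* 0<ε)) (k _ (0<½* 0<ε))) λ _ p → p

lim-⊕ : ∀ {a b L M} → Lim a L → Lim b M → Lim (λ k → a k ⊕ b k) (L ⊕ M)
lim-⊕ {a} {b} {L} {M} (mkLim h) (mkLim k) = mkLim λ ε 0<ε →
  ev-zip (λ i p q → ≡.subst (Near (a i ⊕ b i) (L ⊕ M)) (½+½ ε) (near-⊕ (a i) (b i) L M p q)) (h _ (0<½* 0<ε)) (k _ (0<½* 0<ε))

lim-⊝ : ∀ {a L} → Lim a L → Lim (λ k → ⊝ a k) (⊝ L)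
lim-⊝ {a} {L} (mkLim h) = mkLim λ ε 0<ε → ev-map (λ k → near-⊝ (a k) L) (h ε 0<ε)

lim-⊗ : ∀ {a b L M} → Lim a L → Lim b M → Lim (λ k → a k ⊗ b k) (L ⊗ M)
lim-⊗ {a} {b} {L} {M} (mkLim h) (mkLim k) = mkLim λ ε 0<ε → let δ , 0<δ , f = near-⊗ L M ε 0<ε in
  ev-zip (λ i p q → f (a i) (b i) p q) (h δ 0<δ) (k δ 0<δ)

lim-≽ : ∀ {x a L} → Eventually (λ k → x ≼ a k) → Lim a L → x ≼ L
lim-≽ {x} {a} {L} h (mkLim lim) = mk≼ λ ε 0<ε → ev-witness (ev-zip (λ k p q →
  ev-zip (λ n u v → bound ε (seq x n) (seq (a k) n) (seq L n) u v) (≼-within p _ (0<½* 0<ε)) q) h (lim _ (0<½* 0<ε))) λ _ p → p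
  where
  open ℚ.≤-Reasoning
  bound : ∀ ε u v w → u ℚ.≤ v ℚ.+ ½ ℚ.* ε → ∣ v ℚ.- w ∣ ℚ.< ½ ℚ.* ε → u ℚ.≤ w ℚ.+ ε
  bound ε u v w h k = begin
    u                                    ≤⟨ h ⟩
    v ℚ.+ ½ ℚ.* ε                        ≤⟨ ℚ.+-monoˡ-≤ (½ ℚ.* ε) (∣p-q∣≤ε⇒p≤q+ε v w (ℚ.<⇒≤ k)) ⟩
    w ℚ.+ ½ ℚ.* ε ℚ.+ ½ ℚ.* ε            ≡⟨ ≡.trans (ℚ.+-assoc w _ _) (≡.cong (w ℚ.+_) (½+½ ε)) ⟩
    w ℚ.+ ε                              ∎

lim-≼ : ∀ {y a L} → Eventually (λ k → a k ≼ y) → Lim a L → L ≼ y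
lim-≼ {y} {a} {L} h lim = ≼-trans (≼-reflexive (ℝR.sym (neg-neg L)))
  (≼-trans (≼-⊝ (lim-≽ (ev-map (λ k → ≼-⊝ {a k} {y}) h) (lim-⊝ lim))) (≼-reflexive (neg-neg y)))
  where open ℝ-Identities

≋-0 : ∀ {x} → ¬ (𝟘 < x) → ¬ (x < 𝟘) → x ≋ 𝟘
≋-0 h k = ≼-antisym (≤⇒≼ h) (≤⇒≼ k)

-x*y≋0 : ∀ x y → x ⊗ y ≋ 𝟘 → (⊝ x) ⊗ y ≋ 𝟘
-x*y≋0 x y h = ℝR.trans (ℝ-Identities.-x*y x y) (ℝR.trans (ℝR.-‿cong h) ℝ-Identities.-0≈0)

pos-cancel : ∀ x y → 𝟘 < y → x ⊗ y ≋ 𝟘 → x ≋ 𝟘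
pos-cancel x y 0<y h = ≋-0 {x}
  (λ 0<x → <⇒≉ {𝟘} {x ⊗ y} (0<-⊗ x y 0<x 0<y) (ℝR.sym h))
  (λ x<0 → <⇒≉ {𝟘} {(⊝ x) ⊗ y} (0<-⊗ (⊝ x) y (0<-⊝ x x<0) 0<y) (ℝR.sym (-x*y≋0 x y h)))

-- Signs cannot be decided but can be refuted: a positive or negative y would make x vanish by
-- `pos-cancel`, and a real that is neither is zero.
ℝ-noZeroDivisors : ∀ x y → x ⊗ y ≋ 𝟘 → ¬ (x ≋ 𝟘) → y ≋ 𝟘
ℝ-noZeroDivisors x y h x≉0 = ≋-0 {y}
  (λ 0<y → x≉0 (pos-cancel x y 0<y h))
  (λ y<0 → x≉0 (pos-cancel x (⊝ y) (0<-⊝ y y<0) (ℝR.trans (ℝ-Identities.x*-y x y) (-x*y≋0 x y h))))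

x⊗x≋0⇒x≋0 : ∀ {x} → x ⊗ x ≋ 𝟘 → x ≋ 𝟘
x⊗x≋0⇒x≋0 {x} h = ≋-stable λ x≉0 → x≉0 (ℝ-noZeroDivisors x x h x≉0)

-- The complex numbers as a domain

infixl 6 _⊕ᶜ_
infixl 7 _⊗ᶜ_

𝟘ᶜ 𝟙ᶜ : ℂ
𝟘ᶜ = 𝟘 +i 𝟘
𝟙ᶜ = 𝟙 +i 𝟘

⊝ᶜ_ : ℂ → ℂ
⊝ᶜ z = (⊝ re z) +i (⊝ im z)

_⊕ᶜ_ _⊗ᶜ_ : ℂ → ℂ → ℂ
z ⊕ᶜ w = (re z ⊕ re w) +i (im z ⊕ im w)
z ⊗ᶜ w = (re z ⊗ re w ⊕ ⊝ (im z ⊗ im w)) +i (re z ⊗ im w ⊕ im z ⊗ re w)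

infix 4 _≋ℂ_

record _≋ℂ_ (z w : ℂ) : Set where
  constructor _∥_
  field
    re≋ : re z ≋ re w
    im≋ : im z ≋ im w

open _≋ℂ_ public

≈ℂ⇒≋ℂ : ∀ {z w} → z ≈ℂ w → z ≋ℂ w
≈ℂ⇒≋ℂ (p , q) = mk≋ p ∥ mk≋ q

≋ℂ⇒≈ℂ : ∀ {z w} → z ≋ℂ w → z ≈ℂ w
≋ℂ⇒≈ℂ (mk≋ p ∥ mk≋ q) = p , q

ℂ-ring : CommutativeRing 0ℓ 0ℓ
ℂ-ring = record
  { Carrier = ℂ ; _≈_ = _≋ℂ_ ; _+_ = _⊕ᶜ_ ; _*_ = _⊗ᶜ_ ; -_ = ⊝ᶜ_ ; 0# = 𝟘ᶜ ; 1# = 𝟙ᶜ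
  ; isCommutativeRing = record
    { isRing = record
      { +-isAbelianGroup = record
        { isGroup = record
          { isMonoid = record
            { isSemigroup = record
              { isMagma = record
                { isEquivalence = record
                  { refl  = ℝR.refl ∥ ℝR.refl
                  ; sym   = λ (p ∥ q) → ℝR.sym p ∥ ℝR.sym q
                  ; trans = trans }
                ; ∙-cong = λ (p ∥ q) (r ∥ s) → ℝR.+-cong p r ∥ ℝR.+-cong q s }
              ; assoc = λ z w v → ℝR.+-assoc (re z) (re w) (re v) ∥ ℝR.+-assoc (im z) (im w) (im v) }
            ; identity = (λ z → ℝR.+-identityˡ (re z) ∥ ℝR.+-identityˡ (im z)) , (λ z → ℝR.+-identityʳ (re z) ∥ ℝR.+-identityʳ (im z)) }
          ; inverse = (λ z → ℝR.-‿inverseˡ (re z) ∥ ℝR.-‿inverseˡ (im z)) , (λ z → ℝR.-‿inverseʳ (re z) ∥ ℝR.-‿inverseʳ (im z))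
          ; ⁻¹-cong = λ (p ∥ q) → ℝR.-‿cong p ∥ ℝR.-‿cong q }
        ; comm = λ z w → ℝR.+-comm (re z) (re w) ∥ ℝR.+-comm (im z) (im w) }
      ; *-cong = λ (p ∥ q) (r ∥ s) → ℝR.+-cong (ℝR.*-cong p r) (ℝR.-‿cong (ℝR.*-cong q s)) ∥ ℝR.+-cong (ℝR.*-cong p s) (ℝR.*-cong q r)
      ; *-assoc = assoc
      ; *-identity = identityˡ , λ z → trans (comm z 𝟙ᶜ) (identityˡ z)
      ; distrib = distribˡ , λ z w v → trans (comm (w ⊕ᶜ v) z) (trans (distribˡ z w v) (let p ∥ q = comm z w ; r ∥ s = comm z v in ℝR.+-cong p r ∥ ℝR.+-cong q s)) }
    ; *-comm = comm } }
  where
  open ℝ-Identities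
  trans : ∀ {z w v} → z ≋ℂ w → w ≋ℂ v → z ≋ℂ v
  trans (p ∥ q) (r ∥ s) = ℝR.trans p r ∥ ℝR.trans q s
  assoc : ∀ z w v → (z ⊗ᶜ w) ⊗ᶜ v ≋ℂ z ⊗ᶜ (w ⊗ᶜ v)
  assoc (a +i b) (c +i d) (e +i f) = re-assoc a b c d e f ∥ im-assoc a b c d e f
  comm : ∀ z w → z ⊗ᶜ w ≋ℂ w ⊗ᶜ z
  comm (a +i b) (c +i d) = re-comm a b c d ∥ im-comm a b c d
  identityˡ : ∀ z → 𝟙ᶜ ⊗ᶜ z ≋ℂ z
  identityˡ (a +i b) = re-identity a b ∥ im-identity a b
  distribˡ : ∀ z w v → z ⊗ᶜ (w ⊕ᶜ v) ≋ℂ z ⊗ᶜ w ⊕ᶜ z ⊗ᶜ v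
  distribˡ (a +i b) (c +i d) (e +i f) = re-distrib a b c d e f ∥ im-distrib a b c d e f

norm² : ℂ → ℝ
norm² z = re z ⊗ re z ⊕ im z ⊗ im z

norm²≋0⇒≋0 : ∀ z → norm² z ≋ 𝟘 → z ≋ℂ 𝟘ᶜ
norm²≋0⇒≋0 z h = component (re z) (im z) h ∥ component (im z) (re z) (ℝR.trans (ℝR.+-comm _ _) h)
  where
  component : ∀ a b → a ⊗ a ⊕ b ⊗ b ≋ 𝟘 → a ≋ 𝟘
  component a b h = x⊗x≋0⇒x≋0 (≼-antisym
    (≼-trans (≼-trans (≼-reflexive (ℝR.sym (ℝR.+-identityʳ (a ⊗ a)))) (≼-⊕ ≼-refl (0≼x⊗x b))) (≼-reflexive h))
    (0≼x⊗x a))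

-- Multiplication by the conjugate of z turns z w = 0 into |z|² w = 0, an equation between reals in
-- each component.
ℂ-noZeroDivisors : ∀ {z w} → z ⊗ᶜ w ≋ℂ 𝟘ᶜ → ¬ (z ≋ℂ 𝟘ᶜ) → w ≋ℂ 𝟘ᶜ
ℂ-noZeroDivisors {a +i b} {c +i d} (p ∥ q) z≉0 =
  ℝ-noZeroDivisors (a ⊗ a ⊕ b ⊗ b) c (ℝR.trans
    (ℝ-Identities.divide-re a b c d)
    (vanish a b)) norm²≉0 ∥
  ℝ-noZeroDivisors (a ⊗ a ⊕ b ⊗ b) d (ℝR.trans
    (ℝ-Identities.divide-im a b c d)
    (vanish (⊝ b) a)) norm²≉0
  where
  norm²≉0 : ¬ (a ⊗ a ⊕ b ⊗ b ≋ 𝟘)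
  norm²≉0 h = z≉0 (norm²≋0⇒≋0 (a +i b) h)
  vanish : ∀ x y → x ⊗ (a ⊗ c ⊕ ⊝ (b ⊗ d)) ⊕ y ⊗ (a ⊗ d ⊕ b ⊗ c) ≋ 𝟘
  vanish x y = ℝR.trans (ℝR.+-cong (ℝR.trans (ℝR.*-congˡ {x} p) (ℝR.zeroʳ x)) (ℝR.trans (ℝR.*-congˡ {y} q) (ℝR.zeroʳ y)))
    (ℝR.+-identityˡ 𝟘)

open IntegerMultiples ℂ-ring using () renaming (ι to ιℂ)

0≼re-ι : ∀ n → 𝟘 ≼ re (ιℂ (+ n))
1≼re-ι : ∀ n → 𝟙 ≼ re (ιℂ (+ suc n))
0≼re-ι zero    = ≼-refl
0≼re-ι (suc n) = ≼-trans (<⇒≼ 𝟘<𝟙) (1≼re-ι n)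
1≼re-ι n = ≼-trans (≼-reflexive (ℝR.sym (ℝR.+-identityʳ 𝟙))) (≼-⊕ ≼-refl (0≼re-ι n))

ℂ-domain : CharZeroDomain
ℂ-domain = record
  { commutativeRing = ℂ-ring
  ; stable = λ h → ≋-stable (λ k → h λ (p ∥ _) → k p) ∥ ≋-stable (λ k → h λ (_ ∥ q) → k q)
  ; torsionFree = λ n z h → ℂ-noZeroDivisors {ιℂ (+ suc n)} {z} h λ (p ∥ _) →
      ≼⇒≤ (≼-trans (1≼re-ι n) (≼-reflexive p)) 𝟘<𝟙
  ; noZeroDivisors = ℂ-noZeroDivisors
  ; 0≉1 = λ (p ∥ _) → <⇒≉ 𝟘<𝟙 p
  }

+ℂ≋⊕ᶜ : ∀ z w → z +ℂ w ≋ℂ z ⊕ᶜ w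
+ℂ≋⊕ᶜ z w = ℝR.sym (⊕≋+ (re z) (re w)) ∥ ℝR.sym (⊕≋+ (im z) (im w))

-ℂ≋⊕ᶜ : ∀ z w → z -ℂ w ≋ℂ z ⊕ᶜ ⊝ᶜ w
-ℂ≋⊕ᶜ z w = minus (re z) (re w) ∥ minus (im z) (im w)
  where
  minus : ∀ x y → x - y ≋ x ⊕ ⊝ y
  minus x y = ℝR.trans (ℝR.sym (⊕≋+ x (- y))) (ℝR.+-congˡ {x} (ℝR.sym (⊝≋- y)))

*ℂ≋⊗ᶜ : ∀ z w → z *ℂ w ≋ℂ z ⊗ᶜ w
*ℂ≋⊗ᶜ (a +i b) (c +i d) =
  ℝR.trans (ℝR.sym (⊕≋+ (a * c) (- (b * d)))) (ℝR.+-cong (ℝR.sym (⊗≋* a c)) (ℝR.trans (ℝR.sym (⊝≋- (b * d))) (ℝR.-‿cong (ℝR.sym (⊗≋* b d))))) ∥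
  ℝR.trans (ℝR.sym (⊕≋+ (a * d) (b * c))) (ℝR.+-cong (ℝR.sym (⊗≋* a d)) (ℝR.sym (⊗≋* b c)))

-- Rational majorants of the exponential series

module RationalExponential where

  module ℚP = PowerSums ℚ.+-*-commutativeRing
  module ℚS = Series ℚ.+-*-commutativeRing
  open IntegerMultiples ℚ.+-*-commutativeRing using (ι; ι-+; ι-*; ι-neg) public

  /-≡ : ∀ i j m n .{{_ : NonZero m}} .{{_ : NonZero n}} → i ℤ.* + n ≡ j ℤ.* + m → i ℚ./ m ≡ j ℚ./ n
  /-≡ i j (suc m) (suc n) eq = ℚ.fromℚᵘ-cong {ℚᵘ.mkℚᵘ i m} {ℚᵘ.mkℚᵘ j n} (ℚᵘ.*≡* eq)

  /-+ : ∀ i j → i ℚ./ 1 ℚ.+ j ℚ./ 1 ≡ (i ℤ.+ j) ℚ./ 1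
  /-+ i j = ℚ.toℚᵘ-injective (begin
    ℚ.toℚᵘ (i ℚ./ 1 ℚ.+ j ℚ./ 1)                        ≈⟨ ℚ.toℚᵘ-homo-+ (i ℚ./ 1) (j ℚ./ 1) ⟩
    ℚ.toℚᵘ (i ℚ./ 1) ℚᵘ.+ ℚ.toℚᵘ (j ℚ./ 1)              ≈⟨ ℚᵘ.+-cong (ℚ.toℚᵘ-fromℚᵘ (ℚᵘ.mkℚᵘ i 0)) (ℚ.toℚᵘ-fromℚᵘ (ℚᵘ.mkℚᵘ j 0)) ⟩
    ℚᵘ.mkℚᵘ i 0 ℚᵘ.+ ℚᵘ.mkℚᵘ j 0                        ≈⟨ ℚᵘ.*≡* (≡.cong (ℤ._* + 1) (≡.cong₂ ℤ._+_ (ℤ.*-identityʳ i) (ℤ.*-identityʳ j))) ⟩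
    ℚᵘ.mkℚᵘ (i ℤ.+ j) 0                                 ≈⟨ ℚ.toℚᵘ-fromℚᵘ (ℚᵘ.mkℚᵘ (i ℤ.+ j) 0) ⟨
    ℚ.toℚᵘ ((i ℤ.+ j) ℚ./ 1)                            ∎)
    where open import Relation.Binary.Reasoning.Setoid ℚᵘ.≃-setoid

  /-* : ∀ i j n .{{_ : NonZero n}} → i ℚ./ 1 ℚ.* (j ℚ./ n) ≡ (i ℤ.* j) ℚ./ n
  /-* i j (suc n) = ℚ.toℚᵘ-injective (begin
    ℚ.toℚᵘ (i ℚ./ 1 ℚ.* (j ℚ./ suc n))                  ≈⟨ ℚ.toℚᵘ-homo-* (i ℚ./ 1) (j ℚ./ suc n) ⟩
    ℚ.toℚᵘ (i ℚ./ 1) ℚᵘ.* ℚ.toℚᵘ (j ℚ./ suc n)          ≈⟨ ℚᵘ.*-cong (ℚ.toℚᵘ-fromℚᵘ (ℚᵘ.mkℚᵘ i 0)) (ℚ.toℚᵘ-fromℚᵘ (ℚᵘ.mkℚᵘ j n)) ⟩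
    ℚᵘ.mkℚᵘ i 0 ℚᵘ.* ℚᵘ.mkℚᵘ j n                        ≈⟨ ℚᵘ.*≡* (≡.cong (λ d → i ℤ.* j ℤ.* + d) (≡.sym (ℕ.+-identityʳ (suc n)))) ⟩
    ℚᵘ.mkℚᵘ (i ℤ.* j) n                                 ≈⟨ ℚ.toℚᵘ-fromℚᵘ (ℚᵘ.mkℚᵘ (i ℤ.* j) n) ⟨
    ℚ.toℚᵘ ((i ℤ.* j) ℚ./ suc n)                        ∎)
    where open import Relation.Binary.Reasoning.Setoid ℚᵘ.≃-setoid

  ι≡/1 : ∀ n → ι (+ n) ≡ + n ℚ./ 1
  ι≡/1 zero    = ≡.refl
  ι≡/1 (suc n) = ≡.trans (≡.cong (1ℚ ℚ.+_) (ι≡/1 n)) (/-+ (+ 1) (+ n))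

  ι*/ : ∀ m j n .{{_ : NonZero n}} → ι (+ m) ℚ.* (j ℚ./ n) ≡ (+ m ℤ.* j) ℚ./ n
  ι*/ m j n = ≡.trans (≡.cong (ℚ._* (j ℚ./ n)) (ι≡/1 m)) (/-* (+ m) j n)

  ι*1/ : ∀ n .{{_ : NonZero n}} → ι (+ n) ℚ.* (+ 1 ℚ./ n) ≡ 1ℚ
  ι*1/ n = ≡.trans (ι*/ n (+ 1) n) (/-≡ (+ n ℤ.* + 1) (+ 1) n 1 (≡.trans (ℤ.*-assoc (+ n) (+ 1) (+ 1)) (ℤ.*-comm (+ n) (+ 1))))

  1/!-suc : ∀ k → ι (+ suc k) ℚ.* 1/ suc k ! ≡ 1/ k !
  1/!-suc k = ≡.trans (ι*/ (suc k) (+ 1) (suc k !) {{suc k ℕ.!≢0}})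
    (/-≡ (+ suc k ℤ.* + 1) (+ 1) (suc k !) (k !) {{suc k ℕ.!≢0}} {{k ℕ.!≢0}}
      (≡.trans (≡.cong (ℤ._* + (k !)) (ℤ.*-identityʳ (+ suc k))) (≡.trans (≡.sym (ℤ.pos-* (suc k) (k !))) (≡.sym (ℤ.*-identityˡ _)))))

  cancel-invertible : ∀ i r {x y} → i ℚ.* r ≡ 1ℚ → i ℚ.* x ≡ i ℚ.* y → x ≡ y
  cancel-invertible i r {x} {y} ir≡1 eq = ≡.trans (≡.sym (undo x)) (≡.trans (≡.cong (r ℚ.*_) eq) (undo y))
    where
    undo : ∀ x → r ℚ.* (i ℚ.* x) ≡ x
    undo x = ≡.trans (≡.sym (ℚ.*-assoc r i x)) (≡.trans (≡.cong (ℚ._* x) (≡.trans (ℚ.*-comm r i) ir≡1)) (ℚ.*-identityˡ x))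

  ι-cancel : ∀ n {x y} → ι (+ suc n) ℚ.* x ≡ ι (+ suc n) ℚ.* y → x ≡ y
  ι-cancel n = cancel-invertible (ι (+ suc n)) (+ 1 ℚ./ suc n) (ι*1/ (suc n))

  0≤ι : ∀ n → 0ℚ ℚ.≤ ι (+ n)
  0≤ι zero    = ℚ.≤-refl
  0≤ι (suc n) = ℚ.≤-trans (ℚ.nonNegative⁻¹ 1ℚ) (≡.subst (ℚ._≤ 1ℚ ℚ.+ ι (+ n)) (ℚ.+-identityʳ 1ℚ) (ℚ.+-monoʳ-≤ 1ℚ (0≤ι n)))

  0<ι : ∀ n → 0ℚ ℚ.< ι (+ suc n)
  0<ι n = ℚ.<-≤-trans (ℚ.positive⁻¹ 1ℚ) (≡.subst (ℚ._≤ 1ℚ ℚ.+ ι (+ n)) (ℚ.+-identityʳ 1ℚ) (ℚ.+-monoʳ-≤ 1ℚ (0≤ι n)))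

  ι-mono : ∀ {m n} → m ℕ.≤ n → ι (+ m) ℚ.≤ ι (+ n)
  ι-mono {n = n} ℕ.z≤n   = 0≤ι n
  ι-mono (ℕ.s≤s m≤n) = ℚ.+-monoʳ-≤ 1ℚ (ι-mono m≤n)

  archimedes : ∀ q → ∃[ n ] q ℚ.≤ ι (+ n)
  archimedes q@(mkℚ i d _) = ℤ.∣ i ∣ , ≡.subst (q ℚ.≤_) (≡.sym (ι≡/1 ℤ.∣ i ∣)) (ℚ.toℚᵘ-cancel-≤
    (ℚᵘ.≤-respʳ-≃ (ℚᵘ.≃-sym (ℚ.toℚᵘ-fromℚᵘ (ℚᵘ.mkℚᵘ (+ ℤ.∣ i ∣) 0))) (ℚᵘ.*≤* (le i))))
    where
    le : ∀ i → i ℤ.* + 1 ℤ.≤ + ℤ.∣ i ∣ ℤ.* + suc d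
    le (+ n)    = ≡.subst₂ ℤ._≤_ (≡.sym (ℤ.*-identityʳ (+ n))) (ℤ.pos-* n (suc d)) (ℤ.+≤+ (ℕ.m≤m*n n (suc d)))
    le -[1+ n ] = ≡.subst (ℤ._≤ + suc n ℤ.* + suc d) (≡.sym (ℤ.*-identityʳ -[1+ n ])) ℤ.-≤+

  0≤-* : ∀ {p q} → 0ℚ ℚ.≤ p → 0ℚ ℚ.≤ q → 0ℚ ℚ.≤ p ℚ.* q
  0≤-* {p} {q} 0≤p 0≤q = ≡.subst (ℚ._≤ p ℚ.* q) (ℚ.*-zeroʳ p) (ℚ.*-monoˡ-≤-nonNeg p {{ℚ.nonNegative 0≤p}} 0≤q)

  0≤-+ : ∀ {p q} → 0ℚ ℚ.≤ p → 0ℚ ℚ.≤ q → 0ℚ ℚ.≤ p ℚ.+ q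
  0≤-+ {p} {q} 0≤p 0≤q = ≡.subst (ℚ._≤ p ℚ.+ q) (ℚ.+-identityʳ 0ℚ) (ℚ.+-mono-≤ 0≤p 0≤q)

  p≤p+q : ∀ p {q} → 0ℚ ℚ.≤ q → p ℚ.≤ p ℚ.+ q
  p≤p+q p {q} 0≤q = ≡.subst (ℚ._≤ p ℚ.+ q) (ℚ.+-identityʳ p) (ℚ.+-monoʳ-≤ p 0≤q)

  +-cancel-≤ : ∀ p {q r} → p ℚ.+ q ℚ.≤ p ℚ.+ r → q ℚ.≤ r
  +-cancel-≤ p {q} {r} h = ≡.subst₂ ℚ._≤_ (solve 2 (λ p q → (:- p) :+ (p :+ q) := q) ≡.refl p q)
    (solve 2 (λ p r → (:- p) :+ (p :+ r) := r) ≡.refl p r) (ℚ.+-monoʳ-≤ (ℚ.- p) h)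
    where open ℚ-Solver

  *-mono-≤ : ∀ {p q r s} → 0ℚ ℚ.≤ p → 0ℚ ℚ.≤ r → p ℚ.≤ q → r ℚ.≤ s → p ℚ.* r ℚ.≤ q ℚ.* s
  *-mono-≤ {p} {q} {r} {s} 0≤p 0≤r p≤q r≤s = ℚ.≤-trans (ℚ.*-monoˡ-≤-nonNeg p {{ℚ.nonNegative 0≤p}} r≤s)
    (ℚ.*-monoʳ-≤-nonNeg s {{ℚ.nonNegative (ℚ.≤-trans 0≤r r≤s)}} p≤q)

  open ℚS hiding (module Exponential)
  module ℚE = ℚS.Exponential 1/_! ≡.refl 1/!-suc ι-cancel

  0≤1/! : ∀ k → 0ℚ ℚ.≤ 1/ k !
  0≤1/! k = ℚ.nonNegative⁻¹ (1/ k !) {{ℚ.normalize-nonNeg 1 (k !) {{k ℕ.!≢0}}}}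

  0≤psum : ∀ {f} → (∀ k → 0ℚ ℚ.≤ f k) → ∀ K → 0ℚ ℚ.≤ psum f K
  0≤psum h zero    = ℚ.≤-refl
  0≤psum h (suc K) = 0≤-+ (0≤psum h K) (h K)

  psum-≤ : ∀ {f} → (∀ k → 0ℚ ℚ.≤ f k) → ∀ K a → psum f K ℚ.≤ psum f (K ℕ.+ a)
  psum-≤ {f} h K a = ≡.subst (psum f K ℚ.≤_) (≡.sym (psum-append f K a)) (p≤p+q (psum f K) (0≤psum (h ∘ (K ℕ.+_)) a))

  -- Every index pair of the K by b rectangle satisfies i + j < K + b, and the terms are
  -- nonnegative.
  product≤tri : ∀ {f g} → (∀ k → 0ℚ ℚ.≤ f k) → (∀ k → 0ℚ ℚ.≤ g k) → ∀ K b →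
                psum f K ℚ.* psum g b ℚ.≤ tri f g (K ℕ.+ b)
  product≤tri {f} {g} hf hg zero b = ≡.subst (ℚ._≤ tri f g b) (≡.sym (ℚ.*-zeroˡ (psum g b))) (0≤tri hf b)
    where
    0≤tri : ∀ {f} → (∀ k → 0ℚ ℚ.≤ f k) → ∀ b → 0ℚ ℚ.≤ tri f g b
    0≤tri hf zero    = ℚ.≤-refl
    0≤tri hf (suc b) = 0≤-+ (0≤-* (hf 0) (0≤psum hg (suc b))) (0≤tri (hf ∘ suc) b)
  product≤tri {f} {g} hf hg (suc K) b = begin
    psum f (suc K) ℚ.* psum g b                                   ≡⟨ ≡.cong (ℚ._* psum g b) (psum-head f K) ⟩
    (f 0 ℚ.+ psum (f ∘ suc) K) ℚ.* psum g b                       ≡⟨ ℚ.*-distribʳ-+ (psum g b) (f 0) _ ⟩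
    f 0 ℚ.* psum g b ℚ.+ psum (f ∘ suc) K ℚ.* psum g b            ≤⟨ ℚ.+-mono-≤ (ℚ.*-monoˡ-≤-nonNeg (f 0) {{ℚ.nonNegative (hf 0)}} more)
                                                                      (product≤tri (hf ∘ suc) hg K b) ⟩
    tri f g (suc K ℕ.+ b)                                         ∎
    where
    open ℚ.≤-Reasoning
    more : psum g b ℚ.≤ psum g (suc K ℕ.+ b)
    more = ≡.subst (λ n → psum g b ℚ.≤ psum g n) (ℕ.+-comm b (suc K)) (psum-≤ hg b (suc K))

  module _ (C : ℚ) (0≤C : 0ℚ ℚ.≤ C) where

    t : ℕ → ℚ
    t = ℚE.term C

    0≤pow : ∀ k → 0ℚ ℚ.≤ C ℚP.^ k
    0≤pow zero    = ℚ.nonNegative⁻¹ 1ℚ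
    0≤pow (suc k) = 0≤-* 0≤C (0≤pow k)

    0≤t : ∀ k → 0ℚ ℚ.≤ t k
    0≤t k = 0≤-* (0≤1/! k) (0≤pow k)

    t-halves : ∀ k → C ℚ.+ C ℚ.≤ ι (+ suc k) → t (suc k) ℚ.+ t (suc k) ℚ.≤ t k
    t-halves k 2C≤ = ℚ.*-cancelˡ-≤-pos i {{ℚ.positive (0<ι k)}} (begin
      i ℚ.* (t (suc k) ℚ.+ t (suc k))           ≡⟨ ℚ.*-distribˡ-+ i (t (suc k)) (t (suc k)) ⟩
      i ℚ.* t (suc k) ℚ.+ i ℚ.* t (suc k)       ≡⟨ ≡.cong₂ ℚ._+_ (ℚE.term-suc C k) (ℚE.term-suc C k) ⟩
      C ℚ.* t k ℚ.+ C ℚ.* t k                   ≡⟨ ℚ.*-distribʳ-+ (t k) C C ⟨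
      (C ℚ.+ C) ℚ.* t k                         ≤⟨ ℚ.*-monoʳ-≤-nonNeg (t k) {{ℚ.nonNegative (0≤t k)}} 2C≤ ⟩
      i ℚ.* t k                                 ∎)
      where
      open ℚ.≤-Reasoning
      i = ι (+ suc k)

    -- When terms at least halve, twice the next term covers everything that follows. Carrying this
    -- reserve on the left makes the induction go through.
    psum-tail : ∀ K → C ℚ.+ C ℚ.≤ ι (+ suc K) → ∀ a →
                psum (t ∘ (K ℕ.+_)) a ℚ.+ (t (K ℕ.+ a) ℚ.+ t (K ℕ.+ a)) ℚ.≤ t K ℚ.+ t K
    psum-tail K 2C≤ zero    = ℚ.≤-reflexive (≡.trans (ℚ.+-identityˡ _) (≡.cong (λ k → t k ℚ.+ t k) (ℕ.+-identityʳ K)))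
    psum-tail K 2C≤ (suc a) = begin
      s ℚ.+ u ℚ.+ (t (K ℕ.+ suc a) ℚ.+ t (K ℕ.+ suc a))    ≡⟨ ≡.cong (λ k → s ℚ.+ u ℚ.+ (t k ℚ.+ t k)) (ℕ.+-suc K a) ⟩
      s ℚ.+ u ℚ.+ (t (suc (K ℕ.+ a)) ℚ.+ t (suc (K ℕ.+ a))) ≤⟨ ℚ.+-monoʳ-≤ (s ℚ.+ u) (t-halves (K ℕ.+ a) (ℚ.≤-trans 2C≤ (ι-mono (ℕ.s≤s (ℕ.m≤m+n K a))))) ⟩
      s ℚ.+ u ℚ.+ u                                         ≡⟨ ℚ.+-assoc s u u ⟩
      s ℚ.+ (u ℚ.+ u)                                       ≤⟨ psum-tail K 2C≤ a ⟩
      t K ℚ.+ t K                                           ∎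
      where
      open ℚ.≤-Reasoning
      s = psum (t ∘ (K ℕ.+_)) a
      u = t (K ℕ.+ a)

    psum-bound : ∀ K → C ℚ.+ C ℚ.≤ ι (+ suc K) → ∀ a → psum t (K ℕ.+ a) ℚ.≤ psum t K ℚ.+ (t K ℚ.+ t K)
    psum-bound K 2C≤ a = ≡.subst (ℚ._≤ psum t K ℚ.+ (t K ℚ.+ t K)) (≡.sym (psum-append t K a))
      (ℚ.+-monoʳ-≤ (psum t K) (ℚ.≤-trans (p≤p+q _ (0≤-+ (0≤t (K ℕ.+ a)) (0≤t (K ℕ.+ a)))) (psum-tail K 2C≤ a)))

    t-antitone : ∀ J → C ℚ.+ C ℚ.≤ ι (+ suc J) → ∀ a → t (J ℕ.+ a) ℚ.≤ t J ℚ.+ t J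
    t-antitone J 2C≤ a = ℚ.≤-trans (p≤p+q (t (J ℕ.+ a)) (0≤t (J ℕ.+ a)))
      (ℚ.≤-trans (≡.subst (u ℚ.≤_) (ℚ.+-comm u s) (p≤p+q u (0≤psum (λ k → 0≤t (J ℕ.+ k)) a))) (psum-tail J 2C≤ a))
      where
      u = t (J ℕ.+ a) ℚ.+ t (J ℕ.+ a)
      s = psum (t ∘ (J ℕ.+_)) a

    t-small : ∀ ε → 0ℚ ℚ.< ε → Eventually λ k → t k ℚ.+ t k ℚ.< ε
    t-small ε 0<ε = suc (J ℕ.+ M) , λ { (suc k) (ℕ.s≤s le) → small k (ℕ.≤-trans (ℕ.m≤m+n J M) le) (ℕ.≤-trans (ℕ.m≤n+m M J) le) }
      where
      open ℚ.≤-Reasoning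
      J = proj₁ (archimedes (C ℚ.+ C))
      2C≤J : C ℚ.+ C ℚ.≤ ι (+ suc J)
      2C≤J = ℚ.≤-trans (proj₂ (archimedes (C ℚ.+ C))) (ι-mono (ℕ.n≤1+n J))
      instance
        ε≢0 : ℚ.NonZero ε
        ε≢0 = ℚ.pos⇒nonZero ε {{ℚ.positive 0<ε}}
      -- Here (k+1) t(k+1) = C t(k), and t(k) ≤ 2 t(J) from J on, so D bounds (k+1) times twice the
      -- next term; M is chosen with D ≤ M ε.
      D = C ℚ.* (t J ℚ.+ t J) ℚ.+ C ℚ.* (t J ℚ.+ t J)
      M = proj₁ (archimedes (D ℚ.* ℚ.1/ ε))
      D≤Mε : D ℚ.≤ ι (+ M) ℚ.* ε
      D≤Mε = begin
        D                          ≡⟨ ≡.trans (ℚ.*-assoc D (ℚ.1/ ε) ε) (≡.trans (≡.cong (D ℚ.*_) (ℚ.*-inverseˡ ε)) (ℚ.*-identityʳ D)) ⟨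
        D ℚ.* ℚ.1/ ε ℚ.* ε         ≤⟨ ℚ.*-monoʳ-≤-nonNeg ε {{ℚ.nonNegative (ℚ.<⇒≤ 0<ε)}} (proj₂ (archimedes (D ℚ.* ℚ.1/ ε))) ⟩
        ι (+ M) ℚ.* ε              ∎
      small : ∀ k → J ℕ.≤ k → M ℕ.≤ k → t (suc k) ℚ.+ t (suc k) ℚ.< ε
      small k J≤k M≤k = ℚ.*-cancelˡ-<-nonNeg i {{ℚ.nonNegative (0≤ι (suc k))}} (begin-strict
        i ℚ.* (t (suc k) ℚ.+ t (suc k))           ≡⟨ ℚ.*-distribˡ-+ i (t (suc k)) (t (suc k)) ⟩
        i ℚ.* t (suc k) ℚ.+ i ℚ.* t (suc k)       ≡⟨ ≡.cong₂ ℚ._+_ (ℚE.term-suc C k) (ℚE.term-suc C k) ⟩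
        C ℚ.* t k ℚ.+ C ℚ.* t k                   ≤⟨ ℚ.+-mono-≤ Ct≤ Ct≤ ⟩
        D                                         ≤⟨ D≤Mε ⟩
        ι (+ M) ℚ.* ε                             ≤⟨ ℚ.*-monoʳ-≤-nonNeg ε {{ℚ.nonNegative (ℚ.<⇒≤ 0<ε)}} (ι-mono M≤k) ⟩
        ι (+ k) ℚ.* ε                             <⟨ ℚ.*-monoˡ-<-pos ε {{ℚ.positive 0<ε}} k<1+k ⟩
        i ℚ.* ε                                   ∎)
        where
        i = ι (+ suc k)
        k<1+k : ι (+ k) ℚ.< ι (+ suc k)
        k<1+k = ≡.subst (ℚ._< 1ℚ ℚ.+ ι (+ k)) (ℚ.+-identityˡ (ι (+ k))) (ℚ.+-monoˡ-< (ι (+ k)) (ℚ.positive⁻¹ 1ℚ))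
        Ct≤ : C ℚ.* t k ℚ.≤ C ℚ.* (t J ℚ.+ t J)
        Ct≤ = ℚ.*-monoˡ-≤-nonNeg C {{ℚ.nonNegative 0≤C}} (≡.subst (λ k → t k ℚ.≤ t J ℚ.+ t J) (ℕ.m+[n∸m]≡n J≤k) (t-antitone J 2C≤J (k ℕ.∸ J)))

    tail-small : ∀ ε → 0ℚ ℚ.< ε → Eventually λ K → ∀ a → psum (t ∘ (K ℕ.+_)) a ℚ.< ε
    tail-small ε 0<ε = ev-zip bound (proj₁ (archimedes (C ℚ.+ C)) , λ K le → ℚ.≤-trans (proj₂ (archimedes (C ℚ.+ C))) (ι-mono (ℕ.≤-trans le (ℕ.n≤1+n K))))
      (t-small ε 0<ε)
      where
      bound : ∀ K → C ℚ.+ C ℚ.≤ ι (+ suc K) → t K ℚ.+ t K ℚ.< ε → ∀ a → psum (t ∘ (K ℕ.+_)) a ℚ.< ε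
      bound K 2C≤ lt a = ℚ.≤-<-trans (ℚ.≤-trans (p≤p+q _ (0≤-+ (0≤t (K ℕ.+ a)) (0≤t (K ℕ.+ a)))) (psum-tail K 2C≤ a)) lt

  -- The K by K square lies in the triangle i + j < 2K, whose sum is a partial sum for C + C.
  -- Subtracting the triangle i + j < K leaves a piece of the tail of that series.
  rest-small : ∀ C (0≤C : 0ℚ ℚ.≤ C) ε → 0ℚ ℚ.< ε → Eventually λ K → rest (ℚE.term C) (ℚE.term C) 0 K ℚ.< ε
  rest-small C 0≤C ε 0<ε = ev-map bound (tail-small (C ℚ.+ C) (0≤-+ 0≤C 0≤C) ε 0<ε)
    where
    open ℚ.≤-Reasoning
    T = ℚE.term (C ℚ.+ C)
    e = psum (ℚE.term C)
    bound : ∀ K → (∀ a → psum (T ∘ (K ℕ.+_)) a ℚ.< ε) → rest (ℚE.term C) (ℚE.term C) 0 K ℚ.< ε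
    bound K small = ℚ.≤-<-trans (+-cancel-≤ (psum T K) (begin
      psum T K ℚ.+ rest (ℚE.term C) (ℚE.term C) 0 K       ≡⟨ ℚE.product-of-sums C C K ⟨
      e K ℚ.* e K                                         ≤⟨ product≤tri (0≤t C 0≤C) (0≤t C 0≤C) K K ⟩
      tri (ℚE.term C) (ℚE.term C) (K ℕ.+ K)               ≡⟨ ≡.trans (tri≈psum-conv (ℚE.term C) (ℚE.term C) (K ℕ.+ K)) (psum-cong (ℚE.conv-term C C) (K ℕ.+ K)) ⟩
      psum T (K ℕ.+ K)                                    ≡⟨ psum-append T K K ⟩
      psum T K ℚ.+ psum (T ∘ (K ℕ.+_)) K                  ∎)) (small K)

open RationalExponential

-- The complex exponential function

module ComplexExponential where

  module ℂR = CommutativeRing ℂ-ring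
  module ℂP = PowerSums ℂ-ring
  module ℂS = Series ℂ-ring

  δ : ℕ → ℚ
  δ k = + 1 ℚ./ suc k

  δ-small : ∀ ε → 0ℚ ℚ.< ε → Eventually λ k → δ k ℚ.< ε
  δ-small ε 0<ε = M , λ k M≤k → ℚ.*-cancelˡ-<-nonNeg (ι (+ suc k)) {{ℚ.nonNegative (0≤ι (suc k))}} (begin-strict
    ι (+ suc k) ℚ.* δ k        ≡⟨ ι*1/ (suc k) ⟩
    1ℚ                         ≡⟨ ℚ.*-inverseˡ ε ⟨
    ℚ.1/ ε ℚ.* ε               ≤⟨ ℚ.*-monoʳ-≤-nonNeg ε {{ℚ.nonNegative (ℚ.<⇒≤ 0<ε)}} (ℚ.≤-trans (proj₂ (archimedes (ℚ.1/ ε))) (ι-mono M≤k)) ⟩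
    ι (+ k) ℚ.* ε              <⟨ ℚ.*-monoˡ-<-pos ε {{ℚ.positive 0<ε}}
                                    (≡.subst (ℚ._< 1ℚ ℚ.+ ι (+ k)) (ℚ.+-identityˡ (ι (+ k))) (ℚ.+-monoˡ-< (ι (+ k)) (ℚ.positive⁻¹ 1ℚ))) ⟩
    ι (+ suc k) ℚ.* ε          ∎)
    where
    open ℚ.≤-Reasoning
    instance
      ε≢0 : ℚ.NonZero ε
      ε≢0 = ℚ.pos⇒nonZero ε {{ℚ.positive 0<ε}}
    M = proj₁ (archimedes (ℚ.1/ ε))

  0<δ : ∀ k → 0ℚ ℚ.< δ k
  0<δ k = ℚ.positive⁻¹ (δ k) {{ℚ.normalize-pos 1 (suc k)}}

  -- Supplies values of the exponential that no hypothesis provides, such as the root of unity ζ.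
  -- `diagonal k` is a term of `a k` beyond which `a k` varies by less than 1/(k+1).
  module Completeness (a : ℕ → ℝ) (a-cauchy : ∀ ε → 0ℚ ℚ.< ε → Eventually λ K → ∀ b → Near (a (K ℕ.+ b)) (a K) ε) where

    private
      index : ℕ → ℕ
      index k = proj₁ (cauchy (a k) (δ k) (0<δ k))

      diagonal : ℕ → ℚ
      diagonal k = seq (a k) (index k)

      diagonal-close : ∀ k n → index k ℕ.≤ n → ∣ seq (a k) n ℚ.- diagonal k ∣ ℚ.< δ k
      diagonal-close k n le = proj₂ (cauchy (a k) (δ k) (0<δ k)) n (index k) le ℕ.≤-refl

      Close : ℚ → ℕ → Set
      Close ε k = ∀ l → k ℕ.≤ l → ∃[ n₀ ] (∀ n → n₀ ℕ.≤ n → ∣ seq (a k) n ℚ.- diagonal l ∣ ℚ.< ε)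

      close : ∀ ε → 0ℚ ℚ.< ε → Eventually (Close ε)
      close ε 0<ε = let K , ca = a-cauchy (½ ℚ.* ε) (0<½* 0<ε)
                        M , small = δ-small (½ ℚ.* ε) (0<½* 0<ε)
                    in K ℕ.⊔ M , λ k le l k≤l →
        let K≤k = ℕ.m⊔n≤o⇒m≤o K M le
            M≤l = ℕ.≤-trans (ℕ.m⊔n≤o⇒n≤o K M le) k≤l
            n₁ , near = ca k K≤k (l ℕ.∸ k)
            near′ : ∀ n → n₁ ℕ.≤ n → ∣ seq (a k) n ℚ.- seq (a l) n ∣ ℚ.< ½ ℚ.* ε
            near′ n le′ = ≡.subst (λ m → ∣ seq (a k) n ℚ.- seq (a m) n ∣ ℚ.< ½ ℚ.* ε) (ℕ.m+[n∸m]≡n k≤l)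
              (≡.subst (ℚ._< ½ ℚ.* ε) (∣-∣-comm (seq (a (k ℕ.+ (l ℕ.∸ k))) n) (seq (a k) n)) (near n le′))
        in n₁ ℕ.⊔ index l , λ n le′ → ≡.subst (∣ seq (a k) n ℚ.- diagonal l ∣ ℚ.<_) (½+½ ε)
             (∣-∣-triangle (seq (a k) n) (seq (a l) n) (diagonal l) (near′ n (ℕ.m⊔n≤o⇒m≤o n₁ (index l) le′))
               (ℚ.<-trans (diagonal-close l n (ℕ.m⊔n≤o⇒n≤o n₁ (index l) le′)) (small l M≤l)))

      diagonal-cauchy : IsCauchy diagonal
      diagonal-cauchy ε 0<ε = let K , cl = close (½ ℚ.* ε) (0<½* 0<ε) in
        K , λ m n K≤m K≤n →
          let n₁ , h₁ = cl K ℕ.≤-refl m K≤m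
              n₂ , h₂ = cl K ℕ.≤-refl n K≤n
              i = n₁ ℕ.⊔ n₂
          in ≡.subst (∣ diagonal m ℚ.- diagonal n ∣ ℚ.<_) (½+½ ε)
               (∣-∣-triangle (diagonal m) (seq (a K) i) (diagonal n)
                 (≡.subst (ℚ._< ½ ℚ.* ε) (∣-∣-comm (seq (a K) i) (diagonal m)) (h₁ i (ℕ.m≤m⊔n n₁ n₂))) (h₂ i (ℕ.m≤n⊔m n₁ n₂)))

    limit : ℝ
    limit = mkℝ diagonal diagonal-cauchy

    limit-lim : Lim a limit
    limit-lim = mkLim λ ε 0<ε → let K , cl = close (½ ℚ.* ε) (0<½* 0<ε)
                                    M , ca = diagonal-cauchy (½ ℚ.* ε) (0<½* 0<ε)
      in K ℕ.⊔ M , λ k le →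
        let n₁ , h = cl k (ℕ.m⊔n≤o⇒m≤o K M le) k ℕ.≤-refl
            M≤k = ℕ.m⊔n≤o⇒n≤o K M le
        in n₁ ℕ.⊔ M , λ n le′ → ≡.subst (∣ seq (a k) n ℚ.- diagonal n ∣ ℚ.<_) (½+½ ε)
             (∣-∣-triangle (seq (a k) n) (diagonal k) (diagonal n) (h n (ℕ.m⊔n≤o⇒m≤o n₁ M le′))
               (ca k n M≤k (ℕ.m⊔n≤o⇒n≤o n₁ M le′)))

  emb : ℚ → ℂ
  emb q = fr q +i 𝟘


  ιℂ≋emb : ∀ n → ιℂ (+ n) ≋ℂ emb (ι (+ n))
  ιℂ≋emb zero    = ℂR.refl
  ιℂ≋emb (suc n) = ℝR.trans (ℝR.+-congˡ {𝟙} (re≋ (ιℂ≋emb n))) (ℝR.sym (fr-+ 1ℚ (ι (+ n)))) ∥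
    ℝR.trans (ℝR.+-congˡ {𝟘} (im≋ (ιℂ≋emb n))) (ℝR.+-identityˡ 𝟘)

  emb-* : ∀ p q → emb p ⊗ᶜ emb q ≋ℂ emb (p ℚ.* q)
  emb-* p q = ℝR.trans (ℝ-Identities.re-real (fr p) (fr q)) (ℝR.sym (fr-* p q)) ∥ ℝ-Identities.im-real (fr p) (fr q)

  emb-1/!-suc : ∀ k → ιℂ (+ suc k) ⊗ᶜ emb (1/ suc k !) ≋ℂ emb (1/ k !)
  emb-1/!-suc k = ℂR.trans (ℂR.*-congʳ {emb (1/ suc k !)} (ιℂ≋emb (suc k)))
    (ℂR.trans (emb-* (ι (+ suc k)) (1/ suc k !)) (ℂR.reflexive (≡.cong emb (1/!-suc k))))

  ιℂ-cancel : ∀ n {z w} → ιℂ (+ suc n) ⊗ᶜ z ≋ℂ ιℂ (+ suc n) ⊗ᶜ w → z ≋ℂ w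
  ιℂ-cancel n {z} {w} h = x-y≈0⇒x≈y (CharZeroDomain.torsionFree ℂ-domain n (z ⊕ᶜ ⊝ᶜ w)
    (ℂR.trans (ℂR.distribˡ (ιℂ (+ suc n)) z (⊝ᶜ w)) (ℂR.trans (ℂR.+-congˡ {ιℂ (+ suc n) ⊗ᶜ z} (ℂR.sym (-‿distribʳ-* (ιℂ (+ suc n)) w))) (x≈y⇒x-y≈0 h))))
    where
    open Galois ℂ-domain
    open ℂP using (-‿distribʳ-*)

  module ℂE = ℂS.Exponential (λ k → emb (1/ k !)) ℂR.refl emb-1/!-suc ιℂ-cancel

  open ℂS using (psum; psum-cong; psum-append; rest)
  open ℂE using (term)
  open ℂP using (_^_)

  record IsE (z w : ℂ) : Set where
    constructor mkIsE
    field
      re-lim : Lim (λ K → re (psum (term z) K)) (re w)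
      im-lim : Lim (λ K → im (psum (term z) K)) (im w)

  open IsE public

  isE-cong : ∀ {z z′ w w′} → z ≋ℂ z′ → w ≋ℂ w′ → IsE z w → IsE z′ w′
  isE-cong {z} {z′} z≋ w≋ (mkIsE p q) = mkIsE (lim-resp (re≋ w≋) (lim-≋ (λ K → re≋ (sums K)) p)) (lim-resp (im≋ w≋) (lim-≋ (λ K → im≋ (sums K)) q))
    where
    sums : ∀ K → psum (term z) K ≋ℂ psum (term z′) K
    sums = psum-cong λ k → ℂE.term-cong k z≋

  isE-unique : ∀ {z w w′} → IsE z w → IsE z w′ → w ≋ℂ w′
  isE-unique (mkIsE p q) (mkIsE p′ q′) = lim-unique p p′ ∥ lim-unique q q′

  record Bdᶜ (z : ℂ) (q : ℚ) : Set where
    constructor _∥_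
    field
      re-bd : Bd (re z) q
      im-bd : Bd (im z) q

  open Bdᶜ

  bdᶜ-resp : ∀ {z q r} → q ≡ r → Bdᶜ z q → Bdᶜ z r
  bdᶜ-resp ≡.refl h = h

  bdᶜ-⊕ : ∀ {z w q r} → Bdᶜ z q → Bdᶜ w r → Bdᶜ (z ⊕ᶜ w) (q ℚ.+ r)
  bdᶜ-⊕ (a ∥ b) (c ∥ d) = bd-⊕ a c ∥ bd-⊕ b d

  bdᶜ-⊗ : ∀ {z w q r} → Bdᶜ z q → Bdᶜ w r → Bdᶜ (z ⊗ᶜ w) (q ℚ.* r ℚ.+ q ℚ.* r)
  bdᶜ-⊗ (a ∥ b) (c ∥ d) = bd-⊕ (bd-⊗ a c) (bd-⊝ (bd-⊗ b d)) ∥ bd-⊕ (bd-⊗ a d) (bd-⊗ b c)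

  bdᶜ-emb-⊗ : ∀ {z q} r → 0ℚ ℚ.≤ r → Bdᶜ z q → Bdᶜ (emb r ⊗ᶜ z) (r ℚ.* q)
  bdᶜ-emb-⊗ {z} {q} r 0≤r (a ∥ b) = bdᶜ-resp simplify
    (bd-⊕ (bd-⊗ (bd-fr 0≤r) a) (bd-⊝ (bd-⊗ (bd-fr ℚ.≤-refl) b)) ∥ bd-⊕ (bd-⊗ (bd-fr 0≤r) b) (bd-⊗ (bd-fr ℚ.≤-refl) a))
    where
    simplify : r ℚ.* q ℚ.+ 0ℚ ℚ.* q ≡ r ℚ.* q
    simplify = ≡.trans (≡.cong (r ℚ.* q ℚ.+_) (ℚ.*-zeroˡ q)) (ℚ.+-identityʳ (r ℚ.* q))

  bdᶜ-psum : ∀ {f f̄} → (∀ k → Bdᶜ (f k) (f̄ k)) → ∀ K → Bdᶜ (psum f K) (ℚS.psum f̄ K)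
  bdᶜ-psum h zero    = bd-fr ℚ.≤-refl ∥ bd-fr ℚ.≤-refl
  bdᶜ-psum h (suc K) = bdᶜ-⊕ (bdᶜ-psum h K) (h K)

  bdᶜ-rest : ∀ {f g f̄ ḡ} → (∀ k → Bdᶜ (f k) (f̄ k)) → (∀ k → Bdᶜ (g k) (ḡ k)) →
             ∀ a K → Bdᶜ (rest f g a K) (ℚS.rest f̄ ḡ a K ℚ.+ ℚS.rest f̄ ḡ a K)
  bdᶜ-rest hf hg a zero    = bdᶜ-resp (≡.sym (ℚ.+-identityˡ 0ℚ)) (bd-fr ℚ.≤-refl ∥ bd-fr ℚ.≤-refl)
  bdᶜ-rest {f} {g} {f̄} {ḡ} hf hg a (suc K) = bdᶜ-resp
    (solve 2 (λ x r → (x :+ x) :+ (r :+ r) := (x :+ r) :+ (x :+ r)) ≡.refl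
      (f̄ 0 ℚ.* ℚS.psum (ḡ ∘ (suc K ℕ.+_)) a) (ℚS.rest (f̄ ∘ suc) ḡ (suc a) K))
    (bdᶜ-⊕ (bdᶜ-⊗ (hf 0) (bdᶜ-psum (hg ∘ (suc K ℕ.+_)) a)) (bdᶜ-rest (hf ∘ suc) hg (suc a) K))
    where open ℚ-Solver

  -- A complex product doubles the bound on the components, whence the base C + C.
  bdᶜ-^ : ∀ {z C} → Bdᶜ z C → ∀ k → Bdᶜ (z ^ k) ((C ℚ.+ C) ℚP.^ k)
  bdᶜ-^ h zero    = bd-fr (ℚ.nonNegative⁻¹ 1ℚ) ∥ bd-weaken (ℚ.nonNegative⁻¹ 1ℚ) (bd-fr ℚ.≤-refl)
  bdᶜ-^ {C = C} h (suc k) = bdᶜ-resp (≡.sym (ℚ.*-distribʳ-+ ((C ℚ.+ C) ℚP.^ k) C C)) (bdᶜ-⊗ h (bdᶜ-^ h k))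

  bdᶜ-term : ∀ {z C} → Bdᶜ z C → ∀ k → Bdᶜ (term z k) (ℚE.term (C ℚ.+ C) k)
  bdᶜ-term h k = bdᶜ-emb-⊗ (1/ k !) (0≤1/! k) (bdᶜ-^ h k)

  bdᶜ-exists : ∀ z → ∃[ C ] (0ℚ ℚ.≤ C × Bdᶜ z C)
  bdᶜ-exists z = let p , 0≤p , hp = bd-exists (re z)
                     q , 0≤q , hq = bd-exists (im z)
    in p ℚ.+ q , 0≤-+ 0≤p 0≤q , (bd-weaken (p≤p+q p 0≤q) hp ∥ bd-weaken (≡.subst (q ℚ.≤_) (ℚ.+-comm q p) (p≤p+q q 0≤p)) hq)

  -- The product of the partial sums differs from the partial sum for z + w by `rest`, which is
  -- dominated by its rational counterpart and tends to 0.
  isE-⊕ : ∀ {z w u v} → IsE z u → IsE w v → IsE (z ⊕ᶜ w) (u ⊗ᶜ v)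
  isE-⊕ {z} {w} {u} {v} (mkIsE p q) (mkIsE r s) = mkIsE
    (lim-close (λ ε 0<ε → ev-map (λ K lt → near-bd (re≋ (ℂE.product-of-sums z w K)) (re-bd (bound K)) (half lt)) (small (½ ℚ.* ε) (0<½* 0<ε)))
      (lim-⊕ (lim-⊗ p r) (lim-⊝ (lim-⊗ q s))))
    (lim-close (λ ε 0<ε → ev-map (λ K lt → near-bd (im≋ (ℂE.product-of-sums z w K)) (im-bd (bound K)) (half lt)) (small (½ ℚ.* ε) (0<½* 0<ε)))
      (lim-⊕ (lim-⊗ p s) (lim-⊗ q r)))
    where
    Cz = bdᶜ-exists z
    Cw = bdᶜ-exists w
    C = proj₁ Cz ℚ.+ proj₁ Cw
    0≤C : 0ℚ ℚ.≤ C
    0≤C = 0≤-+ (proj₁ (proj₂ Cz)) (proj₁ (proj₂ Cw))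
    bd-z : Bdᶜ z C
    bd-z = let a ∥ b = proj₂ (proj₂ Cz) ; le = p≤p+q (proj₁ Cz) (proj₁ (proj₂ Cw)) in bd-weaken le a ∥ bd-weaken le b
    bd-w : Bdᶜ w C
    bd-w = let a ∥ b = proj₂ (proj₂ Cw)
               le = ≡.subst (proj₁ Cw ℚ.≤_) (ℚ.+-comm (proj₁ Cw) (proj₁ Cz)) (p≤p+q (proj₁ Cw) (proj₁ (proj₂ Cz)))
           in bd-weaken le a ∥ bd-weaken le b
    R : ℕ → ℚ
    R = ℚS.rest (ℚE.term (C ℚ.+ C)) (ℚE.term (C ℚ.+ C)) 0
    bound : ∀ K → Bdᶜ (rest (term z) (term w) 0 K) (R K ℚ.+ R K)
    bound = bdᶜ-rest (bdᶜ-term bd-z) (bdᶜ-term bd-w) 0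
    small : ∀ ε → 0ℚ ℚ.< ε → Eventually λ K → R K ℚ.< ε
    small = rest-small (C ℚ.+ C) (0≤-+ 0≤C 0≤C)
    half : ∀ {r ε} → r ℚ.< ½ ℚ.* ε → r ℚ.+ r ℚ.< ε
    half {r} {ε} lt = ≡.subst (r ℚ.+ r ℚ.<_) (½+½ ε) (ℚ.+-mono-< lt lt)

  isE-exists : ∀ z → ∃[ w ] IsE z w
  isE-exists z = Re.limit +i Im.limit , mkIsE Re.limit-lim Im.limit-lim
    where
    Cz = bdᶜ-exists z
    C = proj₁ Cz ℚ.+ proj₁ Cz
    0≤C : 0ℚ ℚ.≤ C
    0≤C = 0≤-+ (proj₁ (proj₂ Cz)) (proj₁ (proj₂ Cz))
    bound : ∀ K b → Bdᶜ (psum (term z ∘ (K ℕ.+_)) b) (ℚS.psum (ℚE.term C ∘ (K ℕ.+_)) b)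
    bound K = bdᶜ-psum (bdᶜ-term (proj₂ (proj₂ Cz)) ∘ (K ℕ.+_))
    re-cauchy : ∀ ε → 0ℚ ℚ.< ε → Eventually λ K → ∀ b → Near (re (psum (term z) (K ℕ.+ b))) (re (psum (term z) K)) ε
    re-cauchy ε 0<ε = ev-map (λ K lt b → near-bd (re≋ (psum-append (term z) K b)) (re-bd (bound K b)) (lt b)) (tail-small C 0≤C ε 0<ε)
    im-cauchy : ∀ ε → 0ℚ ℚ.< ε → Eventually λ K → ∀ b → Near (im (psum (term z) (K ℕ.+ b))) (im (psum (term z) K)) ε
    im-cauchy ε 0<ε = ev-map (λ K lt b → near-bd (im≋ (psum-append (term z) K b)) (im-bd (bound K b)) (lt b)) (tail-small C 0≤C ε 0<ε)
    module Re = Completeness (λ K → re (psum (term z) K)) re-cauchy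
    module Im = Completeness (λ K → im (psum (term z) K)) im-cauchy

  isE-0 : IsE 𝟘ᶜ 𝟙ᶜ
  isE-0 = mkIsE (constant (λ K → re≋ (sums K))) (constant (λ K → im≋ (sums K)))
    where
    sums : ∀ K → psum (term 𝟘ᶜ) (suc K) ≋ℂ 𝟙ᶜ
    sums zero    = ℂR.trans (ℂR.+-identityˡ (term 𝟘ᶜ 0)) (ℂR.*-identityˡ 𝟙ᶜ)
    sums (suc K) = ℂR.trans (ℂR.+-cong (sums K) (ℂR.trans (ℂR.*-congˡ {emb (1/ suc K !)} (ℂR.zeroˡ (𝟘ᶜ ^ K))) (ℂR.zeroʳ (emb (1/ suc K !)))))
      (ℂR.+-identityʳ 𝟙ᶜ)
    constant : ∀ {a L} → (∀ K → a (suc K) ≋ L) → Lim a L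
    -- The empty partial sum is 0, so the constant value is reached only from index 1 on.
    constant h = mkLim λ ε 0<ε → 1 , λ { (suc K) _ → ≋⇒≈ (h K) ε 0<ε }

  conj : ℂ → ℂ
  conj z = re z +i (⊝ im z)

  conj-* : ∀ z w → conj (z ⊗ᶜ w) ≋ℂ conj z ⊗ᶜ conj w
  conj-* (a +i b) (c +i d) = ℝ-Identities.re-conj a b c d ∥ ℝ-Identities.im-conj a b c d

  conj-^ : ∀ z k → conj (z ^ k) ≋ℂ conj z ^ k
  conj-^ z zero    = ℝR.refl ∥ ℝ-Identities.-0≈0
  conj-^ z (suc k) = ℂR.trans (conj-* z (z ^ k)) (ℂR.*-congˡ {conj z} (conj-^ z k))

  conj-emb : ∀ q → conj (emb q) ≋ℂ emb q
  conj-emb q = ℝR.refl ∥ ℝ-Identities.-0≈0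

  conj-psum : ∀ z K → conj (psum (term z) K) ≋ℂ psum (term (conj z)) K
  conj-psum z zero    = ℝR.refl ∥ ℝ-Identities.-0≈0
  conj-psum z (suc K) = ℂR.trans (ℝR.refl ∥ ℝ-Identities.neg-+ (im (psum (term z) K)) (im (term z K)))
    (ℂR.+-cong (conj-psum z K) (ℂR.trans (conj-* (emb (1/ K !)) (z ^ K)) (ℂR.*-cong (conj-emb (1/ K !)) (conj-^ z K))))

  isE-conj : ∀ {z w} → IsE z w → IsE (conj z) (conj w)
  isE-conj {z} (mkIsE p q) = mkIsE (lim-≋ (λ K → re≋ (conj-psum z K)) p) (lim-≋ (λ K → im≋ (conj-psum z K)) (lim-⊝ q))

  isE-^ : ∀ {z w} → IsE z w → ∀ n → IsE (ιℂ (+ n) ⊗ᶜ z) (w ^ n)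
  isE-^ {z} {w} h zero    = isE-cong (ℂR.sym (ℂR.zeroˡ z)) ℂR.refl isE-0
  isE-^ {z} {w} h (suc n) = isE-cong (ℂR.sym (ℂR.trans (ℂR.distribʳ z 𝟙ᶜ (ιℂ (+ n))) (ℂR.+-congʳ {ιℂ (+ n) ⊗ᶜ z} (ℂR.*-identityˡ z)))) ℂR.refl
    (isE-⊕ h (isE-^ h n))

  -- exp (ix) · conj (exp (ix)) = exp (ix) · exp (-ix) = 1
  isE-imaginary : ∀ {x w} → IsE (𝟘 +i x) w → norm² w ≋ 𝟙
  isE-imaginary {x} {w} h = ℝR.trans (ℝ-Identities.norm²-conj (re w) (im w)) (re≋ (isE-unique
    (isE-cong (ℝR.+-identityˡ 𝟘 ∥ ℝR.-‿inverseʳ x) ℂR.refl (isE-⊕ h (isE-conj h))) isE-0))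

  ^ℂ≋^ : ∀ z n → z ^ℂ n ≋ℂ z ^ n
  ^ℂ≋^ z zero    = ℝR.sym (fr≋ 1ℚ) ∥ ℝR.sym (fr≋ 0ℚ)
  ^ℂ≋^ z (suc n) = ℂR.trans (*ℂ≋⊗ᶜ z (z ^ℂ n)) (ℂR.*-congˡ {z} (^ℂ≋^ z n))

  expSum≋psum : ∀ z K → expSum z K ≋ℂ psum (term z) K
  expSum≋psum z zero    = ℝR.sym (fr≋ 0ℚ) ∥ ℝR.sym (fr≋ 0ℚ)
  expSum≋psum z (suc K) = ℂR.trans (+ℂ≋⊕ᶜ (expSum z K) (fromℝ (fromℚ (1/ K !)) *ℂ z ^ℂ K))
    (ℂR.+-cong (expSum≋psum z K) (ℂR.trans (*ℂ≋⊗ᶜ (fromℝ (fromℚ (1/ K !))) (z ^ℂ K))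
      (ℂR.*-cong (ℝR.sym (fr≋ (1/ K !)) ∥ ℝR.sym (fr≋ 0ℚ)) (^ℂ≋^ z K))))

  isExpℂ⇒isE : ∀ {z w} → IsExpℂ z w → IsE z w
  isExpℂ⇒isE {z} {w} (p , q) = mkIsE (lim-≋ (λ K → re≋ (expSum≋psum z K)) (⟶⇒Lim p)) (lim-≋ (λ K → im≋ (expSum≋psum z K)) (⟶⇒Lim q))

open ComplexExponential

-- Unit vectors of rational angle

module RootsOfUnity where

  open Galois ℂ-domain using (^-multiple; ^-%)
  open Orders ℂ-domain using (Order; order-exists)
  open ℂP using (_^_; ^-homo-*; ^-congʳ; ^-assocʳ; ^-congˡ)

  +≋⊕ : ∀ {x y x′ y′} → x ≋ x′ → y ≋ y′ → x + y ≋ x′ ⊕ y′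
  +≋⊕ {x} {y} h k = ℝR.trans (ℝR.sym (⊕≋+ x y)) (ℝR.+-cong h k)

  *≋⊗ : ∀ {x y x′ y′} → x ≋ x′ → y ≋ y′ → x * y ≋ x′ ⊗ y′
  *≋⊗ {x} {y} h k = ℝR.trans (ℝR.sym (⊗≋* x y)) (ℝR.*-cong h k)

  angle : ℝ → ℚ → ℂ
  angle P q = 𝟘 +i (P ⊗ fr q)

  angle-⊕ : ∀ P p q → angle P p ⊕ᶜ angle P q ≋ℂ angle P (p ℚ.+ q)
  angle-⊕ P p q = ℝR.+-identityˡ 𝟘 ∥ ℝR.trans (ℝR.sym (ℝR.distribˡ P (fr p) (fr q))) (ℝR.*-congˡ {P} (ℝR.sym (fr-+ p q)))

  angle-ι : ∀ P n q → ιℂ (+ n) ⊗ᶜ angle P q ≋ℂ angle P (ι (+ n) ℚ.* q)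
  angle-ι P n q = ℂR.trans (ℂR.*-congʳ {angle P q} (ιℂ≋emb n))
    (ℝ-Identities.re-scale (fr (ι (+ n))) (P ⊗ fr q) ∥
     ℝR.trans (ℝ-Identities.im-scale (fr (ι (+ n))) P (fr q)) (ℝR.*-congˡ {P} (ℝR.sym (fr-* (ι (+ n)) q))))

  ι≡/1ᶻ : ∀ i → ι i ≡ i ℚ./ 1
  ι≡/1ᶻ (+ n)    = ι≡/1 n
  ι≡/1ᶻ -[1+ n ] = ≡.cong ℚ.-_ (ι≡/1 (suc n))

  fraction : ∀ γ → γ ≡ ι (↥ γ) ℚ.* (+ 1 ℚ./ ↧ₙ γ)
  fraction γ = ≡.sym (≡.trans (≡.cong (ℚ._* (+ 1 ℚ./ ↧ₙ γ)) (ι≡/1ᶻ (↥ γ))) (≡.trans (/-* (↥ γ) (+ 1) (↧ₙ γ))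
    (≡.trans (≡.cong (λ i → i ℚ./ ↧ₙ γ) (ℤ.*-identityʳ (↥ γ))) (ℚ.↥p/↧p≡p γ))))

  1/-expand : ∀ c n .{{_ : NonZero n}} .{{_ : NonZero (c ℕ.* n)}} → + 1 ℚ./ n ≡ ι (+ c) ℚ.* (+ 1 ℚ./ (c ℕ.* n))
  1/-expand c n = ≡.sym (≡.trans (ι*/ c (+ 1) (c ℕ.* n)) (/-≡ (+ c ℤ.* + 1) (+ 1) (c ℕ.* n) n
    (≡.trans (≡.cong (ℤ._* + n) (ℤ.*-identityʳ (+ c))) (≡.trans (≡.sym (ℤ.pos-* c n)) (≡.sym (ℤ.*-identityˡ _))))))

  expand : ∀ a c n .{{_ : NonZero n}} .{{_ : NonZero (c ℕ.* n)}} → ι a ℚ.* (+ 1 ℚ./ n) ≡ ι (a ℤ.* + c) ℚ.* (+ 1 ℚ./ (c ℕ.* n))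
  expand a c n = ≡.trans (≡.cong (ι a ℚ.*_) (1/-expand c n)) (≡.trans (≡.sym (ℚ.*-assoc (ι a) (ι (+ c)) (+ 1 ℚ./ (c ℕ.* n))))
    (≡.cong (ℚ._* (+ 1 ℚ./ (c ℕ.* n))) (≡.sym (ι-* a (+ c)))))

  common-denominator : ∀ {A : Set} (D : ℚ → A → Set) xs → All (λ x → ∃[ γ ] D γ x) xs →
    ∃[ b ] All (λ x → ∃[ a ] D (ι a ℚ.* (+ 1 ℚ./ suc b)) x) xs
  common-denominator D []       []               = 0 , []
  common-denominator D (x ∷ xs) ((γ , Dγ) ∷ all) = let b , all′ = common-denominator D xs all in
    combine b γ , head b ∷ All.map (λ (a , Da) → a ℤ.* + ↧ₙ γ , ≡.subst (λ q → D q _) (expand a (↧ₙ γ) (suc b)) Da) all′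
    where
    -- The successor of this number is `↧ₙ γ * suc b`, a common multiple of both denominators.
    combine : ℕ → ℚ → ℕ
    combine b γ = b ℕ.+ ℚ.denominator-1 γ ℕ.* suc b
    head : ∀ b → ∃[ a ] D (ι a ℚ.* (+ 1 ℚ./ suc (combine b γ))) x
    head b = ↥ γ ℤ.* + suc b , ≡.subst (λ q → D q x) (≡.trans (fraction γ) (≡.trans (expand (↥ γ) (suc b) (↧ₙ γ))
      (/-cong′ (ℕ.*-comm (suc b) (↧ₙ γ))))) Dγ
      where
      /-cong′ : ∀ {m n} .{{_ : NonZero m}} .{{_ : NonZero n}} → m ≡ n →
                ι (↥ γ ℤ.* + suc b) ℚ.* (+ 1 ℚ./ m) ≡ ι (↥ γ ℤ.* + suc b) ℚ.* (+ 1 ℚ./ n)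
      /-cong′ ≡.refl = ≡.refl

  module Angles (h : ℝ) (w : ℂ) (exp-ih : IsE (𝟘 +i h) w) (re-w : re w ≋ 𝟘) where

    P : ℝ
    P = h ⊕ h

    -- w = exp (ih) has norm 1 and real part 0, so w² = -1 whatever the sign of its imaginary part.
    w⁴≋1 : w ^ 4 ≋ℂ 𝟙ᶜ
    w⁴≋1 = ℂR.trans (ℂR.*-congˡ {w} (ℂR.*-congˡ {w} (ℂR.*-congˡ {w} (ℂR.*-identityʳ w))))
      (ℂR.trans (ℂP-assoc w) (ℂR.trans (ℂR.*-cong square square) minus-one²))
      where
      ℂP-assoc : ∀ w → w ⊗ᶜ (w ⊗ᶜ (w ⊗ᶜ w)) ≋ℂ (w ⊗ᶜ w) ⊗ᶜ (w ⊗ᶜ w)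
      ℂP-assoc w = ℂR.sym (ℂR.*-assoc w w (w ⊗ᶜ w))
      im²≋1 : im w ⊗ im w ≋ 𝟙
      im²≋1 = ℝR.trans (ℝR.sym (ℝR.trans (ℝR.+-congʳ {im w ⊗ im w} (ℝR.trans (ℝR.*-congʳ {re w} re-w) (ℝR.zeroˡ (re w)))) (ℝR.+-identityˡ (im w ⊗ im w))))
        (isE-imaginary exp-ih)
      square : w ⊗ᶜ w ≋ℂ (⊝ 𝟙) +i 𝟘
      square = ℝR.trans (ℝR.+-cong (ℝR.trans (ℝR.*-congʳ {re w} re-w) (ℝR.zeroˡ (re w))) (ℝR.-‿cong im²≋1)) (ℝR.+-identityˡ (⊝ 𝟙)) ∥
        ℝR.trans (ℝR.+-cong (ℝR.trans (ℝR.*-congʳ {im w} re-w) (ℝR.zeroˡ (im w))) (ℝR.trans (ℝR.*-congˡ {im w} re-w) (ℝR.zeroʳ (im w)))) (ℝR.+-identityˡ 𝟘)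
      minus-one² : ((⊝ 𝟙) +i 𝟘) ⊗ᶜ ((⊝ 𝟙) +i 𝟘) ≋ℂ 𝟙ᶜ
      minus-one² = ℝR.trans (ℝ-Identities.re-square 𝟙) (ℝR.*-identityˡ 𝟙) ∥ ℝ-Identities.im-square (⊝ 𝟙)

    exp-2πi : IsE (angle P (ι (+ 2))) 𝟙ᶜ
    exp-2πi = isE-cong (ℂR.trans (ℂR.*-congˡ {ιℂ (+ 4)} shape) (ℂR.trans (angle-ι P 4 ½) (ℂR.reflexive ≡.refl))) w⁴≋1 (isE-^ exp-ih 4)
      where
      shape : 𝟘 +i h ≋ℂ angle P ½
      shape = ℝR.refl ∥ ℝR.sym (ℝR.trans (ℝR.distribʳ (fr ½) h h) (ℝR.trans (ℝR.sym (ℝR.distribˡ h (fr ½) (fr ½)))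
        (ℝR.trans (ℝR.*-congˡ {h} (ℝR.sym (fr-+ ½ ½))) (ℝR.*-identityʳ h))))

    module _ (b : ℕ) where

      private
        q : ℚ
        q = + 1 ℚ./ suc b

      ζ : ℂ
      ζ = proj₁ (isE-exists (angle P q))

      exp-ζ : IsE (angle P q) ζ
      exp-ζ = proj₂ (isE-exists (angle P q))

      period : ℕ
      period = 2 ℕ.* suc b

      ζ^period : ζ ^ period ≋ℂ 𝟙ᶜ
      ζ^period = isE-unique (isE-^ exp-ζ period) (isE-cong (ℂR.sym (ℂR.trans (angle-ι P period q) (ℂR.reflexive (≡.cong (angle P) full)))) ℂR.refl exp-2πi)
        where
        full : ι (+ period) ℚ.* q ≡ ι (+ 2)
        full = ≡.trans (≡.cong (λ i → ι i ℚ.* q) (ℤ.pos-* 2 (suc b))) (≡.trans (≡.cong (ℚ._* q) (ι-* (+ 2) (+ suc b)))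
          (≡.trans (ℚ.*-assoc (ι (+ 2)) (ι (+ suc b)) q) (≡.trans (≡.cong (ι (+ 2) ℚ.*_) (ι*1/ (suc b))) (ℚ.*-identityʳ (ι (+ 2))))))

      is-power : ∀ a {z} → IsE (angle P (ι a ℚ.* q)) z → ∃[ k ] z ≋ℂ ζ ^ k
      is-power (+ n)    {z} h = n , isE-unique h (isE-cong (angle-ι P n q) ℂR.refl (isE-^ exp-ζ n))
      -- A negative exponent -(n+1) is replaced by (n+1)(period - 1); the second factor is `period`
      -- with one `suc` removed.
      is-power -[1+ n ] {z} h = suc n ℕ.* (b ℕ.+ suc (b ℕ.+ 0)) , (begin
        z                                            ≈⟨ ℂR.*-identityʳ z ⟨
        z ⊗ᶜ 𝟙ᶜ                                      ≈⟨ ℂR.*-congˡ {z} (^-multiple ζ period ζ^period (suc n)) ⟨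
        z ⊗ᶜ ζ ^ (suc n ℕ.* period)                  ≡⟨ ≡.cong (λ k → z ⊗ᶜ ζ ^ k) (ℕ.*-suc (suc n) _) ⟩
        z ⊗ᶜ ζ ^ (suc n ℕ.+ suc n ℕ.* m)             ≈⟨ ℂR.*-congˡ {z} (^-homo-* ζ (suc n) (suc n ℕ.* m)) ⟩
        z ⊗ᶜ (ζ ^ suc n ⊗ᶜ ζ ^ (suc n ℕ.* m))        ≈⟨ ℂR.*-assoc z (ζ ^ suc n) (ζ ^ (suc n ℕ.* m)) ⟨
        z ⊗ᶜ ζ ^ suc n ⊗ᶜ ζ ^ (suc n ℕ.* m)          ≈⟨ ℂR.*-congʳ {ζ ^ (suc n ℕ.* m)} inverse ⟩
        𝟙ᶜ ⊗ᶜ ζ ^ (suc n ℕ.* m)                      ≈⟨ ℂR.*-identityˡ _ ⟩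
        ζ ^ (suc n ℕ.* m)                            ∎)
        where
        open import Relation.Binary.Reasoning.Setoid ℂR.setoid
        m = b ℕ.+ suc (b ℕ.+ 0)
        sum≡0 : ι -[1+ n ] ℚ.* q ℚ.+ ι (+ suc n) ℚ.* q ≡ 0ℚ
        sum≡0 = ≡.trans (≡.sym (ℚ.*-distribʳ-+ q (ι -[1+ n ]) (ι (+ suc n)))) (≡.trans (≡.cong (ℚ._* q) (ℚ.+-inverseˡ (ι (+ suc n)))) (ℚ.*-zeroˡ q))
        inverse : z ⊗ᶜ ζ ^ suc n ≋ℂ 𝟙ᶜ
        inverse = isE-unique (isE-⊕ h (isE-cong (angle-ι P (suc n) q) ℂR.refl (isE-^ exp-ζ (suc n))))
          (isE-cong (ℂR.sym (ℂR.trans (angle-⊕ P (ι -[1+ n ] ℚ.* q) (ι (+ suc n) ℚ.* q))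
            (ℂR.trans (ℂR.reflexive (≡.cong (angle P) sum≡0)) (ℝR.refl ∥ ℝR.zeroʳ P)))) ℂR.refl isE-0)

  𝕚*≋ : ∀ {x y} → x ≋ y → 𝕚 *ℂ fromℝ x ≋ℂ 𝟘 +i y
  𝕚*≋ {x} {y} h = ℂR.trans (*ℂ≋⊗ᶜ 𝕚 (fromℝ x)) (ℂR.trans (ℂR.*-cong {𝕚} {𝟘 +i 𝟙} {fromℝ x} {y +i 𝟘} (ℝR.sym (fr≋ 0ℚ) ∥ ℝR.sym (fr≋ 1ℚ)) (h ∥ ℝR.sym (fr≋ 0ℚ)))
    (ℝ-Identities.re-rotate y 𝟙 ∥ ℝR.trans (ℝ-Identities.im-rotate y 𝟙) (ℝR.*-identityˡ y)))

  HalfPeriod : ℝ → Set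
  HalfPeriod h = ∃[ w ] (IsE (𝟘 +i h) w × re w ≋ 𝟘)

  isπ⇒halfPeriod : ∀ {π} (π-is : Isπ π) → HalfPeriod (proj₁ π-is)
  isπ⇒halfPeriod (h , _ , (w , exp , re-w) , _) = w , isE-cong (𝕚*≋ ℝR.refl) ℂR.refl (isExpℂ⇒isE exp) , ℝR.trans (mk≋ re-w) (ℝR.sym (fr≋ 0ℚ))

  -- Every pair comes with a real π of its own. Neither of two least positive zeros of the cosine
  -- can be strictly smaller than the other, which makes them equal.
  isπ-unique : ∀ {π π′} (p : Isπ π) (p′ : Isπ π′) → π′ ≋ proj₁ p ⊕ proj₁ p
  isπ-unique (h , 0<h , cos , least , _) (h′ , 0<h′ , cos′ , least′ , π′≈) =
    ℝR.trans (mk≋ π′≈) (+≋⊕ h′≋h h′≋h)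
    where
    h′≋h : h′ ≋ h
    h′≋h = ≼-antisym {h′} {h} (≤⇒≼ {h′} {h} λ h<h′ → least′ h 0<h h<h′ cos) (≤⇒≼ {h} {h′} λ h′<h → least h′ 0<h′ h′<h cos′)

  norm²-cong : ∀ {z w} → z ≋ℂ w → norm² z ≋ norm² w
  norm²-cong (p ∥ q) = ℝR.+-cong (ℝR.*-cong p p) (ℝR.*-cong q q)

  -- Comparing norms gives r² = 1, that is (r + 1)(r - 1) = 0, and r + 1 is nonzero because r is
  -- positive.
  unit-factor : ∀ {r w} → 0ℝ < r → norm² w ≋ 𝟙 → norm² ((r +i 𝟘) ⊗ᶜ w) ≋ 𝟙 → r ≋ 𝟙
  unit-factor {r} {w} 0<r norm-w norm-rw = ℝ-sub (ℝ-noZeroDivisors (r ⊕ 𝟙) (r ⊕ ⊝ 𝟙) difference r+1≉0)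
    where
    ℝ-sub : r ⊕ ⊝ 𝟙 ≋ 𝟘 → r ≋ 𝟙
    ℝ-sub h = ℝR.trans (ℝ-Identities.add-back r 𝟙) (ℝR.trans (ℝR.+-congʳ {𝟙} h) (ℝR.+-identityˡ 𝟙))
    r²≋1 : r ⊗ r ≋ 𝟙
    r²≋1 = ℝR.trans (ℝR.sym (ℝR.trans (ℝR.*-congˡ {r ⊗ r} norm-w) (ℝR.*-identityʳ (r ⊗ r))))
      (ℝR.trans (ℝR.sym (ℝ-Identities.norm²-scale r (re w) (im w))) norm-rw)
    difference : (r ⊕ 𝟙) ⊗ (r ⊕ ⊝ 𝟙) ≋ 𝟘
    difference = ℝR.trans (ℝ-Identities.difference-of-squares r 𝟙) (ℝR.trans (ℝR.+-cong r²≋1 (ℝR.-‿cong (ℝR.*-identityˡ 𝟙))) (ℝR.-‿inverseʳ 𝟙))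
    r+1≉0 : ¬ (r ⊕ 𝟙 ≋ 𝟘)
    r+1≉0 h = ≼⇒≤ {𝟙} {𝟘} (≼-trans (≼-reflexive (ℝR.sym (ℝR.+-identityˡ 𝟙))) (≼-trans (≼-⊕ (≼-trans (≼-reflexive (fr≋ 0ℚ)) (<⇒≼ {0ℝ} {r} 0<r)) (≼-refl {𝟙})) (≼-reflexive h))) 𝟘<𝟙

  unitRational⇒angle : ∀ {π} (π-is : Isπ π) p q → IsDistance p q 1ℝ → RationalAngle p q →
    ∃[ γ ] IsE (angle (proj₁ π-is ⊕ proj₁ π-is) γ) (q ⊕ᶜ ⊝ᶜ p)
  unitRational⇒angle {π} π-is p q (_ , dist) (π′ , γ , r , w , π′-is , 0<r , exp , q-p≈) = γ , isE-cong ℂR.refl w≋q-p exp′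
    where
    exp′ : IsE (angle (proj₁ π-is ⊕ proj₁ π-is) γ) w
    exp′ = isE-cong (𝕚*≋ (*≋⊗ (isπ-unique {π} {π′} π-is π′-is) (ℝR.sym (fr≋ γ)))) ℂR.refl (isExpℂ⇒isE exp)
    q-p≋ : q ⊕ᶜ ⊝ᶜ p ≋ℂ (r +i 𝟘) ⊗ᶜ w
    q-p≋ = ℂR.trans (ℂR.sym (-ℂ≋⊕ᶜ q p)) (ℂR.trans (≈ℂ⇒≋ℂ q-p≈) (ℂR.trans (*ℂ≋⊗ᶜ (fromℝ r) w) (ℂR.*-congʳ {w} {fromℝ r} {r +i 𝟘} (ℝR.refl ∥ ℝR.sym (fr≋ 0ℚ)))))
    norm-q-p : norm² (q ⊕ᶜ ⊝ᶜ p) ≋ 𝟙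
    norm-q-p = ℝR.trans (ℝ-Identities.norm²-swap (re q) (re p) (im q) (im p)) (ℝR.trans (ℝR.sym (norm²-cong (-ℂ≋⊕ᶜ p q)))
      (ℝR.trans (ℝR.sym (+≋⊕ (*≋⊗ ℝR.refl ℝR.refl) (*≋⊗ ℝR.refl ℝR.refl)))
        (ℝR.trans (ℝR.sym (mk≋ dist)) (ℝR.trans (*≋⊗ (ℝR.sym (fr≋ 1ℚ)) (ℝR.sym (fr≋ 1ℚ))) (ℝR.*-identityˡ 𝟙)))))
    r≋1 : r ≋ 𝟙
    r≋1 = unit-factor {r} {w} 0<r (isE-imaginary exp′) (ℝR.trans (ℝR.sym (norm²-cong q-p≋)) norm-q-p)
    w≋q-p : w ≋ℂ q ⊕ᶜ ⊝ᶜ p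
    w≋q-p = ℂR.sym (ℂR.trans q-p≋ (ℂR.trans (ℂR.*-congʳ {w} {r +i 𝟘} {𝟙ᶜ} (r≋1 ∥ ℝR.refl)) (ℂR.*-identityˡ w)))

  -- The first pair provides the real π to which all angles are referred, so the empty list is
  -- treated apart. The order of ζ is available under a double negation only, which the decidable
  -- conclusion absorbs.
  unit-rational-pairs : ∀ {n} (S : Fin n → ℂ) → Injective _≡_ _≈ℂ_ S → ∀ t → n ℕ.< 2 ℕ.^ suc t →
    ∀ xs → Unique xs → All (UnitRationalPair S) xs → length xs ℕ.≤ 2 ℕ.* suc t ℕ.* (2 ℕ.* suc t) ℕ.* (n ℕ.* t)
  unit-rational-pairs S S-inj t n< [] _ _ = ℕ.z≤n
  unit-rational-pairs {n} S S-inj t n< xs@((i₀ , j₀) ∷ _) uniq all@((_ , _ , π , _ , _ , _ , π-is , _) ∷ _) =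
    decidable-stable (length xs ℕ.≤? _) λ ¬bound →
      order-exists (A.ζ b) (A.period b) (A.ζ^period b) λ (N , N≢0 , order) →
        ¬bound (bound N {{N≢0}} order)
    where
    h = proj₁ π-is
    module A = Angles h (proj₁ (isπ⇒halfPeriod {π} π-is)) (proj₁ (proj₂ (isπ⇒halfPeriod {π} π-is))) (proj₂ (proj₂ (isπ⇒halfPeriod {π} π-is)))
    Direction : ℚ → Fin n × Fin n → Set
    Direction γ (i , j) = IsE (angle (h ⊕ h) γ) (S j ⊕ᶜ ⊝ᶜ S i)
    common = common-denominator Direction xs
      (All.map (λ { {i , j} (_ , dist , angle) → unitRational⇒angle {π} π-is (S i) (S j) dist angle }) all)
    b = proj₁ common
    bound : ∀ N {{_ : NonZero N}} → Order (A.ζ b) N → length xs ℕ.≤ 2 ℕ.* suc t ℕ.* (2 ℕ.* suc t) ℕ.* (n ℕ.* t)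
    bound N order = Grids.few-edges ℂ-domain S (λ eq → S-inj (≋ℂ⇒≈ℂ eq)) (A.ζ b) N order t n< xs uniq
      (All.map (λ { {i , j} (a , dir) → label i j (A.is-power b a dir) }) (proj₂ common))
      where
      label : ∀ i j → ∃[ k ] S j ⊕ᶜ ⊝ᶜ S i ≋ℂ A.ζ b ^ k → ∃[ e ] (e ℕ.< N × S j ≋ℂ S i ⊕ᶜ A.ζ b ^ e)
      label i j (k , eq) = k % N , ℕ.m%n<n k N ,
        ℂR.trans (ℂ-add-back (S j) (S i)) (ℂR.+-congˡ {S i} (ℂR.trans eq (^-% (A.ζ b) N (proj₁ order) k)))
        where
        ℂ-add-back : ∀ z w → z ≋ℂ w ⊕ᶜ (z ⊕ᶜ ⊝ᶜ w)
        ℂ-add-back z w = ℂR.trans (RingIdentities.add-back ℂ-ring z w) (ℂR.+-comm (z ⊕ᶜ ⊝ᶜ w) w)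

open RootsOfUnity

-- The real exponential and the numerical estimate

module RealExponential where

  module ℝP = PowerSums ℝ-ring
  module ℝS = Series ℝ-ring
  open ℝS using (psum; psum-cong; psum-append)
  open ℝP using (_^_; ^-distrib-*; ^-assocʳ; ^-congˡ)

  0≼⊝ : ∀ {x y} → x ≼ y → 𝟘 ≼ y ⊕ ⊝ x
  0≼⊝ {x} {y} h = ≼-trans (≼-reflexive (ℝR.sym (ℝR.-‿inverseʳ x))) (≼-⊕ h ≼-refl)

  ≼-from-0 : ∀ {x y} → 𝟘 ≼ y ⊕ ⊝ x → x ≼ y
  ≼-from-0 {x} {y} h = ≼-trans (≼-reflexive (ℝR.sym (ℝR.+-identityˡ x))) (≼-trans (≼-⊕ h ≼-refl) (≼-reflexive (ℝR.sym (ℝ-Identities.add-back y x))))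

  0≼-⊕ : ∀ {x y} → 𝟘 ≼ x → 𝟘 ≼ y → 𝟘 ≼ x ⊕ y
  0≼-⊕ h k = ≼-trans (≼-reflexive (ℝR.sym (ℝR.+-identityˡ 𝟘))) (≼-⊕ h k)

  ≼-⊗ : ∀ {a b c d} → 𝟘 ≼ a → 𝟘 ≼ c → a ≼ b → c ≼ d → a ⊗ c ≼ b ⊗ d
  ≼-⊗ {a} {b} {c} {d} 0≼a 0≼c a≼b c≼d = ≼-from-0 (≼-trans
    (0≼-⊕ (0≼-⊗ (≼-trans 0≼a a≼b) (0≼⊝ c≼d)) (0≼-⊗ (0≼⊝ a≼b) 0≼c))
    (≼-reflexive (ℝ-Identities.product-difference a b c d)))

  0≼-^ : ∀ {x} → 𝟘 ≼ x → ∀ k → 𝟘 ≼ x ^ k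
  0≼-^ h zero    = <⇒≼ 𝟘<𝟙
  0≼-^ h (suc k) = 0≼-⊗ h (0≼-^ h k)

  ≼-^ : ∀ {x y} → 𝟘 ≼ x → x ≼ y → ∀ k → x ^ k ≼ y ^ k
  ≼-^ 0≼x x≼y zero    = ≼-refl
  ≼-^ 0≼x x≼y (suc k) = ≼-⊗ 0≼x (0≼-^ 0≼x k) x≼y (≼-^ 0≼x x≼y k)

  fr-^ : ∀ q k → fr (q ℚP.^ k) ≋ fr q ^ k
  fr-^ q zero    = ℝR.refl
  fr-^ q (suc k) = ℝR.trans (fr-* q (q ℚP.^ k)) (ℝR.*-congˡ {fr q} (fr-^ q k))

  0≼fr : ∀ {q} → 0ℚ ℚ.≤ q → 𝟘 ≼ fr q
  0≼fr = fr-mono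

  fr-cancel : ∀ {p q} → fr p ≼ fr q → p ℚ.≤ q
  fr-cancel {p} {q} h = ℚ.≮⇒≥ λ q<p → ≼⇒≤ {fr p} {fr q} h (fr-< q<p)
    where
    fr-< : q ℚ.< p → fr q < fr p
    fr-< q<p = ½ ℚ.* (p ℚ.- q) , 0<½* 0<p-q , 0 , λ n _ → ≡.subst₂ (λ a b → a ℚ.+ ½ ℚ.* (p ℚ.- q) ℚ.< b)
      (≡.sym (seq-fr q n)) (≡.trans (solve 2 (λ p q → q :+ (p :- q) := p) ≡.refl p q) (≡.sym (seq-fr p n))) (ℚ.+-monoʳ-< q (½ε<ε 0<p-q))
      where
      open ℚ-Solver
      0<p-q : 0ℚ ℚ.< p ℚ.- q
      0<p-q = ≡.subst (ℚ._< p ℚ.- q) (ℚ.+-inverseʳ q) (ℚ.+-monoˡ-< (ℚ.- q) q<p)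

  ι-ℕ* : ∀ m n → ι (+ (m ℕ.* n)) ≡ ι (+ m) ℚ.* ι (+ n)
  ι-ℕ* m n = ≡.trans (≡.cong ι (ℤ.pos-* m n)) (ι-* (+ m) (+ n))

  ι-ℕ^ : ∀ m k → ι (+ (m ℕ.^ k)) ≡ ι (+ m) ℚP.^ k
  ι-ℕ^ m zero    = ≡.refl
  ι-ℕ^ m (suc k) = ≡.trans (ι-ℕ* m (m ℕ.^ k)) (≡.cong (ι (+ m) ℚ.*_) (ι-ℕ^ m k))

  real : ℝ → ℂ
  real x = x +i 𝟘

  real-⊗ : ∀ x y → real x ⊗ᶜ real y ≋ℂ real (x ⊗ y)
  real-⊗ x y = ℝ-Identities.re-real x y ∥ ℝ-Identities.im-real x y

  real-⊕ : ∀ x y → real x ⊕ᶜ real y ≋ℂ real (x ⊕ y)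
  real-⊕ x y = ℝR.refl ∥ ℝR.+-identityˡ 𝟘

  real-^ : ∀ x k → real x ℂP.^ k ≋ℂ real (x ^ k)
  real-^ x zero    = ℂR.refl
  real-^ x (suc k) = ℂR.trans (ℂR.*-congˡ {real x} (real-^ x k)) (real-⊗ x (x ^ k))

  rterm : ℝ → ℕ → ℝ
  rterm x k = fr (1/ k !) ⊗ x ^ k

  real-psum : ∀ x K → ℂS.psum (ℂE.term (real x)) K ≋ℂ real (psum (rterm x) K)
  real-psum x zero    = ℂR.refl
  real-psum x (suc K) = ℂR.trans (ℂR.+-cong (real-psum x K) (ℂR.trans (ℂR.*-congˡ {emb (1/ K !)} (real-^ x K)) (real-⊗ (fr (1/ K !)) (x ^ K))))
    (real-⊕ (psum (rterm x) K) (rterm x K))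

  record Exp (x y : ℝ) : Set where
    constructor mkExp
    field exp-isE : IsE (real x) (real y)

  open Exp

  exp-lim : ∀ {x y} → Exp x y → Lim (psum (rterm x)) y
  exp-lim {x} (mkExp h) = lim-≋ (λ K → re≋ (real-psum x K)) (re-lim h)

  exp-cong : ∀ {x x′ y y′} → x ≋ x′ → y ≋ y′ → Exp x y → Exp x′ y′
  exp-cong p q (mkExp h) = mkExp (isE-cong (p ∥ ℝR.refl) (q ∥ ℝR.refl) h)

  exp-unique : ∀ {x y y′} → Exp x y → Exp x y′ → y ≋ y′
  exp-unique h k = lim-unique (exp-lim h) (exp-lim k)

  exp-⊕ : ∀ {x y u v} → Exp x u → Exp y v → Exp (x ⊕ y) (u ⊗ v)
  exp-⊕ {x} {y} {u} {v} (mkExp h) (mkExp k) = mkExp (isE-cong (real-⊕ x y) (real-⊗ u v) (isE-⊕ h k))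

  exp-0 : Exp 𝟘 𝟙
  exp-0 = mkExp isE-0

  -- The complex value at a real point equals its own conjugate by uniqueness, so its imaginary part
  -- is zero.
  exp-exists : ∀ x → ∃[ y ] Exp x y
  exp-exists x = let w , h = isE-exists (real x) in
    re w , mkExp (isE-cong ℂR.refl (ℝR.refl ∥ im≋0 (im≋ (isE-unique (isE-cong (ℝR.refl ∥ ℝ-Identities.-0≈0) ℂR.refl (isE-conj h)) h))) h)
    where
    𝟙⊕𝟙≉0 : ¬ (𝟙 ⊕ 𝟙 ≋ 𝟘)
    𝟙⊕𝟙≉0 h = ≼⇒≤ {𝟙} {𝟘} (≼-trans (≼-reflexive (ℝR.sym (ℝR.+-identityˡ 𝟙))) (≼-trans (≼-⊕ (<⇒≼ 𝟘<𝟙) (≼-refl {𝟙})) (≼-reflexive h))) 𝟘<𝟙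
    im≋0 : ∀ {v} → ⊝ v ≋ v → v ≋ 𝟘
    im≋0 {v} h = ℝ-noZeroDivisors (𝟙 ⊕ 𝟙) v (ℝR.trans (ℝR.distribʳ v 𝟙 𝟙) (ℝR.trans (ℝR.+-cong (ℝR.*-identityˡ v) (ℝR.*-identityˡ v))
      (ℝR.trans (ℝR.+-congˡ {v} (ℝR.sym h)) (ℝR.-‿inverseʳ v)))) 𝟙⊕𝟙≉0

  exp-power : ∀ {x y} → Exp x y → ∀ t → Exp (fr (ι (+ t)) ⊗ x) (y ^ t)
  exp-power {x} h zero    = exp-cong (ℝR.sym (ℝR.zeroˡ x)) ℝR.refl exp-0
  exp-power {x} h (suc t) = exp-cong (ℝR.sym (ℝR.trans (ℝR.*-congʳ {x} (fr-+ 1ℚ (ι (+ t))))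
    (ℝR.trans (ℝR.distribʳ x 𝟙 (fr (ι (+ t)))) (ℝR.+-congʳ {fr (ι (+ t)) ⊗ x} (ℝR.*-identityˡ x))))) ℝR.refl (exp-⊕ h (exp-power h t))

  module _ {x y : ℝ} (0≼x : 𝟘 ≼ x) (h : Exp x y) where

    0≼rterm : ∀ k → 𝟘 ≼ rterm x k
    0≼rterm k = 0≼-⊗ (0≼fr (0≤1/! k)) (0≼-^ 0≼x k)

    0≼psum : ∀ {f} → (∀ k → 𝟘 ≼ f k) → ∀ K → 𝟘 ≼ psum f K
    0≼psum hf zero    = ≼-refl
    0≼psum hf (suc K) = 0≼-⊕ (0≼psum hf K) (hf K)

    psum≼exp : ∀ K → psum (rterm x) K ≼ y
    psum≼exp K = lim-≽ (K , λ K′ K≤K′ → ≡.subst (λ k → psum (rterm x) K ≼ psum (rterm x) k) (ℕ.m+[n∸m]≡n K≤K′) (mono (K′ ℕ.∸ K))) (exp-lim h)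
      where
      mono : ∀ a → psum (rterm x) K ≼ psum (rterm x) (K ℕ.+ a)
      mono a = ≼-trans (≼-trans (≼-reflexive (ℝR.sym (ℝR.+-identityʳ _))) (≼-⊕ ≼-refl (0≼psum (λ k → 0≼rterm (K ℕ.+ k)) a)))
        (≼-reflexive (ℝR.sym (psum-append (rterm x) K a)))

    rterm≼exp : ∀ k → rterm x k ≼ y
    rterm≼exp k = ≼-trans (≼-trans (≼-reflexive (ℝR.sym (ℝR.+-identityˡ (rterm x k)))) (≼-⊕ (0≼psum 0≼rterm k) ≼-refl)) (psum≼exp (suc k))

    1+x≼exp : 𝟙 ⊕ x ≼ y
    1+x≼exp = ≼-trans (≼-reflexive (ℝR.sym (ℝR.+-cong first second))) (psum≼exp 2)
      where
      first : psum (rterm x) 1 ≋ 𝟙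
      first = ℝR.trans (ℝR.+-identityˡ (rterm x 0)) (ℝR.*-identityˡ 𝟙)
      second : rterm x 1 ≋ x
      second = ℝR.trans (ℝR.*-identityˡ (x ⊗ 𝟙)) (ℝR.*-identityʳ x)

    1≼exp : 𝟙 ≼ y
    1≼exp = ≼-trans (≼-trans (≼-reflexive (ℝR.sym (ℝR.+-identityʳ 𝟙))) (≼-⊕ ≼-refl 0≼x)) 1+x≼exp

  module _ {x x′ y : ℝ} (1≼y : 𝟙 ≼ y) (h : Exp x y) (h′ : Exp x′ y) where

    -- If x < x′, put d = exp (x′ - x). Then y d = y and hence d = 1, while d ≥ 1 + (x′ - x).
    exp-injective-≼ : x′ ≼ x
    exp-injective-≼ = ≤⇒≼ {x′} {x} λ x<x′ → ≼⇒≤ {x′} {x} (bound (0≼⊝ (<⇒≼ {x} {x′} x<x′))) x<x′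
      where
      y≉0 : ¬ (y ≋ 𝟘)
      y≉0 y≋0 = ≼⇒≤ {𝟙} {𝟘} (≼-trans 1≼y (≼-reflexive y≋0)) 𝟘<𝟙
      bound : 𝟘 ≼ x′ ⊕ ⊝ x → x′ ≼ x
      bound 0≼δ = ≼-trans (≼-reflexive (ℝ-Identities.add-back x′ x)) (≼-trans (≼-⊕ δ≼0 ≼-refl) (≼-reflexive (ℝR.+-identityˡ x)))
        where
        δ′ = x′ ⊕ ⊝ x
        d = proj₁ (exp-exists δ′)
        exp-d = proj₂ (exp-exists δ′)
        y⊗d≋y : y ⊗ d ≋ y
        y⊗d≋y = exp-unique (exp-cong (ℝR.trans (ℝR.+-comm x δ′) (ℝR.sym (ℝ-Identities.add-back x′ x))) ℝR.refl (exp-⊕ h exp-d)) h′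
        d-1≋0 : d ⊕ ⊝ 𝟙 ≋ 𝟘
        d-1≋0 = ℝ-noZeroDivisors y (d ⊕ ⊝ 𝟙) (ℝR.trans (ℝ-Identities.factor-difference y d 𝟙)
          (ℝR.trans (ℝR.+-cong y⊗d≋y (ℝR.-‿cong (ℝR.*-identityʳ y))) (ℝR.-‿inverseʳ y))) y≉0
        δ≼0 : δ′ ≼ 𝟘
        δ≼0 = ≼-trans (≼-reflexive (ℝ-Identities.subtract-one δ′ 𝟙)) (≼-trans (≼-⊕ (1+x≼exp 0≼δ exp-d) (≼-refl {⊝ 𝟙})) (≼-reflexive d-1≋0))

  exp-injective : ∀ {x x′ y} → 𝟙 ≼ y → Exp x y → Exp x′ y → x ≋ x′
  exp-injective 1≼y h h′ = ≼-antisym (exp-injective-≼ 1≼y h′ h) (exp-injective-≼ 1≼y h h′)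

  ⅔ : ℚ
  ⅔ = + 2 ℚ./ 3

  0≤⅔ : 0ℚ ℚ.≤ ⅔
  0≤⅔ = from-yes (0ℚ ℚ.≤? ⅔)

  rterm-fr : ∀ q k → rterm (fr q) k ≋ fr (ℚE.term q k)
  rterm-fr q k = ℝR.trans (ℝR.*-congˡ {fr (1/ k !)} (ℝR.sym (fr-^ q k))) (ℝR.sym (fr-* (1/ k !) (q ℚP.^ k)))

  psum-fr : ∀ q K → psum (rterm (fr q)) K ≋ fr (ℚS.psum (ℚE.term q) K)
  psum-fr q zero    = ℝR.refl
  psum-fr q (suc K) = ℝR.trans (ℝR.+-cong (psum-fr q K) (rterm-fr q K)) (ℝR.sym (fr-+ (ℚS.psum (ℚE.term q) K) (ℚE.term q K)))

  -- 1 + x + x²/2 + x³/6 + 2 · x⁴/24 at x = 2/3: each further term is at most half of the preceding one.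
  e^⅔-bound : ℚ
  e^⅔-bound = ℚS.psum (ℚE.term ⅔) 4 ℚ.+ (ℚE.term ⅔ 4 ℚ.+ ℚE.term ⅔ 4)

  e^⅔-bound<2 : e^⅔-bound ℚ.< ι (+ 2)
  e^⅔-bound<2 = from-yes (e^⅔-bound ℚ.<? ι (+ 2))

  0<e^⅔-bound : 0ℚ ℚ.< e^⅔-bound
  0<e^⅔-bound = from-yes (0ℚ ℚ.<? e^⅔-bound)

  exp-⅔ : ∀ {c} → Exp (fr ⅔) c → c ≼ fr e^⅔-bound
  exp-⅔ h = lim-≼ (4 , λ K 4≤K → ≼-trans (≼-reflexive (psum-fr ⅔ K))
    (≡.subst (λ k → fr (ℚS.psum (ℚE.term ⅔) k) ≼ fr e^⅔-bound) (ℕ.m+[n∸m]≡n 4≤K) (fr-mono (psum-bound ⅔ 0≤⅔ 4 (from-yes (⅔ ℚ.+ ⅔ ℚ.≤? ι (+ 5))) (K ℕ.∸ 4))))) (exp-lim h)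

  ^-mono-< : ∀ {p q} → 0ℚ ℚ.< p → p ℚ.< q → ∀ k → p ℚP.^ suc k ℚ.< q ℚP.^ suc k
  ^-mono-< {p} {q} 0<p p<q zero    = ≡.subst₂ ℚ._<_ (≡.sym (ℚ.*-identityʳ p)) (≡.sym (ℚ.*-identityʳ q)) p<q
  ^-mono-< {p} {q} 0<p p<q (suc k) = ℚ.<-trans (ℚ.*-monoʳ-<-pos p {{ℚ.positive 0<p}} (^-mono-< 0<p p<q k))
    (ℚ.*-monoˡ-<-pos (q ℚP.^ suc k) {{ℚ.positive (0<^ (ℚ.<-trans 0<p p<q) (suc k))}} p<q)
    where
    0<^ : ∀ {q} → 0ℚ ℚ.< q → ∀ k → 0ℚ ℚ.< q ℚP.^ k
    0<^ 0<q zero    = ℚ.positive⁻¹ 1ℚ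
    0<^ {q} 0<q (suc k) = ℚ.positive⁻¹ _ {{ℚ.pos*pos⇒pos q {{ℚ.positive 0<q}} _ {{ℚ.positive (0<^ 0<q k)}}}}

  -- Write T = t + 1 and X = ⅔ T. If ℓ < X, then 2^T ≤ n ≤ n exp (X - ℓ) = exp (⅔)^T, but exp (⅔) is
  -- at most `e^⅔-bound`, which is less than 2.
  log-lower : ∀ t n {ℓ} → 2 ℕ.^ suc t ℕ.≤ n → Exp ℓ (fr (ι (+ n))) → fr (ι (+ suc t) ℚ.* ⅔) ≼ ℓ
  log-lower t n {ℓ} 2^t≤n h = ≤⇒≼ {X} {ℓ} λ ℓ<X → ℚ.<-irrefl ≡.refl (ℚ.<-≤-trans
    (^-mono-< 0<e^⅔-bound e^⅔-bound<2 t) (fr-cancel (too-small (0≼⊝ (<⇒≼ {ℓ} {X} ℓ<X)))))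
    where
    X = fr (ι (+ suc t) ℚ.* ⅔)
    c = proj₁ (exp-exists (fr ⅔))
    exp-c = proj₂ (exp-exists (fr ⅔))
    too-small : 𝟘 ≼ X ⊕ ⊝ ℓ → fr (ι (+ 2) ℚP.^ suc t) ≼ fr (e^⅔-bound ℚP.^ suc t)
    too-small 0≼δ = ≼-trans (fr-mono (≡.subst (ℚ._≤ ι (+ n)) (ι-ℕ^ 2 (suc t)) (ι-mono 2^t≤n)))
      (≼-trans (≼-reflexive (ℝR.sym (ℝR.*-identityʳ (fr (ι (+ n))))))
      (≼-trans (≼-⊗ (0≼fr (0≤ι n)) (<⇒≼ 𝟘<𝟙) ≼-refl (1≼exp 0≼δ exp-d))
      (≼-trans (≼-reflexive n⊗d≋c^t)
      (≼-trans (≼-^ (≼-trans (<⇒≼ 𝟘<𝟙) (1≼exp (0≼fr 0≤⅔) exp-c)) (exp-⅔ exp-c) (suc t))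
        (≼-reflexive (ℝR.sym (fr-^ e^⅔-bound (suc t))))))))
      where
      exp-d = proj₂ (exp-exists (X ⊕ ⊝ ℓ))
      n⊗d≋c^t : fr (ι (+ n)) ⊗ proj₁ (exp-exists (X ⊕ ⊝ ℓ)) ≋ c ^ suc t
      n⊗d≋c^t = exp-unique (exp-cong (ℝR.trans (ℝR.+-comm ℓ (X ⊕ ⊝ ℓ)) (ℝR.sym (ℝ-Identities.add-back X ℓ))) ℝR.refl (exp-⊕ h exp-d))
        (exp-cong (ℝR.sym (fr-* (ι (+ suc t)) ⅔)) ℝR.refl (exp-power exp-c (suc t)))

  isExp⇒Exp : ∀ x y → IsExp x y → Exp x y
  isExp⇒Exp x y h = mkExp (isE-cong (ℝR.refl ∥ ℝR.sym (fr≋ 0ℚ)) (ℝR.refl ∥ ℝR.sym (fr≋ 0ℚ)) (isExpℂ⇒isE h))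

  fromℕ≋ : ∀ n → fromℕ n ≋ fr (ι (+ n))
  fromℕ≋ n = ℝR.trans (ℝR.sym (fr≋ (+ n ℚ./ 1))) (ℝR.reflexive (≡.cong fr (≡.sym (ι≡/1 n))))

  -- A Taylor term of even order 2j involves the square root s only through s² = ℓ.
  exp-lower : ∀ {s ℓ E} j c X → 0ℚ ℚ.≤ c → 0ℚ ℚ.≤ X → 𝟘 ≼ s → s ⊗ s ≋ ℓ → fr X ≼ ℓ → Exp (fr c ⊗ s) E →
              fr (1/ (2 ℕ.* j) ! ℚ.* (c ℚP.^ (2 ℕ.* j) ℚ.* X ℚP.^ j)) ≼ E
  exp-lower {s} {ℓ} {E} j c X 0≤c 0≤X 0≼s s²≋ℓ X≼ℓ h = ≼-trans (≼-reflexive split)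
    (≼-trans (≼-⊗ (0≼fr (0≤1/! k)) (0≼-⊗ (0≼-^ (0≼fr 0≤c) k) (0≼-^ (0≼fr 0≤X) j)) ≼-refl
      (≼-⊗ (0≼-^ (0≼fr 0≤c) k) (0≼-^ (0≼fr 0≤X) j) ≼-refl (≼-^ (0≼fr 0≤X) X≼ℓ j)))
    (≼-trans (≼-reflexive (ℝR.sym even-term)) (rterm≼exp (0≼-⊗ (0≼fr 0≤c) 0≼s) h k)))
    where
    k = 2 ℕ.* j
    even-term : rterm (fr c ⊗ s) k ≋ fr (1/ k !) ⊗ (fr c ^ k ⊗ ℓ ^ j)
    even-term = ℝR.*-congˡ {fr (1/ k !)} (ℝR.trans (^-distrib-* (fr c) s k) (ℝR.*-congˡ {fr c ^ k}
      (ℝR.trans (ℝR.sym (^-assocʳ s 2 j)) (^-congˡ j (ℝR.trans (ℝR.*-congˡ {s} (ℝR.*-identityʳ s)) s²≋ℓ)))))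
    split : fr (1/ k ! ℚ.* (c ℚP.^ k ℚ.* X ℚP.^ j)) ≋ fr (1/ k !) ⊗ (fr c ^ k ⊗ fr X ^ j)
    split = ℝR.trans (fr-* (1/ k !) (c ℚP.^ k ℚ.* X ℚP.^ j)) (ℝR.*-congˡ {fr (1/ k !)}
      (ℝR.trans (fr-* (c ℚP.^ k) (X ℚP.^ j)) (ℝR.*-cong (fr-^ c k) (fr-^ X j))))

  -- Homogeneity in T reduces the estimate for all T to one numerical comparison.
  rescale : ∀ K a b T w j → 0ℚ ℚ.≤ T → K ℚ.≤ a ℚ.* (b ℚ.* w ℚP.^ j) → K ℚ.* T ℚP.^ j ℚ.≤ a ℚ.* (b ℚ.* (T ℚ.* w) ℚP.^ j)
  rescale K a b T w j 0≤T le = ≡.subst (K ℚ.* T ℚP.^ j ℚ.≤_) regroup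
    (ℚ.*-monoʳ-≤-nonNeg (T ℚP.^ j) {{ℚ.nonNegative (0≤pow T 0≤T j)}} le)
    where
    open ℚ-Solver
    regroup : a ℚ.* (b ℚ.* w ℚP.^ j) ℚ.* T ℚP.^ j ≡ a ℚ.* (b ℚ.* (T ℚ.* w) ℚP.^ j)
    regroup = ≡.trans (solve 4 (λ a b t w → a :* (b :* w) :* t := a :* (b :* (t :* w))) ≡.refl a b (T ℚP.^ j) (w ℚP.^ j))
      (≡.cong (λ v → a ℚ.* (b ℚ.* v)) (≡.sym (ℚP.^-distrib-* T w j)))

  -- The right-hand side is 96/5; the 6 is that of the exponent 6/√(log n), and ⅔ is the lower bound
  -- for log 2.
  16≤6⁶⅔³/6! : ι (+ 16) ℚ.≤ 1/ 6 ! ℚ.* (ι (+ 6) ℚP.^ 6 ℚ.* ⅔ ℚP.^ 3)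
  16≤6⁶⅔³/6! = from-yes (ι (+ 16) ℚ.≤? 1/ 6 ! ℚ.* (ι (+ 6) ℚP.^ 6 ℚ.* ⅔ ℚP.^ 3))

  -- The term (6s)⁶/6! of the exponential series, where s² = ℓ ≥ ⅔ T.
  exp-6s : ∀ {s ℓ E} T → 0ℚ ℚ.≤ T → 𝟘 ≼ s → s ⊗ s ≋ ℓ → fr (T ℚ.* ⅔) ≼ ℓ → Exp (fr (ι (+ 6)) ⊗ s) E →
           fr (ι (+ 16) ℚ.* T ℚP.^ 3) ≼ E
  exp-6s T 0≤T 0≼s s²≋ℓ X≼ℓ h = ≼-trans
    (fr-mono (rescale (ι (+ 16)) (1/ 6 !) (ι (+ 6) ℚP.^ 6) T ⅔ 3 0≤T 16≤6⁶⅔³/6!))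
    (exp-lower 3 (ι (+ 6)) (T ℚ.* ⅔) (0≤ι 6) (0≤-* 0≤T 0≤⅔) 0≼s s²≋ℓ X≼ℓ h)

  binary-log : ∀ n → ∃[ t ] (2 ℕ.^ t ℕ.≤ suc n × suc n ℕ.< 2 ℕ.^ suc t)
  binary-log zero    = 0 , ℕ.≤-refl , ℕ.≤-refl
  binary-log (suc n) = let t , lo , hi = binary-log n in by-cases t lo hi (suc (suc n) ℕ.<? 2 ℕ.^ suc t)
    where
    by-cases : ∀ t → 2 ℕ.^ t ℕ.≤ suc n → suc n ℕ.< 2 ℕ.^ suc t → Dec (suc (suc n) ℕ.< 2 ℕ.^ suc t) →
               ∃[ t ] (2 ℕ.^ t ℕ.≤ suc (suc n) × suc (suc n) ℕ.< 2 ℕ.^ suc t)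
    by-cases t lo hi (yes lt) = t , ℕ.m≤n⇒m≤1+n lo , lt
    by-cases t lo hi (no ¬lt) = suc t , ℕ.≮⇒≥ ¬lt , ℕ.≤-<-trans hi (≡.subst (2 ℕ.^ suc t ℕ.<_) (ℕ.*-comm (2 ℕ.^ suc t) 2)
      (ℕ.m<m*n (2 ℕ.^ suc t) 2 {{ℕ.m^n≢0 2 (suc t)}} (ℕ.s≤s (ℕ.s≤s ℕ.z≤n))))

  -- With T = t + 1 ≥ 1 one has 2 (T + 1) ≤ 4 T, and squaring gives the constant 16.
  16nt³ : ∀ n t → 2 ℕ.* suc (suc t) ℕ.* (2 ℕ.* suc (suc t)) ℕ.* (n ℕ.* suc t) ℕ.≤ n ℕ.* (16 ℕ.* suc t ℕ.^ 3)
  16nt³ n t = ≡.subst₂ ℕ._≤_ ≡.refl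
    (solve 2 (λ n T → con 4 :* T :* (con 4 :* T) :* (n :* T) := n :* (con 16 :* (T :* (T :* (T :* con 1))))) ≡.refl n (suc t))
    (ℕ.*-monoˡ-≤ (n ℕ.* suc t) (ℕ.*-mono-≤ twice twice))
    where
    open +-*-Solver
    twice : 2 ℕ.* suc (suc t) ℕ.≤ 4 ℕ.* suc t
    twice = ≡.subst (2 ℕ.* suc (suc t) ℕ.≤_) (solve 1 (λ t → con 2 :* (con 2 :+ t) :+ con 2 :* t := con 4 :* (con 1 :+ t)) ≡.refl t)
      (ℕ.m≤m+n (2 ℕ.* suc (suc t)) (2 ℕ.* t))

  -- With q = c/s and ℓ = s² the exponent (1 + q) ℓ becomes ℓ + c s, so the power of n factors as n
  -- times exp (c s).
  split-exponent : ∀ q s ℓ ℓ′ c → q ⊗ s ≋ c → s ⊗ s ≋ ℓ → ℓ′ ≋ ℓ → (1ℝ + q) * ℓ′ ≋ ℓ ⊕ c ⊗ s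
  split-exponent q s ℓ ℓ′ c qs≋c s²≋ℓ ℓ′≋ℓ = begin
    (1ℝ + q) * ℓ′               ≈⟨ *≋⊗ {1ℝ + q} {ℓ′} {𝟙 ⊕ q} {s ⊗ s} 1+q (ℝR.trans ℓ′≋ℓ (ℝR.sym s²≋ℓ)) ⟩
    (𝟙 ⊕ q) ⊗ (s ⊗ s)           ≈⟨ ℝR.distribʳ (s ⊗ s) 𝟙 q ⟩
    𝟙 ⊗ (s ⊗ s) ⊕ q ⊗ (s ⊗ s)   ≈⟨ ℝR.+-cong (ℝR.trans (ℝR.*-identityˡ (s ⊗ s)) s²≋ℓ) (ℝR.sym (ℝR.*-assoc q s s)) ⟩
    ℓ ⊕ q ⊗ s ⊗ s               ≈⟨ ℝR.+-congˡ {ℓ} (ℝR.*-congʳ {s} qs≋c) ⟩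
    ℓ ⊕ c ⊗ s                   ∎
    where
    open import Relation.Binary.Reasoning.Setoid ℝR.setoid
    1+q : 1ℝ + q ≋ 𝟙 ⊕ q
    1+q = +≋⊕ {1ℝ} {q} {𝟙} {q} (ℝR.sym (fr≋ 1ℚ)) ℝR.refl

open RealExponential

theorem1 : (n : ℕ) → 2 ℕ.≤ n →
    (S : Fin n → ℂ) → Injective _≡_ _≈ℂ_ S →
    -- bound is n ^ (1 + 6 / √ (log n))
    (logn √logn 6/√logn bound : ℝ) →
    IsLog (fromℕ n) logn →
    IsSqrt logn √logn →
    IsQuotient (fromℕ 6) √logn 6/√logn →
    IsPower (fromℕ n) (1ℝ + 6/√logn) bound →
    AtMost bound (UnitRationalPair S)
theorem1 n@(suc m) 2≤n S S-inj ℓ s q bound log (0≤s , s²≈ℓ) (_ , qs≈6) (ℓ′ , log′ , power) xs uniq all =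
  ≼⇒≤ {fromℕ (length xs)} {bound} (≼-trans (≼-reflexive (fromℕ≋ (length xs))) (lower (binary-log m)))
  where
  exp-ℓ : Exp ℓ (fr (ι (+ n)))
  exp-ℓ = exp-cong ℝR.refl (fromℕ≋ n) (isExp⇒Exp ℓ (fromℕ n) log)
  1≼n : 𝟙 ≼ fr (ι (+ n))
  1≼n = fr-mono (ι-mono {1} {n} (ℕ.s≤s ℕ.z≤n))
  -- `IsPower` brings a logarithm of n of its own, which has to be identified with ℓ.
  ℓ′≋ℓ : ℓ′ ≋ ℓ
  ℓ′≋ℓ = exp-injective 1≼n (exp-cong ℝR.refl (fromℕ≋ n) (isExp⇒Exp ℓ′ (fromℕ n) log′)) exp-ℓ
  s²≋ℓ : s ⊗ s ≋ ℓ
  s²≋ℓ = ℝR.trans (⊗≋* s s) (mk≋ {s * s} {ℓ} s²≈ℓ)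
  0≼s : 𝟘 ≼ s
  0≼s = ≼-trans (≼-reflexive (fr≋ 0ℚ)) (≤⇒≼ {0ℝ} {s} 0≤s)
  qs≋6 : q ⊗ s ≋ fr (ι (+ 6))
  qs≋6 = ℝR.trans (⊗≋* q s) (ℝR.trans (mk≋ {q * s} {fromℕ 6} qs≈6) (fromℕ≋ 6))
  exponent : (1ℝ + q) * ℓ′ ≋ ℓ ⊕ fr (ι (+ 6)) ⊗ s
  exponent = split-exponent q s ℓ ℓ′ (fr (ι (+ 6))) qs≋6 s²≋ℓ ℓ′≋ℓ
  6s = fr (ι (+ 6)) ⊗ s
  E = proj₁ (exp-exists 6s)
  exp-E = proj₂ (exp-exists 6s)
  bound≋ : bound ≋ fr (ι (+ n)) ⊗ E
  bound≋ = exp-unique (exp-cong exponent ℝR.refl (isExp⇒Exp ((1ℝ + q) * ℓ′) bound power)) (exp-⊕ exp-ℓ exp-E)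
  lower : ∃[ t ] (2 ℕ.^ t ℕ.≤ n × n ℕ.< 2 ℕ.^ suc t) → fr (ι (+ length xs)) ≼ bound
  -- t = 0 would mean n < 2.
  lower (zero  , _  , hi) = contradiction 2≤n (ℕ.<⇒≱ hi)
  -- With T = t + 1 the chain is: number of pairs ≤ n · 16 T³ ≤ n · exp (6s), and the last product
  -- is the bound.
  lower (suc t , lo , hi) = ≼-trans (fr-mono (ι-mono (ℕ.≤-trans (unit-rational-pairs S S-inj (suc t) hi xs uniq all) (16nt³ n t))))
    (≼-trans (≼-reflexive (ℝR.trans (ℝR.reflexive (≡.cong fr ι-16nt³)) (fr-* (ι (+ n)) (ι (+ 16) ℚ.* ι (+ suc t) ℚP.^ 3))))
    (≼-trans (≼-⊗ (0≼fr (0≤ι n)) (0≼fr (0≤-* (0≤ι 16) (0≤pow (ι (+ suc t)) (0≤ι (suc t)) 3))) ≼-refl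
      (exp-6s (ι (+ suc t)) (0≤ι (suc t)) 0≼s s²≋ℓ (log-lower t n lo exp-ℓ) exp-E))
      (≼-reflexive (ℝR.sym bound≋))))
    where
    ι-16nt³ : ι (+ (n ℕ.* (16 ℕ.* suc t ℕ.^ 3))) ≡ ι (+ n) ℚ.* (ι (+ 16) ℚ.* ι (+ suc t) ℚP.^ 3)
    ι-16nt³ = ≡.trans (ι-ℕ* n (16 ℕ.* suc t ℕ.^ 3)) (≡.cong (ι (+ n) ℚ.*_) (≡.trans (ι-ℕ* 16 (suc t ℕ.^ 3)) (≡.cong (ι (+ 16) ℚ.*_) (ι-ℕ^ (suc t) 3))))
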